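{- Let $G$ be a finite simple graph and $\theta$ a real number. Let $H_1,\dots,H_q,Q_1,\dots,Q_m$ be all the connected components of $G\setminus A_\theta(G)$, where each $H_i$ is $\theta$-critical and $\textnormal{mult}(\theta,Q_j)=0$ for all $j$. Let $u,v$ be distinct vertices of $G$ such that (a) $u\in V(G)\setminus A_\theta(G)$ and $v\in V(Q_{j_0})$ for some $j_0$, or (b) $u,v\in V(H_{i_0})$ for some $i_0$, or (c) $\textnormal{mult}(\theta,G)\ge 2$, $u\in V(H_{i_1})$ and $v\in V(H_{i_2})$ for some $i_1\neq i_2$. Then $A_\theta(G)$ is a $\theta$-extreme set in $S_\theta(G)\setminus uv$, i.e. $\textnormal{mult}(\theta,S_\theta(G)\setminus(A_\theta(G)\cup\{u,v\}))=\textnormal{mult}(\theta,S_\theta(G)\setminus uv)+|A_\theta(G)|$.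
   Context: $\mu(G,x)=\sum_{r\ge 0}(-1)^r p(G,r)x^{|V(G)|-2r}$ is the matching polynomial ($p(G,r)$ = number of $r$-matchings, $p(G,0)=1$, empty graph has $\mu=1$); $\textnormal{mult}(\theta,G)$ is the multiplicity of $\theta$ as a root of $\mu(G,x)$ ($0$ if not a root). $G\setminus X$, $G\setminus uv$ denote vertex deletion. A vertex $u$ is $\theta$-essential if $\textnormal{mult}(\theta,G\setminus u)=\textnormal{mult}(\theta,G)-1$, and $\theta$-special if it is not $\theta$-essential but adjacent to a $\theta$-essential vertex; $A_\theta(G)$ is the set of $\theta$-special vertices. A connected graph is $\theta$-critical if every vertex is $\theta$-essential in it. $S_\theta(G)$ is the graph on $V(G)$ in which distinct $w,z$ are adjacent iff $wz\in E(G)$ or one of $w,z$ is in $A_\theta(G)$. A set $X$ is $\theta$-extreme in a graph $F$ if $\textnormal{mult}(\theta,F\setminus X)=\textnormal{mult}(\theta,F)+|X|$. -}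

module Defs where

open import Level using (0ℓ)
open import Data.Bool using (Bool; true; false; _∧_; _∨_; not; if_then_else_)
open import Data.Nat using (ℕ; zero; suc; ⌊_/2⌋; _∸_) renaming (_+_ to _+ℕ_)
open import Data.Nat.Properties using () renaming (_≟_ to _≟ℕ_)
open import Data.Integer using (ℤ; +_; -[1+_])
open import Data.Fin using (Fin; toℕ; _<?_)
open import Data.Fin.Properties using () renaming (_≟_ to _≟F_)
open import Data.Fin.Subset using (Subset; _∈_; _∉_; _⊆_; ⊤; ⁅_⁆; ∣_∣; ∁; _∪_) renaming (_-_ to _∖ᵥ_)
open import Data.Vec using (lookup)
open import Data.List using (List; []; _∷_; _++_; map; concatMap; filterᵇ; length; replicate; upTo; allFin; foldr)
open import Data.Product using (Σ; ∃; ∃-syntax; _×_; _,_)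
open import Data.Sum using (_⊎_)
open import Data.Empty using (⊥)
open import Data.Unit using () renaming (⊤ to Unit)
open import Relation.Nullary using (¬_; does)
open import Relation.Binary.PropositionalEquality using (_≡_)
open import Relation.Binary.Structures using (IsStrictTotalOrder)
open import Algebra.Bundles using (CommutativeRing)

-- The real numbers, axiomatised as a Dedekind-complete ordered field
-- (any model is isomorphic to ℝ).

record RealNumbers : Set₁ where
  field
    commRing : CommutativeRing 0ℓ 0ℓ
  open CommutativeRing commRing public
  field
    _<_ : Carrier → Carrier → Set
    isStrictTotalOrder : IsStrictTotalOrder _≈_ _<_
    0<1 : 0# < 1#
    +-monoˡ-< : ∀ {a b} c → a < b → (a + c) < (b + c)
    *-pos : ∀ {a b} → 0# < a → 0# < b → 0# < (a * b)
    inverse : ∀ a → ¬ (a ≈ 0#) → ∃[ b ] ((a * b) ≈ 1#)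
  _≤ᴿ_ : Carrier → Carrier → Set
  a ≤ᴿ b = (a < b) ⊎ (a ≈ b)
  field
    lub : (P : Carrier → Set) → ∃[ x ] P x → ∃[ b ] (∀ x → P x → x ≤ᴿ b) →
          ∃[ s ] ((∀ x → P x → x ≤ᴿ s) × (∀ b → (∀ x → P x → x ≤ᴿ b) → s ≤ᴿ b))

-- Polynomials over the reals, as lists of coefficients (ascending powers).

module Poly (ℝ : RealNumbers) where
  open RealNumbers ℝ

  Pol : Set
  Pol = List Carrier

  _+P_ : Pol → Pol → Pol
  [] +P q = q
  (a ∷ p) +P [] = a ∷ p
  (a ∷ p) +P (b ∷ q) = (a + b) ∷ (p +P q)

  scale : Carrier → Pol → Pol
  scale c = map (c *_)

  _*P_ : Pol → Pol → Pol
  [] *P q = []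
  (a ∷ p) *P q = scale a q +P (0# ∷ (p *P q))

  linear : Carrier → Pol
  linear θ = (- θ) ∷ 1# ∷ []

  _^P_ : Pol → ℕ → Pol
  p ^P zero = 1# ∷ []
  p ^P suc k = p *P (p ^P k)

  eval : Pol → Carrier → Carrier
  eval [] x = 0#
  eval (a ∷ p) x = a + (x * eval p x)

  AllZero : Pol → Set
  AllZero [] = Unit
  AllZero (a ∷ p) = (a ≈ 0#) × AllZero p

  _≈P_ : Pol → Pol → Set
  [] ≈P q = AllZero q
  (a ∷ p) ≈P [] = AllZero (a ∷ p)
  (a ∷ p) ≈P (b ∷ q) = (a ≈ b) × (p ≈P q)

  -- θ is a root of multiplicity exactly k of f
  -- (i.e. f = (x - θ)^k g with g(θ) ≠ 0; k = 0 means "not a root").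
  -- Note this forces f ≠ 0.
  RootMult : Carrier → Pol → ℕ → Set
  RootMult θ f k = ∃[ g ] ((f ≈P ((linear θ ^P k) *P g)) × ¬ (eval g θ ≈ 0#))

  fromℕ : ℕ → Carrier
  fromℕ zero = 0#
  fromℕ (suc n) = 1# + fromℕ n

  fromℤ : ℤ → Carrier
  fromℤ (+ n) = fromℕ n
  fromℤ -[1+ n ] = - fromℕ (suc n)

  monomial : Carrier → ℕ → Pol
  monomial c k = replicate k 0# ++ (c ∷ [])

Adj : ℕ → Set
Adj n = Fin n → Fin n → Bool

record SimpleGraph (n : ℕ) : Set where
  field
    adj : Adj n
    sym : ∀ i j → adj i j ≡ adj j i
    irrefl : ∀ i → adj i i ≡ false

inS : ∀ {n} → Subset n → Fin n → Bool
inS S i = lookup S i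

_≡ᵇ_ : ∀ {n} → Fin n → Fin n → Bool
i ≡ᵇ j = does (i ≟F j)

edges : ∀ {n} → Adj n → Subset n → List (Fin n × Fin n)
edges {n} E S =
  concatMap (λ i → concatMap (λ j →
     if does (i <? j) ∧ inS S i ∧ inS S j ∧ E i j then (i , j) ∷ [] else [])
     (allFin n)) (allFin n)

sublists : ∀ {A : Set} → List A → List (List A)
sublists [] = [] ∷ []
sublists (x ∷ xs) = let r = sublists xs in r ++ map (x ∷_) r

disjointE : ∀ {n} → Fin n × Fin n → Fin n × Fin n → Bool
disjointE (a , b) (c , d) = not (a ≡ᵇ c ∨ a ≡ᵇ d ∨ b ≡ᵇ c ∨ b ≡ᵇ d)

isMatching : ∀ {n} → List (Fin n × Fin n) → Bool
isMatching [] = true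
isMatching (e ∷ es) = foldr (λ f b → disjointE e f ∧ b) true es ∧ isMatching es

numMatchings : ∀ {n} → Adj n → Subset n → ℕ → ℕ
numMatchings E S r =
  length (filterᵇ (λ M → isMatching M ∧ does (length M ≟ℕ r))
                   (sublists (edges E S)))

module Matching (ℝ : RealNumbers) where
  open RealNumbers ℝ
  open Poly ℝ

  signed : ℕ → ℕ → ℤ
  signed zero p = + p
  signed (suc zero) zero = + 0
  signed (suc zero) (suc p) = -[1+ p ]
  signed (suc (suc r)) p = signed r p

  μ : ∀ {n} → Adj n → Subset n → Pol
  μ E S = foldr (λ r acc →
             monomial (fromℤ (signed r (numMatchings E S r))) (∣ S ∣ ∸ (r +ℕ r)) +P acc)
           [] (upTo (suc ⌊ ∣ S ∣ /2⌋))


  Mult : Carrier → ∀ {n} → Adj n → Subset n → ℕ → Set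
  Mult θ E S k = RootMult θ (μ E S) k

  Essential : Carrier → ∀ {n} → Adj n → Subset n → Fin n → Set
  Essential θ E S u = u ∈ S × ∃[ k ] (Mult θ E S (suc k) × Mult θ E (S ∖ᵥ u) k)

  Special : Carrier → ∀ {n} → Adj n → Subset n → Fin n → Set
  Special θ E S u = u ∈ S × ¬ Essential θ E S u ×
                    ∃[ w ] (Essential θ E S w × E u w ≡ true)

  data Walk {n} (E : Adj n) (S : Subset n) : Fin n → Fin n → Set where
    here : ∀ {x} → x ∈ S → Walk E S x x
    step : ∀ {x y z} → x ∈ S → E x y ≡ true → Walk E S y z → Walk E S x z

  Connected : ∀ {n} → Adj n → Subset n → Set
  Connected E S = ∃[ x ] (x ∈ S) × (∀ x y → x ∈ S → y ∈ S → Walk E S x y)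

  Component : ∀ {n} → Adj n → Subset n → Subset n → Set
  Component E T C = C ⊆ T × Connected E C ×
                    (∀ x y → x ∈ C → y ∈ T → E x y ≡ true → y ∈ C)

  Critical : Carrier → ∀ {n} → Adj n → Subset n → Set
  Critical θ E C = Connected E C × (∀ u → u ∈ C → Essential θ E C u)

  -- S_θ(G) adjacency, given the set A (= A_θ(G))
  SAdj : ∀ {n} → Adj n → Subset n → Adj n
  SAdj E A w z = not (w ≡ᵇ z) ∧ (E w z ∨ inS A w ∨ inS A z)

{-# OPTIONS --safe #-}

-- Expand every matching polynomial as a power series in ε = x - θ; mult(θ, ·)
-- becomes the order of vanishing. Two consequences of the vertex recursion
-- μ(S) = x μ(S-u) - Σ_{z~u} μ(S-u-z), valid for arbitrary vertex weights in
-- place of x, drive the proof: with μ_u = μ(S-u), the polynomial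
-- μ_u μ_v - μ μ_uv is a sum of squares over the paths from u to v, and the
-- Wronskian μ_u μ' - μ_u' μ is a sum of squares over the paths starting in u.
-- The latter gives interlacing, and that a neighbour w of a vertex essential
-- in F - w satisfies mult(F - w) = mult(F) + 1. The former, with the weight of
-- a third vertex moved, excludes the configurations that would violate the
-- stability lemma for special vertices or Gallai's lemma. Hence
-- mult(G - A) = mult(G) + |A|, and mult(G - A - u - v) ≥ |A| in each of the
-- cases (a), (b), (c). In S_θ(G) the vertices of A are joined to everything:
-- put back one by one, each has an essential neighbour as long as the
-- multiplicity is positive, so each lowers it by exactly one.

module Submission where

-- From each expansion only the lowest coefficient is read off. A sum of squares of series has even
-- order and a positive lowest coefficient, and its terms cannot cancel. So μ_u μ_v - μ μ_uv never
-- has odd order, which forbids a deletion to leave a multiplicity unchanged in the configurations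
-- that matter. Where the orders have the right parity, this says nothing. There the weight of a
-- third vertex w becomes x + tε: the difference keeps its positivity for every real t, while the
-- coefficient in question is affine in t with nonzero slope and takes the value -1. This is why the
-- path identity is wanted for arbitrary weights although the theorem knows only the weight x. The
-- final count: in (a) the vertex of Q_j costs nothing and the other at most one; in (b) a critical
-- component has multiplicity exactly 1, so the pair costs at most one; in (c) the pair costs at
-- most two. The surplus mult(G) in mult(G - A) = mult(G) + |A| pays for it: a special vertex has an
-- essential neighbour, so mult(G) ≥ 1 unless A is empty, and (c) assumes mult(G) ≥ 2.

open import Defs
open import Level using (0ℓ)
open import Data.Bool using (Bool; true; false; _∧_; _∨_; not; if_then_else_)
open import Data.Bool.Properties using (∧-assoc; ∧-zeroʳ; ∧-identityʳ; ∨-comm; ∨-zeroʳ; ∨-identityʳ)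
open import Data.Nat using (ℕ; zero; suc; _≤_; z≤n; s≤s; ⌊_/2⌋; _∸_) renaming (_+_ to _+ℕ_; _*_ to _*ℕ_; _<_ to _<ℕ_; _≟_ to _≟ℕ_)
import Data.Nat.Properties as ℕₚ
open import Data.Nat.Tactic.RingSolver using (solve-∀)
open import Data.Fin using (Fin; zero; suc; _<?_)
open import Data.Fin.Properties using (any?; <-cmp) renaming (_≟_ to _≟F_)
open import Data.Fin.Subset using (Subset; _∈_; _∉_; ⊤; ⁅_⁆; ∣_∣; ∁; _∪_; _∩_; _-_) renaming (⊥ to ∅)
open import Data.Fin.Subset.Properties using (p─⊥≡p; p─q⊆p; p─x─y≡p─y─x; x∈p∧x≢y⇒x∈p-y; x∈p∩q⁻; ∈⊤; x∈∁p⇒x∉p; x∉p⇒x∈∁p; _∈?_; nonempty?; Empty-unique; ∣⊥∣≡0)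
open import Data.List using (List; []; _∷_; _++_; map; concatMap; filterᵇ; length; foldr; tabulate; allFin; applyUpTo)
open import Data.List.Properties using (concatMap-cong; filter-++; length-filter)
open import Data.Vec using ([]; _∷_; lookup; here; there)
open import Data.Vec.Properties using (lookup⇒[]=; []=⇒lookup; lookup-map; lookup-zipWith)
open import Data.Maybe using (Maybe; just; nothing)
open import Data.Product using (∃-syntax; _×_; _,_; proj₁; proj₂)
open import Data.Sum using (_⊎_; inj₁; inj₂)
open import Data.Empty using (⊥; ⊥-elim)
open import Data.Unit using (tt)
open import Function using (_∘_; id)
open import Relation.Nullary using (¬_; Dec; yes; no; does; _×-dec_)
open import Relation.Nullary.Decidable using (dec-true; dec-false)
open import Relation.Binary.Definitions using (tri<; tri≈; tri>)
open import Relation.Binary.Structures using (IsStrictTotalOrder)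
open import Relation.Binary.PropositionalEquality using (_≡_; _≢_; module ≡-Reasoning) renaming (refl to ≡-refl; sym to ≡-sym; trans to ≡-trans; cong to ≡-cong; cong₂ to ≡-cong₂; subst to ≡-subst)
open import Algebra.Bundles using (CommutativeRing; RawRing)
open import Algebra.Solver.Ring.AlmostCommutativeRing using (_-Raw-AlmostCommutative⟶_; fromCommutativeRing)
import Algebra.Properties.AbelianGroup as AbelianGroupProperties
import Algebra.Properties.Ring as RingProperties
import Algebra.Properties.Semiring.Mult as SemiringMult
import Algebra.Properties.Semiring.Sum as SemiringSum
import Algebra.Solver.Ring as RingSolver
import Algebra.Solver.Ring.NaturalCoefficients.Default as SemiringSolver
import Relation.Binary.Reasoning.Setoid as SetoidReasoning

-- A ring solver for arbitrary commutative rings: the coefficients are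
-- formal differences of natural numbers, for which equality is decidable.

module DifferenceSolver (R : CommutativeRing 0ℓ 0ℓ) where
  open CommutativeRing R
  open SetoidReasoning setoid
  open RingProperties ring using (-‿distribˡ-*; -‿distribʳ-*; -‿involutive; -0#≈0#)
  open AbelianGroupProperties +-abelianGroup using (⁻¹-∙-comm)
  open SemiringMult semiring using (×-homo-+; ×1-homo-*) renaming (_×_ to _·_)
  private module S = SemiringSolver commutativeSemiring

  private
    differences : RawRing 0ℓ 0ℓ
    differences = record
      { Carrier = ℕ × ℕ
      ; _≈_ = _≡_
      ; _+_ = λ { (a , b) (c , d) → (a +ℕ c , b +ℕ d) }
      ; _*_ = λ { (a , b) (c , d) → (a *ℕ c +ℕ b *ℕ d , a *ℕ d +ℕ b *ℕ c) }
      ; -_ = λ { (a , b) → (b , a) }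
      ; 0# = 0 , 0
      ; 1# = 1 , 0
      }

    ⟦_⟧ : ℕ × ℕ → Carrier
    ⟦ a , b ⟧ = a · 1# + - (b · 1#)

    +-hom : ∀ a b c d → ⟦ a +ℕ c , b +ℕ d ⟧ ≈ ⟦ a , b ⟧ + ⟦ c , d ⟧
    +-hom a b c d = begin
      (a +ℕ c) · 1# + - ((b +ℕ d) · 1#)
        ≈⟨ +-cong (×-homo-+ 1# a c) (-‿cong (×-homo-+ 1# b d)) ⟩
      (a · 1# + c · 1#) + - (b · 1# + d · 1#)
        ≈⟨ +-congˡ (⁻¹-∙-comm _ _) ⟨
      (a · 1# + c · 1#) + (- (b · 1#) + - (d · 1#))
        ≈⟨ S.solve 4 (λ a b c d → (a S.:+ c) S.:+ (b S.:+ d) S.:= (a S.:+ b) S.:+ (c S.:+ d)) refl _ _ _ _ ⟩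
      ⟦ a , b ⟧ + ⟦ c , d ⟧ ∎

    split : ∀ a b c d → (a *ℕ c +ℕ b *ℕ d) · 1# ≈ (a · 1#) * (c · 1#) + (b · 1#) * (d · 1#)
    split a b c d = trans (×-homo-+ 1# (a *ℕ c) (b *ℕ d)) (+-cong (×1-homo-* a c) (×1-homo-* b d))

    *-hom : ∀ a b c d → ⟦ a *ℕ c +ℕ b *ℕ d , a *ℕ d +ℕ b *ℕ c ⟧ ≈ ⟦ a , b ⟧ * ⟦ c , d ⟧
    *-hom a b c d = begin
      (a *ℕ c +ℕ b *ℕ d) · 1# + - ((a *ℕ d +ℕ b *ℕ c) · 1#)
        ≈⟨ +-cong (split a b c d) (-‿cong (split a b d c)) ⟩
      (A * C + B * D) + - (A * D + B * C)
        ≈⟨ +-congˡ (⁻¹-∙-comm _ _) ⟨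
      (A * C + B * D) + (- (A * D) + - (B * C))
        ≈⟨ +-cong (+-congˡ (sym BD)) (+-cong (-‿distribʳ-* A D) (-‿distribˡ-* B C)) ⟩
      (A * C + (- B) * (- D)) + (A * (- D) + (- B) * C)
        ≈⟨ S.solve 4 (λ a b c d → (a S.:* c S.:+ b S.:* d) S.:+ (a S.:* d S.:+ b S.:* c)
                                    S.:= (a S.:+ b) S.:* (c S.:+ d)) refl A (- B) C (- D) ⟩
      (A + - B) * (C + - D) ∎
      where
      A = a · 1#
      B = b · 1#
      C = c · 1#
      D = d · 1#
      BD : (- B) * (- D) ≈ B * D
      BD = begin
        (- B) * (- D) ≈⟨ -‿distribˡ-* B (- D) ⟨
        - (B * (- D)) ≈⟨ -‿cong (-‿distribʳ-* B D) ⟨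
        - (- (B * D)) ≈⟨ -‿involutive _ ⟩
        B * D ∎

    neg-hom : ∀ a b → ⟦ b , a ⟧ ≈ - ⟦ a , b ⟧
    neg-hom a b = begin
      b · 1# + - (a · 1#)         ≈⟨ +-comm _ _ ⟩
      - (a · 1#) + b · 1#         ≈⟨ +-congˡ (-‿involutive _) ⟨
      - (a · 1#) + - - (b · 1#)   ≈⟨ ⁻¹-∙-comm _ _ ⟩
      - (a · 1# + - (b · 1#))     ∎

    morphism : differences -Raw-AlmostCommutative⟶ fromCommutativeRing R
    morphism = record
      { ⟦_⟧ = ⟦_⟧
      ; +-homo = λ { (a , b) (c , d) → +-hom a b c d }
      ; *-homo = λ { (a , b) (c , d) → *-hom a b c d }
      ; -‿homo = λ { (a , b) → neg-hom a b }
      ; 0-homo = -‿inverseʳ 0#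
      ; 1-homo = trans (+-cong (+-identityʳ 1#) -0#≈0#) (+-identityʳ 1#)
      }

    add-both : ∀ a b c → ⟦ a +ℕ c , b +ℕ c ⟧ ≈ ⟦ a , b ⟧
    add-both a b c = trans (+-hom a b c c) (trans (+-congˡ (-‿inverseʳ _)) (+-identityʳ _))

    -- Pairs are compared by cross addition, as formal differences; the propositional `_≈_` of
    -- `differences` would keep (1 , 1) and (0 , 0) apart.
    weaklyEqual : ∀ p q → Maybe (⟦ p ⟧ ≈ ⟦ q ⟧)
    weaklyEqual (a , b) (c , d) with a +ℕ d ≟ℕ c +ℕ b
    ... | no _ = nothing
    ... | yes eq = just (begin
      ⟦ a , b ⟧             ≈⟨ add-both a b d ⟨
      ⟦ a +ℕ d , b +ℕ d ⟧   ≡⟨ ≡-cong (λ x → ⟦ x , b +ℕ d ⟧) eq ⟩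
      ⟦ c +ℕ b , b +ℕ d ⟧   ≡⟨ ≡-cong (λ x → ⟦ c +ℕ b , x ⟧) (ℕₚ.+-comm b d) ⟩
      ⟦ c +ℕ b , d +ℕ b ⟧   ≈⟨ add-both c d b ⟩
      ⟦ c , d ⟧             ∎)

  open RingSolver differences (fromCommutativeRing R) morphism weaklyEqual public
    using (solve; _:=_; _:+_; _:*_; _:-_; :-_)

-- Stated for an arbitrary ring: instantiated at series, the solver would
-- unfold convolutions.

module Identities (R : CommutativeRing 0ℓ 0ℓ) where
  open CommutativeRing R
  open DifferenceSolver R
  open RingProperties ring using (-0#≈0#)

  +-*-+ : ∀ a b x p q → (a + b) + x * (p + q) ≈ (a + x * p) + (b + x * q)
  +-*-+ = solve 5 (λ a b x p q → (a :+ b) :+ x :* (p :+ q) := (a :+ x :* p) :+ (b :+ x :* q)) refl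

  scale-horner : ∀ c a x p → c * a + x * (c * p) ≈ c * (a + x * p)
  scale-horner = solve 4 (λ c a x p → c :* a :+ x :* (c :* p) := c :* (a :+ x :* p)) refl

  horner-* : ∀ a x p q → a * q + x * (p * q) ≈ (a + x * p) * q
  horner-* = solve 4 (λ a x p q → a :* q :+ x :* (p :* q) := (a :+ x :* p) :* q) refl

  *-swap : ∀ x c p → x * (c * p) ≈ c * (x * p)
  *-swap = solve 3 (λ x c p → x :* (c :* p) := c :* (x :* p)) refl

  +-cancel-right : ∀ b a → b ≈ (b + a) + - a
  +-cancel-right = solve 2 (λ b a → b := (b :+ a) :- a) refl

  +-cancel-left : ∀ a b → (a + b) + - a ≈ b
  +-cancel-left = solve 2 (λ a b → (a :+ b) :- a := b) refl

  synthetic-division : ∀ a x t q e → a + x * ((x + - t) * q + e) ≈ (x + - t) * (e + x * q) + (a + t * e)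
  synthetic-division = solve 5 (λ a x t q e →
    a :+ x :* ((x :- t) :* q :+ e) := (x :- t) :* (e :+ x :* q) :+ (a :+ t :* e)) refl

  neg-difference-zero : ∀ x c y → x * (c * y) ≈ (c * (x * y)) + - 0#
  neg-difference-zero x c y = trans (*-swap x c y) (trans (sym (+-identityʳ _)) (+-congˡ (sym -0#≈0#)))

  *-difference : ∀ x c y q → x * (c * y + - q) ≈ c * (x * y) + - (x * q)
  *-difference = solve 4 (λ x c y q → x :* (c :* y :- q) := c :* (x :* y) :- x :* q) refl

  subtract-sum : ∀ a b c → a + - (b + c) ≈ (a + - b) + - c
  subtract-sum = solve 3 (λ a b c → a :- (b :+ c) := (a :- b) :- c) refl

  neg-+-interchange : ∀ a b c d → (a + b) + - (c + d) ≈ (a + - c) + (b + - d)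
  neg-+-interchange = solve 4 (λ a b c d → (a :+ b) :- (c :+ d) := (a :- c) :+ (b :- d)) refl

  -- The weight `y` of the expanded vertex cancels, which makes the path expansion of `D` valid for
  -- arbitrary weights.
  rayleigh-step : ∀ y a v s t →
    a * (y * v + - t) + - ((y * a + - s) * v) ≈ s * v + - (a * t)
  rayleigh-step = solve 5 (λ y a v s t →
    a :* (y :* v :- t) :- (y :* a :- s) :* v := s :* v :- a :* t) refl

  shift-self : ∀ y p s σ → (y * p + - σ) + s * p ≈ (y + s) * p + - σ
  shift-self = solve 4 (λ y p s σ → (y :* p :- σ) :+ s :* p := (y :+ s) :* p :- σ) refl

  shift-other : ∀ y a σ s b τ → (y * a + - σ) + s * (y * b + - τ) ≈ y * (a + s * b) + - (σ + s * τ)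
  shift-other = solve 6 (λ y a σ s b τ →
    (y :* a :- σ) :+ s :* (y :* b :- τ) := y :* (a :+ s :* b) :- (σ :+ s :* τ)) refl

  -- The weight `x` cancels and survives only through its derivative `e`, which becomes the
  -- coefficient of the square `p * p`.
  wronskian-step : ∀ e x p p′ σ σ′ →
    p * ((e * p + x * p′) + - σ′) + - ((x * p + - σ) * p′) ≈ e * (p * p) + (σ * p′ + - (p * σ′))
  wronskian-step = solve 6 (λ e x p p′ σ σ′ →
    p :* ((e :* p :+ x :* p′) :- σ′) :- (x :* p :- σ) :* p′ := e :* (p :* p) :+ (σ :* p′ :- p :* σ′)) refl

  derivative-step : ∀ e x p d σ → (e * p + x * (e * d)) + - (e * σ) ≈ e * (p + (x * d + - σ))
  derivative-step = solve 5 (λ e x p d σ →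
    (e :* p :+ x :* (e :* d)) :- e :* σ := e :* (p :+ (x :* d :- σ))) refl

  product-step : ∀ x p q σ → x * (p * q) + - (σ * q) ≈ (x * p + - σ) * q
  product-step = solve 4 (λ x p q σ → x :* (p :* q) :- σ :* q := (x :* p :- σ) :* q) refl

  obstruction-value : ∀ α β c w d i → w * d * i ≈ 1# →
    α * β + - ((c + ((α * β + 1# + - (c * d)) * i) * w) * d) ≈ - 1#
  obstruction-value α β c w d i eq = trans
    (solve 7 (λ α β c w d i o →
       α :* β :- (c :+ ((α :* β :+ o :- c :* d) :* i) :* w) :* d :=
       α :* β :- (c :* d :+ (α :* β :+ o :- c :* d) :* (w :* d :* i))) refl α β c w d i 1#)
    (trans (+-congˡ (-‿cong (+-congˡ (trans (*-congˡ eq) (*-identityʳ _)))))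
      (solve 3 (λ p cd o → p :- (cd :+ (p :+ o :- cd)) := :- o) refl (α * β) (c * d) 1#))

  -- For `f` = l this is the lowest coefficient of a Wronskian of series of orders l and l + 1: the
  -- operator ε d/dε multiplies leading coefficients by their orders, and these differ by 1, so
  -- nothing is lost.
  euler-value : ∀ p q f → p * ((1# + f) * q) + - ((f * p) * q) ≈ p * q
  euler-value p q f = trans (solve 4 (λ p q f o → p :* ((o :+ f) :* q) :- (f :* p) :* q := p :* (o :* q)) refl p q f 1#)
    (*-congˡ (*-identityˡ q))

-- Formal power series over a commutative ring

module PowerSeries (R : CommutativeRing 0ℓ 0ℓ) where
  open CommutativeRing R hiding (zero)
  open SetoidReasoning setoid
  open DifferenceSolver R

  Series : Set
  Series = ℕ → Carrier

  infix 4 _≐_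
  _≐_ : Series → Series → Set
  f ≐ g = ∀ n → f n ≈ g n

  -- A record, so that unification does not compare coefficients.
  infix 4 _≋_
  record _≋_ (f g : Series) : Set where
    constructor pointwise
    field at : f ≐ g
  open _≋_ public

  tail : Series → Series
  tail f n = f (suc n)

  const : Carrier → Series
  const a zero = a
  const a (suc n) = 0#

  infixl 7 _⊛_
  infixl 6 _⊞_

  _⊞_ : Series → Series → Series
  (f ⊞ g) n = f n + g n

  -- The Cauchy product by recursion on the index, peeling the head of the left factor: no finite
  -- sums appear, and each law is an induction on the index with the series varying.
  _⊛_ : Series → Series → Series
  (f ⊛ g) zero = f 0 * g 0
  (f ⊛ g) (suc n) = f 0 * g (suc n) + (tail f ⊛ g) n

  ⊟_ : Series → Series
  (⊟ f) n = - f n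

  0ₛ 1ₛ ε : Series
  0ₛ _ = 0#
  1ₛ = const 1#
  ε zero = 0#
  ε (suc n) = 1ₛ n

  ⊛-cong : ∀ {f f′ g g′} → f ≐ f′ → g ≐ g′ → f ⊛ g ≐ f′ ⊛ g′
  ⊛-cong p q zero = *-cong (p 0) (q 0)
  ⊛-cong p q (suc n) = +-cong (*-cong (p 0) (q (suc n))) (⊛-cong (λ i → p (suc i)) q n)

  ⊛-distribʳ : ∀ h f g → (f ⊞ g) ⊛ h ≐ (f ⊛ h) ⊞ (g ⊛ h)
  ⊛-distribʳ h f g zero = distribʳ _ _ _
  ⊛-distribʳ h f g (suc n) = begin
    (f 0 + g 0) * h (suc n) + ((tail f ⊞ tail g) ⊛ h) n
      ≈⟨ +-cong (distribʳ _ _ _) (⊛-distribʳ h (tail f) (tail g) n) ⟩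
    (f 0 * h (suc n) + g 0 * h (suc n)) + ((tail f ⊛ h) n + (tail g ⊛ h) n)
      ≈⟨ solve 4 (λ a b c d → (a :+ b) :+ (c :+ d) := (a :+ c) :+ (b :+ d)) refl _ _ _ _ ⟩
    (f 0 * h (suc n) + (tail f ⊛ h) n) + (g 0 * h (suc n) + (tail g ⊛ h) n) ∎

  ⊛-zeroˡ : ∀ g → 0ₛ ⊛ g ≐ 0ₛ
  ⊛-zeroˡ g zero = zeroˡ _
  ⊛-zeroˡ g (suc n) = trans (+-cong (zeroˡ _) (⊛-zeroˡ g n)) (+-identityˡ _)

  -- The mirror image of the defining recursion, peeling the right factor; commutativity follows
  -- from it by induction.
  ⊛-sucʳ : ∀ f g n → (f ⊛ g) (suc n) ≈ f (suc n) * g 0 + (f ⊛ tail g) n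
  ⊛-sucʳ f g zero = +-comm _ _
  ⊛-sucʳ f g (suc n) = begin
    f 0 * g (suc (suc n)) + (tail f ⊛ g) (suc n)
      ≈⟨ +-congˡ (⊛-sucʳ (tail f) g n) ⟩
    f 0 * g (suc (suc n)) + (f (suc (suc n)) * g 0 + (tail f ⊛ tail g) n)
      ≈⟨ solve 3 (λ a b c → a :+ (b :+ c) := b :+ (a :+ c)) refl _ _ _ ⟩
    f (suc (suc n)) * g 0 + (f 0 * g (suc (suc n)) + (tail f ⊛ tail g) n) ∎

  ⊛-comm : ∀ f g → f ⊛ g ≐ g ⊛ f
  ⊛-comm f g zero = *-comm _ _
  ⊛-comm f g (suc n) = begin
    f 0 * g (suc n) + (tail f ⊛ g) n ≈⟨ +-cong (*-comm _ _) (⊛-comm (tail f) g n) ⟩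
    g (suc n) * f 0 + (g ⊛ tail f) n ≈⟨ ⊛-sucʳ g f n ⟨
    (g ⊛ f) (suc n) ∎

  ⊛-distribˡ : ∀ h f g → h ⊛ (f ⊞ g) ≐ (h ⊛ f) ⊞ (h ⊛ g)
  ⊛-distribˡ h f g n = begin
    (h ⊛ (f ⊞ g)) n           ≈⟨ ⊛-comm h (f ⊞ g) n ⟩
    ((f ⊞ g) ⊛ h) n           ≈⟨ ⊛-distribʳ h f g n ⟩
    (f ⊛ h) n + (g ⊛ h) n     ≈⟨ +-cong (⊛-comm f h n) (⊛-comm g h n) ⟩
    (h ⊛ f) n + (h ⊛ g) n     ∎

  scale-⊛ : ∀ a f g n → ((λ i → a * f i) ⊛ g) n ≈ a * (f ⊛ g) n
  scale-⊛ a f g zero = *-assoc _ _ _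
  scale-⊛ a f g (suc n) = begin
    (a * f 0) * g (suc n) + ((λ i → a * f (suc i)) ⊛ g) n
      ≈⟨ +-cong (*-assoc _ _ _) (scale-⊛ a (tail f) g n) ⟩
    a * (f 0 * g (suc n)) + a * (tail f ⊛ g) n
      ≈⟨ distribˡ _ _ _ ⟨
    a * (f 0 * g (suc n) + (tail f ⊛ g) n) ∎

  ⊛-assoc : ∀ f g h → (f ⊛ g) ⊛ h ≐ f ⊛ (g ⊛ h)
  ⊛-assoc f g h zero = *-assoc _ _ _
  ⊛-assoc f g h (suc n) = begin
    (f 0 * g 0) * h (suc n) + (((λ i → f 0 * g (suc i)) ⊞ (tail f ⊛ g)) ⊛ h) n
      ≈⟨ +-cong (*-assoc _ _ _) (⊛-distribʳ h _ (tail f ⊛ g) n) ⟩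
    f 0 * (g 0 * h (suc n)) + (((λ i → f 0 * g (suc i)) ⊛ h) n + ((tail f ⊛ g) ⊛ h) n)
      ≈⟨ +-congˡ (+-cong (scale-⊛ (f 0) (tail g) h n) (⊛-assoc (tail f) g h n)) ⟩
    f 0 * (g 0 * h (suc n)) + (f 0 * (tail g ⊛ h) n + (tail f ⊛ (g ⊛ h)) n)
      ≈⟨ +-assoc _ _ _ ⟨
    (f 0 * (g 0 * h (suc n)) + f 0 * (tail g ⊛ h) n) + (tail f ⊛ (g ⊛ h)) n
      ≈⟨ +-congʳ (distribˡ _ _ _) ⟨
    f 0 * (g ⊛ h) (suc n) + (tail f ⊛ (g ⊛ h)) n ∎

  const-⊛ : ∀ a g n → (const a ⊛ g) n ≈ a * g n
  const-⊛ a g zero = refl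
  const-⊛ a g (suc n) = trans (+-congˡ (⊛-zeroˡ g n)) (+-identityʳ _)

  ⊛-identityˡ : ∀ g → 1ₛ ⊛ g ≐ g
  ⊛-identityˡ g n = trans (const-⊛ 1# g n) (*-identityˡ _)

  ε-⊛-zero : ∀ g → (ε ⊛ g) 0 ≈ 0#
  ε-⊛-zero g = zeroˡ _

  ε-⊛-suc : ∀ g n → (ε ⊛ g) (suc n) ≈ g n
  ε-⊛-suc g n = trans (+-cong (zeroˡ _) (⊛-identityˡ g n)) (+-identityˡ _)

  seriesRing : CommutativeRing 0ℓ 0ℓ
  seriesRing = record
    { Carrier = Series ; _≈_ = _≋_ ; _+_ = _⊞_ ; _*_ = _⊛_ ; -_ = ⊟_ ; 0# = 0ₛ ; 1# = 1ₛ
    ; isCommutativeRing = record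
      { isRing = record
        { +-isAbelianGroup = record
          { isGroup = record
            { isMonoid = record
              { isSemigroup = record
                { isMagma = record
                  { isEquivalence = record
                    { refl = pointwise (λ _ → refl)
                    ; sym = λ p → pointwise (λ n → sym (at p n))
                    ; trans = λ p q → pointwise (λ n → trans (at p n) (at q n))
                    }
                  ; ∙-cong = λ p q → pointwise (λ n → +-cong (at p n) (at q n))
                  }
                ; assoc = λ f g h → pointwise (λ n → +-assoc _ _ _)
                }
              ; identity = (λ f → pointwise (λ n → +-identityˡ _)) , (λ f → pointwise (λ n → +-identityʳ _))
              }
            ; inverse = (λ f → pointwise (λ n → -‿inverseˡ _)) , (λ f → pointwise (λ n → -‿inverseʳ _))
            ; ⁻¹-cong = λ p → pointwise (λ n → -‿cong (at p n))
            }
          ; comm = λ f g → pointwise (λ n → +-comm _ _)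
          }
        ; *-cong = λ p q → pointwise (⊛-cong (at p) (at q))
        ; *-assoc = λ f g h → pointwise (⊛-assoc f g h)
        ; *-identity = (λ g → pointwise (⊛-identityˡ g)) , (λ g → pointwise (λ n → trans (⊛-comm g 1ₛ n) (⊛-identityˡ g n)))
        ; distrib = (λ h f g → pointwise (⊛-distribˡ h f g)) , (λ h f g → pointwise (⊛-distribʳ h f g))
        }
      ; *-comm = λ f g → pointwise (⊛-comm f g)
      }
    }

-- Real series: orders of vanishing, a derivation, positivity cones

module RealSeries (ℝ : RealNumbers) where
  open RealNumbers ℝ hiding (zero)
  open IsStrictTotalOrder isStrictTotalOrder public using (_≟_; compare)
    renaming (trans to <-trans; irrefl to <-irrefl; <-respˡ-≈ to <-respˡ; <-respʳ-≈ to <-respʳ)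
  open PowerSeries commRing public
  open Poly ℝ using (fromℕ)
  open DifferenceSolver commRing using (solve; _:=_; _:+_; _:*_; :-_)
  open RingProperties ring using (-‿distribʳ-*; -0#≈0#)
  module Ser = CommutativeRing seriesRing
  module SI = Identities seriesRing
  module SerSum = SemiringSum Ser.semiring
  open SerSum public using (sum)

  NonNeg : Carrier → Set
  NonNeg a = ¬ (a < 0#)

  0<⇒¬<0 : ∀ {a} → 0# < a → NonNeg a
  0<⇒¬<0 p q = <-irrefl refl (<-trans p q)

  <0⇒0<- : ∀ {a} → a < 0# → 0# < (- a)
  <0⇒0<- {a} p = <-respˡ (-‿inverseʳ a) (<-respʳ (+-identityˡ _) (+-monoˡ-< (- a) p))

  +-pos-nonNeg : ∀ {a b} → 0# < a → NonNeg b → 0# < (a + b)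
  +-pos-nonNeg {a} {b} p q with compare b 0#
  ... | tri< b<0 _ _ = ⊥-elim (q b<0)
  ... | tri≈ _ b≈0 _ = <-respʳ (sym (trans (+-congˡ b≈0) (+-identityʳ a))) p
  ... | tri> _ _ 0<b = <-trans 0<b (<-respˡ (+-identityˡ b) (+-monoˡ-< b p))

  nonNeg-sum≈0 : ∀ {a b} → NonNeg a → NonNeg b → a + b ≈ 0# → a ≈ 0# × b ≈ 0#
  nonNeg-sum≈0 {a} {b} p q eq with compare a 0#
  ... | tri< a<0 _ _ = ⊥-elim (p a<0)
  ... | tri> _ _ 0<a = ⊥-elim (<-irrefl (sym eq) (+-pos-nonNeg 0<a q))
  ... | tri≈ _ a≈0 _ = a≈0 , trans (sym (+-identityˡ b)) (trans (+-congʳ (sym a≈0)) eq)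

  nonNeg-+ : ∀ {a b} → NonNeg a → NonNeg b → NonNeg (a + b)
  nonNeg-+ {a} {b} p q with compare a 0#
  ... | tri< a<0 _ _ = ⊥-elim (p a<0)
  ... | tri> _ _ 0<a = 0<⇒¬<0 (+-pos-nonNeg 0<a q)
  ... | tri≈ _ a≈0 _ = λ s → q (<-respˡ (trans (+-congʳ a≈0) (+-identityˡ b)) s)

  nonNeg-cong : ∀ {a b} → a ≈ b → NonNeg a → NonNeg b
  nonNeg-cong eq p s = p (<-respˡ (sym eq) s)

  square-pos : ∀ {a} → ¬ (a ≈ 0#) → 0# < (a * a)
  square-pos {a} a≉0 with compare a 0#
  ... | tri≈ _ a≈0 _ = ⊥-elim (a≉0 a≈0)
  ... | tri> _ _ 0<a = *-pos 0<a 0<a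
  ... | tri< a<0 _ _ = <-respʳ (solve 1 (λ a → (:- a) :* (:- a) := a :* a) refl a)
                         (*-pos (<0⇒0<- a<0) (<0⇒0<- a<0))

  nonNeg-square : ∀ a → NonNeg (a * a)
  nonNeg-square a with a ≟ 0#
  ... | yes a≈0 = λ s → <-irrefl (trans (*-congʳ a≈0) (zeroˡ a)) s
  ... | no a≉0 = 0<⇒¬<0 (square-pos a≉0)

  *-≉0 : ∀ {a b} → ¬ (a ≈ 0#) → ¬ (b ≈ 0#) → ¬ (a * b ≈ 0#)
  *-≉0 {a} {b} a≉0 b≉0 ab≈0 with inverse a a≉0
  ... | c , ac≈1 = b≉0 (begin
    b             ≈⟨ *-identityˡ b ⟨
    1# * b        ≈⟨ *-congʳ ac≈1 ⟨
    (a * c) * b   ≈⟨ solve 3 (λ a b c → (a :* c) :* b := c :* (a :* b)) refl a b c ⟩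
    c * (a * b)   ≈⟨ *-congˡ ab≈0 ⟩
    c * 0#        ≈⟨ zeroʳ c ⟩
    0#            ∎)
    where open SetoidReasoning setoid

  square≈0 : ∀ {a} → a * a ≈ 0# → a ≈ 0#
  square≈0 {a} eq with a ≟ 0#
  ... | yes p = p
  ... | no q = ⊥-elim (*-≉0 q q eq)

  nonNeg-fromℕ : ∀ n → NonNeg (fromℕ n)
  nonNeg-fromℕ zero = <-irrefl refl
  nonNeg-fromℕ (suc n) = nonNeg-+ (0<⇒¬<0 0<1) (nonNeg-fromℕ n)

  fromℕ-suc≉0 : ∀ n → ¬ (fromℕ (suc n) ≈ 0#)
  fromℕ-suc≉0 n eq = <-irrefl (sym eq) (+-pos-nonNeg 0<1 (nonNeg-fromℕ n))

  -1<0 : (- 1#) < 0#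
  -1<0 = <-respˡ (+-identityˡ _) (<-respʳ (-‿inverseʳ 1#) (+-monoˡ-< (- 1#) 0<1))

  -- Orders of vanishing

  Vanish : ℕ → Series → Set
  Vanish k f = ∀ i → i <ℕ k → f i ≈ 0#

  vanish-zero : ∀ {f} → Vanish 0 f
  vanish-zero _ ()

  vanish-suc : ∀ {k f} → Vanish k f → f k ≈ 0# → Vanish (suc k) f
  vanish-suc {k} v eq i (s≤s i≤k) with ℕₚ.m≤n⇒m<n∨m≡n i≤k
  ... | inj₁ i<k = v i i<k
  ... | inj₂ ≡-refl = eq

  vanish-≤ : ∀ {j k f} → j ≤ k → Vanish k f → Vanish j f
  vanish-≤ j≤k v i i<j = v i (ℕₚ.<-≤-trans i<j j≤k)

  vanish-cong : ∀ {k f g} → f ≋ g → Vanish k f → Vanish k g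
  vanish-cong eq v i p = trans (sym (at eq i)) (v i p)

  vanish-⊞ : ∀ {k f g} → Vanish k f → Vanish k g → Vanish k (f ⊞ g)
  vanish-⊞ v w i p = trans (+-cong (v i p) (w i p)) (+-identityˡ 0#)

  vanish-⊟ : ∀ {k f} → Vanish k f → Vanish k (⊟ f)
  vanish-⊟ v i p = trans (-‿cong (v i p)) -0#≈0#

  vanish-0ₛ : ∀ {k} → Vanish k 0ₛ
  vanish-0ₛ i p = refl

  vanish-sum : ∀ {k n} (f : Fin n → Series) → (∀ i → Vanish k (f i)) → Vanish k (sum f)
  vanish-sum {n = zero} f v = vanish-0ₛ
  vanish-sum {n = suc n} f v = vanish-⊞ (v zero) (vanish-sum (λ i → f (suc i)) (λ i → v (suc i)))

  vanish-tail : ∀ {k f} → Vanish (suc k) f → Vanish k (tail f)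
  vanish-tail v i p = v (suc i) (s≤s p)

  drop-headˡ : ∀ {f} → f 0 ≈ 0# → ∀ g n → (f ⊛ g) (suc n) ≈ (tail f ⊛ g) n
  drop-headˡ eq g n = trans (+-congʳ (trans (*-congʳ eq) (zeroˡ _))) (+-identityˡ _)

  drop-headʳ : ∀ {g} → g 0 ≈ 0# → ∀ f n → (f ⊛ g) (suc n) ≈ (f ⊛ tail g) n
  drop-headʳ {g} eq f n = trans (⊛-sucʳ f g n) (trans (+-congʳ (trans (*-congˡ eq) (zeroʳ _))) (+-identityˡ _))

  vanish-⊛ : ∀ i j {f g} → Vanish i f → Vanish j g → Vanish (i +ℕ j) (f ⊛ g)
  vanish-⊛ zero zero v w n ()
  vanish-⊛ zero (suc j) v w zero p = trans (*-congˡ (w 0 (s≤s z≤n))) (zeroʳ _)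
  vanish-⊛ zero (suc j) {f} {g} v w (suc n) (s≤s p) =
    trans (drop-headʳ {g} (w 0 (s≤s z≤n)) f n) (vanish-⊛ zero j {f} {tail g} vanish-zero (vanish-tail w) n p)
  vanish-⊛ (suc i) j v w zero p = trans (*-congʳ (v 0 (s≤s z≤n))) (zeroˡ _)
  vanish-⊛ (suc i) j {f} {g} v w (suc n) (s≤s p) =
    trans (drop-headˡ {f} (v 0 (s≤s z≤n)) g n) (vanish-⊛ i j (vanish-tail v) w n p)

  -- In degree i + j every other product of the convolution has a factor below its bound. Neither
  -- bound has to be sharp; sharp ones make orders additive.
  coeff-⊛ : ∀ i j {f g} → Vanish i f → Vanish j g → (f ⊛ g) (i +ℕ j) ≈ f i * g j
  coeff-⊛ zero zero v w = refl
  coeff-⊛ zero (suc j) {f} {g} v w =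
    trans (drop-headʳ {g} (w 0 (s≤s z≤n)) f j) (coeff-⊛ zero j {f} {tail g} vanish-zero (vanish-tail w))
  coeff-⊛ (suc i) j {f} {g} v w =
    trans (drop-headˡ {f} (v 0 (s≤s z≤n)) g (i +ℕ j)) (coeff-⊛ i j (vanish-tail v) w)

  vanish-⊛ʳ : ∀ {k} f {g} → Vanish k g → Vanish k (f ⊛ g)
  vanish-⊛ʳ {k} f w = vanish-⊛ 0 k {f} vanish-zero w

  vanish-ε : ∀ {k f} → Vanish k f → Vanish (suc k) (ε ⊛ f)
  vanish-ε {f = f} v zero p = ε-⊛-zero f
  vanish-ε {f = f} v (suc i) (s≤s p) = trans (ε-⊛-suc f i) (v i p)

  vanish-ε⁻ : ∀ {k f} → Vanish (suc k) (ε ⊛ f) → Vanish k f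
  vanish-ε⁻ {f = f} v i p = trans (sym (ε-⊛-suc f i)) (v (suc i) (s≤s p))

  Ord : Series → ℕ → Set
  Ord f k = Vanish k f × ¬ (f k ≈ 0#)

  vanish≤ord : ∀ {f j k} → Vanish j f → Ord f k → j ≤ k
  vanish≤ord {j = j} {k} v (_ , ne) with ℕₚ.<-cmp k j
  ... | tri< k<j _ _ = ⊥-elim (ne (v k k<j))
  ... | tri≈ _ ≡-refl _ = ℕₚ.≤-refl
  ... | tri> _ _ j<k = ℕₚ.<⇒≤ j<k

  ord-unique : ∀ {f j k} → Ord f j → Ord f k → j ≡ k
  ord-unique p q = ℕₚ.≤-antisym (vanish≤ord (proj₁ p) q) (vanish≤ord (proj₁ q) p)

  ord-cong : ∀ {f g k} → f ≋ g → Ord f k → Ord g k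
  ord-cong eq (v , ne) = vanish-cong eq v , λ z → ne (trans (at eq _) z)

  ord-⊛ : ∀ {f g i j} → Ord f i → Ord g j → Ord (f ⊛ g) (i +ℕ j)
  ord-⊛ {i = i} {j} (v , p) (w , q) =
    vanish-⊛ i j v w , λ z → *-≉0 p q (trans (sym (coeff-⊛ i j v w)) z)

  -- The zero series has no order, so the search for the first nonzero coefficient is bounded by
  -- `k`; it is conclusive once some nonzero coefficient is known.
  vanish⊎ord : ∀ f k → Vanish k f ⊎ ∃[ j ] Ord f j
  vanish⊎ord f zero = inj₁ vanish-zero
  vanish⊎ord f (suc k) with vanish⊎ord f k
  ... | inj₂ o = inj₂ o
  ... | inj₁ v with f k ≟ 0#
  ...   | yes z = inj₁ (vanish-suc v z)
  ...   | no nz = inj₂ (k , v , nz)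

  ≉0⇒ord : ∀ f k → ¬ (f k ≈ 0#) → ∃[ j ] Ord f j
  ≉0⇒ord f k ne with vanish⊎ord f (suc k)
  ... | inj₁ v = ⊥-elim (ne (v k ℕₚ.≤-refl))
  ... | inj₂ o = o

  -- The derivation ε·d/dε

  ϑ : Series → Series
  ϑ f n = fromℕ n * f n

  ϑ-cong : ∀ {f g} → f ≋ g → ϑ f ≋ ϑ g
  ϑ-cong eq = pointwise (λ n → *-congˡ (at eq n))

  ϑ-⊞ : ∀ f g → ϑ (f ⊞ g) ≋ ϑ f ⊞ ϑ g
  ϑ-⊞ f g = pointwise (λ n → distribˡ _ _ _)

  ϑ-⊟ : ∀ f → ϑ (⊟ f) ≋ ⊟ ϑ f
  ϑ-⊟ f = pointwise (λ n → sym (-‿distribʳ-* _ _))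

  ϑ-0ₛ : ϑ 0ₛ ≋ 0ₛ
  ϑ-0ₛ = pointwise (λ n → zeroʳ _)

  ϑ-sum : ∀ {n} (f : Fin n → Series) → ϑ (sum f) ≋ sum (λ i → ϑ (f i))
  ϑ-sum {zero} f = ϑ-0ₛ
  ϑ-sum {suc n} f = Ser.trans (ϑ-⊞ (f zero) _) (Ser.+-congˡ (ϑ-sum (λ i → f (suc i))))

  ϑ-const : ∀ a → ϑ (const a) ≋ 0ₛ
  ϑ-const a = pointwise λ { zero → zeroˡ _ ; (suc n) → zeroʳ _ }

  ϑ-ε : ϑ ε ≋ ε
  ϑ-ε = pointwise λ { zero → zeroˡ _ ; (suc zero) → trans (*-identityʳ _) (+-identityʳ _) ; (suc (suc n)) → zeroʳ _ }

  ϑ-⊛-coeff : ∀ f g → ϑ (f ⊛ g) ≐ (ϑ f ⊛ g) ⊞ (f ⊛ ϑ g)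
  ϑ-⊛-coeff f g zero = solve₀ (f 0) (g 0)
    where
    open SetoidReasoning setoid
    solve₀ : ∀ a b → 0# * (a * b) ≈ (0# * a) * b + a * (0# * b)
    solve₀ a b = begin
      0# * (a * b)                ≈⟨ zeroˡ _ ⟩
      0#                          ≈⟨ +-identityˡ 0# ⟨
      0# + 0#                     ≈⟨ +-cong (trans (*-congʳ (zeroˡ a)) (zeroˡ b)) (trans (*-congˡ (zeroˡ b)) (zeroʳ a)) ⟨
      (0# * a) * b + a * (0# * b) ∎
  ϑ-⊛-coeff f g (suc n) = begin
    (1# + fromℕ n) * (f 0 * g (suc n) + (tail f ⊛ g) n)
      ≈⟨ solve 5 (λ o N a b c → (o :+ N) :* (a :* b :+ c) := a :* ((o :+ N) :* b) :+ (o :* c :+ N :* c)) refl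
           1# (fromℕ n) (f 0) (g (suc n)) ((tail f ⊛ g) n) ⟩
    f 0 * (fromℕ (suc n) * g (suc n)) + (1# * (tail f ⊛ g) n + fromℕ n * (tail f ⊛ g) n)
      ≈⟨ +-congˡ (+-cong (*-identityˡ _) (ϑ-⊛-coeff (tail f) g n)) ⟩
    f 0 * (fromℕ (suc n) * g (suc n)) + ((tail f ⊛ g) n + ((ϑ (tail f) ⊛ g) n + (tail f ⊛ ϑ g) n))
      ≈⟨ solve 4 (λ a b c d → a :+ (b :+ (c :+ d)) := (b :+ c) :+ (a :+ d)) refl _ _ _ _ ⟩
    ((tail f ⊛ g) n + (ϑ (tail f) ⊛ g) n) + (f 0 * (fromℕ (suc n) * g (suc n)) + (tail f ⊛ ϑ g) n)
      ≈⟨ +-congʳ (⊛-distribʳ g (tail f) (ϑ (tail f)) n) ⟨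
    ((tail f ⊞ ϑ (tail f)) ⊛ g) n + (f ⊛ ϑ g) (suc n)
      ≈⟨ +-congʳ (⊛-cong (λ i → sym (trans (distribʳ _ _ _) (+-congʳ (*-identityˡ _)))) (λ _ → refl) n) ⟩
    (tail (ϑ f) ⊛ g) n + (f ⊛ ϑ g) (suc n)
      ≈⟨ +-congʳ (drop-headˡ {ϑ f} (zeroˡ _) g n) ⟨
    (ϑ f ⊛ g) (suc n) + (f ⊛ ϑ g) (suc n) ∎
    where open SetoidReasoning setoid

  ϑ-⊛ : ∀ f g → ϑ (f ⊛ g) ≋ (ϑ f ⊛ g) ⊞ (f ⊛ ϑ g)
  ϑ-⊛ f g = pointwise (ϑ-⊛-coeff f g)

  -- The reason to use ε d/dε in place of d/dε: each coefficient is multiplied by its index and no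
  -- order is lost.
  vanish-ϑ : ∀ {k f} → Vanish k f → Vanish k (ϑ f)
  vanish-ϑ v i p = trans (*-congˡ (v i p)) (zeroʳ _)

  -- Series whose lowest coefficient is non-negative, respectively
  -- non-negative and of even index. The latter contains the squares; in
  -- both cones the terms of a sum vanish at least to the order of the sum.

  Lex : Series → Set
  Lex f = ∀ k → Vanish k f → NonNeg (f k)

  Even : Series → Set
  Even f = ∀ j → Vanish (suc (j +ℕ j)) f → f (suc (j +ℕ j)) ≈ 0#

  Cone : Series → Set
  Cone f = Lex f × Even f

  -- No cancellation: while both terms vanish, their next coefficients are non-negative, so a zero
  -- sum forces both to be zero.
  lex-split : ∀ {f g} → Lex f → Lex g → ∀ k → Vanish k (f ⊞ g) → Vanish k f × Vanish k g
  lex-split lf lg zero v = vanish-zero , vanish-zero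
  lex-split lf lg (suc k) v with lex-split lf lg k (vanish-≤ (ℕₚ.n≤1+n k) v)
  ... | vf , vg with nonNeg-sum≈0 (lf k vf) (lg k vg) (v k ℕₚ.≤-refl)
  ...   | f≈0 , g≈0 = vanish-suc vf f≈0 , vanish-suc vg g≈0

  lex-⊞ : ∀ {f g} → Lex f → Lex g → Lex (f ⊞ g)
  lex-⊞ lf lg k v with lex-split lf lg k v
  ... | vf , vg = nonNeg-+ (lf k vf) (lg k vg)

  cone-⊞ : ∀ {f g} → Cone f → Cone g → Cone (f ⊞ g)
  cone-⊞ {f} {g} (lf , ef) (lg , eg) = lex-⊞ lf lg , even
    where
    even : Even (f ⊞ g)
    even j v with lex-split lf lg (suc (j +ℕ j)) v
    ... | vf , vg = trans (+-cong (ef j vf) (eg j vg)) (+-identityˡ 0#)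

  lex-cong : ∀ {f g} → f ≋ g → Lex f → Lex g
  lex-cong eq l k v = nonNeg-cong (at eq k) (l k (vanish-cong (Ser.sym eq) v))

  cone-cong : ∀ {f g} → f ≋ g → Cone f → Cone g
  cone-cong eq (l , e) = lex-cong eq l , λ j v → trans (sym (at eq _)) (e j (vanish-cong (Ser.sym eq) v))

  lex-0ₛ : Lex 0ₛ
  lex-0ₛ k v = <-irrefl refl

  cone-0ₛ : Cone 0ₛ
  cone-0ₛ = lex-0ₛ , λ j v → refl

  lex-sum : ∀ {n} (f : Fin n → Series) → (∀ i → Lex (f i)) → Lex (sum f)
  lex-sum {zero} f l = lex-0ₛ
  lex-sum {suc n} f l = lex-⊞ (l zero) (lex-sum (λ i → f (suc i)) (λ i → l (suc i)))

  cone-sum : ∀ {n} (f : Fin n → Series) → (∀ i → Cone (f i)) → Cone (sum f)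
  cone-sum {zero} f c = cone-0ₛ
  cone-sum {suc n} f c = cone-⊞ (c zero) (cone-sum (λ i → f (suc i)) (λ i → c (suc i)))

  lex-sum-split : ∀ {n} (f : Fin n → Series) → (∀ i → Lex (f i)) →
                  ∀ k → Vanish k (sum f) → ∀ i → Vanish k (f i)
  lex-sum-split {suc n} f l k v i
    with lex-split (l zero) (lex-sum (λ i → f (suc i)) (λ i → l (suc i))) k v
  lex-sum-split {suc n} f l k v zero    | v₀ , _ = v₀
  lex-sum-split {suc n} f l k v (suc i) | _ , vs = lex-sum-split (λ i → f (suc i)) (λ i → l (suc i)) k vs i

  -- Multiplication by `ε` shifts parity, so it preserves `Lex` but not `Even`; the Wronskian, built
  -- from `ε` times squares, is therefore placed in `Lex` only.
  lex-ε : ∀ {f} → Lex f → Lex (ε ⊛ f)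
  lex-ε {f} l zero v = nonNeg-cong (sym (ε-⊛-zero f)) (<-irrefl refl)
  lex-ε {f} l (suc k) v = nonNeg-cong (sym (ε-⊛-suc f k)) (l k (vanish-ε⁻ v))

  parity : ∀ k → ∃[ j ] (k ≡ j +ℕ j ⊎ k ≡ suc (j +ℕ j))
  parity zero = 0 , inj₁ ≡-refl
  parity (suc k) with parity k
  ... | j , inj₁ eq = j , inj₂ (≡-cong suc eq)
  ... | j , inj₂ eq = suc j , inj₁ (≡-cong suc (≡-sym (ℕₚ.+-suc j j) ≡∘ eq))
    where
    _≡∘_ : ∀ {a b c : ℕ} → b ≡ c → a ≡ b → a ≡ c
    ≡-refl ≡∘ ≡-refl = ≡-refl

  sqrt-vanish : ∀ j f → Vanish (j +ℕ j) (f ⊛ f) → Vanish j f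
  sqrt-vanish zero f v = vanish-zero
  sqrt-vanish (suc j) f v = vanish-suc vj (square≈0 (trans (sym (coeff-⊛ j j vj vj))
      (v (j +ℕ j) (s≤s (ℕₚ.+-monoʳ-≤ j (ℕₚ.n≤1+n j))))))
    where
    vj : Vanish j f
    vj = sqrt-vanish j f (vanish-≤ (ℕₚ.+-mono-≤ (ℕₚ.n≤1+n j) (ℕₚ.n≤1+n j)) v)

  -- If f has order j, the square has order 2 j with lowest coefficient the square of f j. If the
  -- square vanishes below 2 j + 1, then f vanishes below j + 1, and the square even below 2 j + 2.
  cone-square : ∀ f → Cone (f ⊛ f)
  cone-square f = lex , even
    where
    even : Even (f ⊛ f)
    even j v = vanish-⊛ (suc j) (suc j) vj vj (suc (j +ℕ j)) (s≤s (ℕₚ.≤-reflexive (≡-sym (ℕₚ.+-suc j j))))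
      where
      vj : Vanish (suc j) f
      vj = vanish-suc w (square≈0 (trans (sym (coeff-⊛ j j w w)) (v (j +ℕ j) ℕₚ.≤-refl)))
        where w = sqrt-vanish j f (vanish-≤ (ℕₚ.n≤1+n _) v)
    lex : Lex (f ⊛ f)
    lex k v with parity k
    ... | j , inj₁ ≡-refl = nonNeg-cong (sym (coeff-⊛ j j w w)) (nonNeg-square (f j))
      where w = sqrt-vanish j f v
    ... | j , inj₂ ≡-refl = nonNeg-cong (sym (even j v)) (<-irrefl refl)

-- Sums of series and the abstract vertex recursion

module SeriesSums (ℝ : RealNumbers) where
  open RealNumbers ℝ hiding (zero; _-_)
  open RealSeries ℝ
  open AbelianGroupProperties Ser.+-abelianGroup using (⁻¹-∙-comm)
  open RingProperties Ser.ring using (-0#≈0#)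

  when : Bool → Series → Series
  when b f = if b then f else 0ₛ

  when-cong : ∀ b {f g} → f ≋ g → when b f ≋ when b g
  when-cong true eq = eq
  when-cong false eq = Ser.refl

  when-0ₛ : ∀ b → when b 0ₛ ≋ 0ₛ
  when-0ₛ true = Ser.refl
  when-0ₛ false = Ser.refl

  when-⊛ʳ : ∀ b f g → when b f ⊛ g ≋ when b (f ⊛ g)
  when-⊛ʳ true f g = Ser.refl
  when-⊛ʳ false f g = Ser.zeroˡ g

  when-⊛ˡ : ∀ b f g → f ⊛ when b g ≋ when b (f ⊛ g)
  when-⊛ˡ true f g = Ser.refl
  when-⊛ˡ false f g = Ser.zeroʳ f

  when-⊟ : ∀ b f → ⊟ when b f ≋ when b (⊟ f)
  when-⊟ true f = Ser.refl
  when-⊟ false f = -0#≈0#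

  when-⊞ : ∀ b f g → when b f ⊞ when b g ≋ when b (f ⊞ g)
  when-⊞ true f g = Ser.refl
  when-⊞ false f g = Ser.+-identityˡ 0ₛ

  when-difference : ∀ b f g → when b f ⊞ (⊟ when b g) ≋ when b (f ⊞ (⊟ g))
  when-difference true f g = Ser.refl
  when-difference false f g = Ser.-‿inverseʳ 0ₛ

  sum-0 : ∀ {n} (f : Fin n → Series) → (∀ i → f i ≋ 0ₛ) → sum f ≋ 0ₛ
  sum-0 {n} f eq = Ser.trans (SerSum.sum-cong-≋ eq) (SerSum.sum-replicate-zero n)

  sum-⊟ : ∀ {n} (f : Fin n → Series) → ⊟ sum f ≋ sum (λ i → ⊟ f i)
  sum-⊟ {zero} f = -0#≈0#
  sum-⊟ {suc n} f = Ser.trans (Ser.sym (⁻¹-∙-comm (f zero) _)) (Ser.+-congˡ {⊟ f zero} (sum-⊟ (f ∘ suc)))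

  sum-difference : ∀ {n} (f g : Fin n → Series) → sum f ⊞ (⊟ sum g) ≋ sum (λ i → f i ⊞ (⊟ g i))
  sum-difference f g = Ser.trans (Ser.+-congˡ {sum f} (sum-⊟ g)) (Ser.sym (SerSum.∑-distrib-+ f (λ i → ⊟ g i)))

  lex-when : ∀ b {f} → (b ≡ true → Lex f) → Lex (when b f)
  lex-when true l = l ≡-refl
  lex-when false l = lex-0ₛ

  cone-when : ∀ b {f} → (b ≡ true → Cone f) → Cone (when b f)
  cone-when true l = l ≡-refl
  cone-when false l = cone-0ₛ

  vanish-when : ∀ b {k f} → (b ≡ true → Vanish k f) → Vanish k (when b f)
  vanish-when true v = v ≡-refl
  vanish-when false v = vanish-0ₛ

  -- The recursion of the weighted matching polynomial: `y u` is the weight of leaving `u`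
  -- unmatched, and each edge contributes a factor -1.
  Recursive : ∀ {n} → Adj n → (Fin n → Series) → (Subset n → Series) → Set
  Recursive E y M = ∀ S u → u ∈ S →
    M S ≋ y u ⊛ M (S - u) ⊞ (⊟ sum (λ z → when (inS (S - u) z ∧ E u z) (M (S - u - z))))

  -- What the multiplicity arguments use of the matching polynomials of all induced subgraphs; it is
  -- instantiated both at G and at S_θ(G). The field `ϑx` says that `x` is ε plus a constant.
  record DeletionFamily {n : ℕ} (E : Adj n) : Set where
    field
      x       : Series
      ϑx      : ϑ x ≋ ε
      M       : Subset n → Series
      rec     : Recursive E (λ _ → x) M
      M-empty : ∀ S → ∣ S ∣ ≡ 0 → M S ≋ 1ₛ
      m       : Subset n → ℕ
      ord     : ∀ S → Ord (M S) (m S)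

∧-split : ∀ {a b} → a ∧ b ≡ true → a ≡ true × b ≡ true
∧-split {true} {true} _ = ≡-refl , ≡-refl

-- Taylor expansion: root multiplicity as order of vanishing

module Taylor (ℝ : RealNumbers) where
  open RealNumbers ℝ hiding (zero)
  open RealSeries ℝ
  open Poly ℝ
  open SetoidReasoning Ser.setoid

  X : Carrier → Series
  X θ = const θ ⊞ ε

  _^ₛ_ : Series → ℕ → Series
  f ^ₛ zero = 1ₛ
  f ^ₛ suc k = f ⊛ (f ^ₛ k)

  taylor : Carrier → Pol → Series
  taylor θ [] = 0ₛ
  taylor θ (a ∷ p) = const a ⊞ X θ ⊛ taylor θ p

  const-cong : ∀ {a b} → a ≈ b → const a ≋ const b
  const-cong eq = pointwise λ { zero → eq ; (suc n) → refl }

  const-+ : ∀ a b → const (a + b) ≋ const a ⊞ const b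
  const-+ a b = pointwise λ { zero → refl ; (suc n) → sym (+-identityˡ 0#) }

  const-* : ∀ a b → const (a * b) ≋ const a ⊛ const b
  const-* a b = pointwise λ { zero → refl ; (suc n) → sym (trans (const-⊛ a (const b) (suc n)) (zeroʳ a)) }

  const-0 : const 0# ≋ 0ₛ
  const-0 = pointwise λ { zero → refl ; (suc n) → refl }

  taylor-+P : ∀ θ p q → taylor θ (p +P q) ≋ taylor θ p ⊞ taylor θ q
  taylor-+P θ [] q = Ser.sym (Ser.+-identityˡ _)
  taylor-+P θ (a ∷ p) [] = Ser.sym (Ser.+-identityʳ _)
  taylor-+P θ (a ∷ p) (b ∷ q) = begin
    const (a + b) ⊞ X θ ⊛ taylor θ (p +P q)
      ≈⟨ Ser.+-cong (const-+ a b) (Ser.*-congˡ (taylor-+P θ p q)) ⟩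
    (const a ⊞ const b) ⊞ X θ ⊛ (taylor θ p ⊞ taylor θ q)
      ≈⟨ SI.+-*-+
           (const a) (const b) (X θ) (taylor θ p) (taylor θ q) ⟩
    (const a ⊞ X θ ⊛ taylor θ p) ⊞ (const b ⊞ X θ ⊛ taylor θ q) ∎

  taylor-scale : ∀ θ c p → taylor θ (scale c p) ≋ const c ⊛ taylor θ p
  taylor-scale θ c [] = Ser.sym (Ser.zeroʳ (const c))
  taylor-scale θ c (a ∷ p) = begin
    const (c * a) ⊞ X θ ⊛ taylor θ (scale c p)
      ≈⟨ Ser.+-cong (const-* c a) (Ser.*-congˡ (taylor-scale θ c p)) ⟩
    const c ⊛ const a ⊞ X θ ⊛ (const c ⊛ taylor θ p)
      ≈⟨ SI.scale-horner
           (const c) (const a) (X θ) (taylor θ p) ⟩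
    const c ⊛ (const a ⊞ X θ ⊛ taylor θ p) ∎

  taylor-*P : ∀ θ p q → taylor θ (p *P q) ≋ taylor θ p ⊛ taylor θ q
  taylor-*P θ [] q = Ser.sym (Ser.zeroˡ (taylor θ q))
  taylor-*P θ (a ∷ p) q = begin
    taylor θ (scale a q +P (0# ∷ (p *P q)))
      ≈⟨ taylor-+P θ (scale a q) (0# ∷ (p *P q)) ⟩
    taylor θ (scale a q) ⊞ (const 0# ⊞ X θ ⊛ taylor θ (p *P q))
      ≈⟨ Ser.+-cong (taylor-scale θ a q) (Ser.+-cong const-0 (Ser.*-congˡ (taylor-*P θ p q))) ⟩
    const a ⊛ taylor θ q ⊞ (0ₛ ⊞ X θ ⊛ (taylor θ p ⊛ taylor θ q))
      ≈⟨ Ser.+-congˡ (Ser.+-identityˡ _) ⟩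
    const a ⊛ taylor θ q ⊞ X θ ⊛ (taylor θ p ⊛ taylor θ q)
      ≈⟨ SI.horner-*
           (const a) (X θ) (taylor θ p) (taylor θ q) ⟩
    (const a ⊞ X θ ⊛ taylor θ p) ⊛ taylor θ q ∎

  taylor-1 : ∀ θ → taylor θ (1# ∷ []) ≋ 1ₛ
  taylor-1 θ = Ser.trans (Ser.+-congˡ (Ser.zeroʳ (X θ))) (Ser.+-identityʳ _)

  taylor-monomial : ∀ θ c k → taylor θ (monomial c k) ≋ const c ⊛ (X θ ^ₛ k)
  taylor-monomial θ c zero = begin
    const c ⊞ X θ ⊛ 0ₛ ≈⟨ Ser.+-congˡ (Ser.zeroʳ (X θ)) ⟩
    const c ⊞ 0ₛ       ≈⟨ Ser.+-identityʳ _ ⟩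
    const c            ≈⟨ Ser.*-identityʳ (const c) ⟨
    const c ⊛ 1ₛ       ∎
  taylor-monomial θ c (suc k) = begin
    const 0# ⊞ X θ ⊛ taylor θ (monomial c k) ≈⟨ Ser.+-cong const-0 (Ser.*-congˡ (taylor-monomial θ c k)) ⟩
    0ₛ ⊞ X θ ⊛ (const c ⊛ (X θ ^ₛ k))        ≈⟨ Ser.+-identityˡ _ ⟩
    X θ ⊛ (const c ⊛ (X θ ^ₛ k))             ≈⟨ SI.*-swap
                                                  (X θ) (const c) (X θ ^ₛ k) ⟩
    const c ⊛ (X θ ⊛ (X θ ^ₛ k))             ∎

  taylor-AllZero : ∀ θ p → AllZero p → taylor θ p ≋ 0ₛ
  taylor-AllZero θ [] _ = Ser.refl
  taylor-AllZero θ (a ∷ p) (a≈0 , z) = begin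
    const a ⊞ X θ ⊛ taylor θ p
      ≈⟨ Ser.+-cong (Ser.trans (const-cong a≈0) const-0) (Ser.*-congˡ (taylor-AllZero θ p z)) ⟩
    0ₛ ⊞ X θ ⊛ 0ₛ ≈⟨ Ser.+-identityˡ _ ⟩
    X θ ⊛ 0ₛ      ≈⟨ Ser.zeroʳ (X θ) ⟩
    0ₛ            ∎

  taylor-cong : ∀ θ p q → p ≈P q → taylor θ p ≋ taylor θ q
  taylor-cong θ [] q z = Ser.sym (taylor-AllZero θ q z)
  taylor-cong θ (a ∷ p) [] z = taylor-AllZero θ (a ∷ p) z
  taylor-cong θ (a ∷ p) (b ∷ q) (eq , eqs) =
    Ser.+-cong (const-cong eq) (Ser.*-congˡ (taylor-cong θ p q eqs))

  X0≋ε : X 0# ≋ ε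
  X0≋ε = Ser.trans (Ser.+-congʳ const-0) (Ser.+-identityˡ ε)

  taylor0-zero : ∀ a p → taylor 0# (a ∷ p) 0 ≈ a
  taylor0-zero a p = trans (+-congˡ (trans (at (Ser.*-congʳ {taylor 0# p} X0≋ε) 0) (ε-⊛-zero (taylor 0# p)))) (+-identityʳ a)

  taylor0-suc : ∀ a p n → taylor 0# (a ∷ p) (suc n) ≈ taylor 0# p n
  taylor0-suc a p n =
    trans (+-congˡ (trans (at (Ser.*-congʳ {taylor 0# p} X0≋ε) (suc n)) (ε-⊛-suc (taylor 0# p) n))) (+-identityˡ _)

  AllZero-taylor0 : ∀ p → taylor 0# p ≋ 0ₛ → AllZero p
  AllZero-taylor0 [] _ = tt
  AllZero-taylor0 (a ∷ p) eq =
    trans (sym (taylor0-zero a p)) (at eq 0) ,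
    AllZero-taylor0 p (pointwise λ n → trans (sym (taylor0-suc a p n)) (at eq (suc n)))

  -- The Taylor expansion at 0 is the coefficient sequence.
  ≈P-taylor0 : ∀ p q → taylor 0# p ≋ taylor 0# q → p ≈P q
  ≈P-taylor0 [] q eq = AllZero-taylor0 q (Ser.sym eq)
  ≈P-taylor0 (a ∷ p) [] eq = AllZero-taylor0 (a ∷ p) eq
  ≈P-taylor0 (a ∷ p) (b ∷ q) eq =
    trans (sym (taylor0-zero a p)) (trans (at eq 0) (taylor0-zero b q)) ,
    ≈P-taylor0 p q (pointwise λ n → trans (sym (taylor0-suc a p n)) (trans (at eq (suc n)) (taylor0-suc b q n)))

  taylor-eval : ∀ θ p → taylor θ p 0 ≈ eval p θ
  taylor-eval θ [] = refl
  taylor-eval θ (a ∷ p) = +-congˡ (*-cong (+-identityʳ θ) (taylor-eval θ p))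

  const-neg : ∀ a → const (- a) ≋ ⊟ const a
  const-neg a = begin
    const (- a)                            ≈⟨ SI.+-cancel-right (const (- a)) (const a) ⟩
    (const (- a) ⊞ const a) ⊞ (⊟ const a)  ≈⟨ Ser.+-congʳ (Ser.trans (Ser.sym (const-+ (- a) a)) (const-cong (-‿inverseˡ a))) ⟩
    const 0# ⊞ (⊟ const a)                 ≈⟨ Ser.trans (Ser.+-congʳ const-0) (Ser.+-identityˡ _) ⟩
    ⊟ const a                              ∎

  taylor-linear : ∀ φ θ → taylor φ (linear θ) ≋ X φ ⊞ (⊟ const θ)
  taylor-linear φ θ = begin
    const (- θ) ⊞ X φ ⊛ taylor φ (1# ∷ [])  ≈⟨ Ser.+-cong (const-neg θ) (Ser.*-congˡ (taylor-1 φ)) ⟩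
    (⊟ const θ) ⊞ X φ ⊛ 1ₛ                  ≈⟨ Ser.+-comm _ _ ⟩
    X φ ⊛ 1ₛ ⊞ (⊟ const θ)                  ≈⟨ Ser.+-congʳ (Ser.*-identityʳ (X φ)) ⟩
    X φ ⊞ (⊟ const θ)                       ∎

  taylor-linear-self : ∀ θ → taylor θ (linear θ) ≋ ε
  taylor-linear-self θ = begin
    taylor θ (linear θ)             ≈⟨ taylor-linear θ θ ⟩
    (const θ ⊞ ε) ⊞ (⊟ const θ)     ≈⟨ SI.+-cancel-left (const θ) ε ⟩
    ε                               ∎

  1≉0 : ¬ (1# ≈ 0#)
  1≉0 eq = <-irrefl (sym eq) 0<1

  ord-ε : ∀ {f k} → Ord f k → Ord (ε ⊛ f) (suc k)
  ord-ε {f} {k} (v , ne) = vanish-ε v , λ z → ne (trans (sym (ε-⊛-suc f k)) z)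

  ord-ε⁻ : ∀ {f k} → Ord (ε ⊛ f) (suc k) → Ord f k
  ord-ε⁻ {f} {k} (v , ne) = vanish-ε⁻ v , λ z → ne (trans (ε-⊛-suc f k) z)

  ord-linear^ : ∀ θ k → Ord (taylor θ (linear θ ^P k)) k
  ord-linear^ θ zero = vanish-zero , λ z → 1≉0 (trans (sym (at (taylor-1 θ) 0)) z)
  ord-linear^ θ (suc k) = ord-cong (Ser.sym (Ser.trans (taylor-*P θ (linear θ) (linear θ ^P k))
                            (Ser.*-congʳ (taylor-linear-self θ)))) (ord-ε (ord-linear^ θ k))

  RootMult⇒Ord : ∀ {θ f k} → RootMult θ f k → Ord (taylor θ f) k
  RootMult⇒Ord {θ} {f} {k} (g , eq , ne) = ≡-subst (Ord (taylor θ f)) (ℕₚ.+-identityʳ k)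
    (ord-cong (Ser.sym (Ser.trans (taylor-cong θ f _ eq) (taylor-*P θ (linear θ ^P k) g)))
      (ord-⊛ (ord-linear^ θ k) (vanish-zero , λ z → ne (trans (sym (taylor-eval θ g)) z))))

  -- Synthetic division by x - θ: the coefficients are the values at θ of the successive tails, and
  -- the value of the whole list is the remainder.
  quotient : Carrier → Pol → Pol
  quotient θ [] = []
  quotient θ (a ∷ p) = eval p θ ∷ quotient θ p

  -- The centre φ of the expansion is kept apart from the root θ: φ = θ turns the linear factor into
  -- `ε` and yields orders, φ = 0 yields the coefficient sequence and hence `_≈P_`.
  taylor-quotient : ∀ φ θ f →
    taylor φ f ≋ (X φ ⊞ (⊟ const θ)) ⊛ taylor φ (quotient θ f) ⊞ const (eval f θ)
  taylor-quotient φ θ [] = Ser.sym (Ser.trans (Ser.+-cong (Ser.zeroʳ _) const-0) (Ser.+-identityˡ 0ₛ))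
  taylor-quotient φ θ (a ∷ p) = begin
    const a ⊞ X φ ⊛ taylor φ p
      ≈⟨ Ser.+-congˡ (Ser.*-congˡ (taylor-quotient φ θ p)) ⟩
    const a ⊞ X φ ⊛ ((X φ ⊞ (⊟ const θ)) ⊛ Q ⊞ e)
      ≈⟨ SI.synthetic-division (const a) (X φ) (const θ) Q e ⟩
    (X φ ⊞ (⊟ const θ)) ⊛ (e ⊞ X φ ⊛ Q) ⊞ (const a ⊞ const θ ⊛ e)
      ≈⟨ Ser.+-congˡ (Ser.trans (const-+ a _) (Ser.+-congˡ (const-* θ (eval p θ)))) ⟨
    (X φ ⊞ (⊟ const θ)) ⊛ (e ⊞ X φ ⊛ Q) ⊞ const (a + θ * eval p θ) ∎
    where
    Q = taylor φ (quotient θ p)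
    e = const (eval p θ)

  taylor-root : ∀ φ θ f → eval f θ ≈ 0# → taylor φ f ≋ taylor φ (linear θ) ⊛ taylor φ (quotient θ f)
  taylor-root φ θ f z = begin
    taylor φ f
      ≈⟨ taylor-quotient φ θ f ⟩
    (X φ ⊞ (⊟ const θ)) ⊛ Q ⊞ const (eval f θ)
      ≈⟨ Ser.+-cong (Ser.*-congʳ (Ser.sym (taylor-linear φ θ))) (Ser.trans (const-cong z) const-0) ⟩
    taylor φ (linear θ) ⊛ Q ⊞ 0ₛ
      ≈⟨ Ser.+-identityʳ _ ⟩
    taylor φ (linear θ) ⊛ Q ∎
    where Q = taylor φ (quotient θ f)

  RootMult-suc : ∀ θ f k → eval f θ ≈ 0# → RootMult θ (quotient θ f) k → RootMult θ f (suc k)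
  RootMult-suc θ f k root (g , eq , ne) = g , ≈P-taylor0 f _ (begin
      taylor 0# f
        ≈⟨ taylor-root 0# θ f root ⟩
      L ⊛ taylor 0# (quotient θ f)
        ≈⟨ Ser.*-congˡ {L} (Ser.trans (taylor-cong 0# (quotient θ f) _ eq) (taylor-*P 0# (linear θ ^P k) g)) ⟩
      L ⊛ (taylor 0# (linear θ ^P k) ⊛ taylor 0# g)
        ≈⟨ Ser.*-assoc L (taylor 0# (linear θ ^P k)) (taylor 0# g) ⟨
      (L ⊛ taylor 0# (linear θ ^P k)) ⊛ taylor 0# g
        ≈⟨ Ser.*-congʳ {taylor 0# g} (taylor-*P 0# (linear θ) (linear θ ^P k)) ⟨
      taylor 0# (linear θ ^P suc k) ⊛ taylor 0# g
        ≈⟨ taylor-*P 0# (linear θ ^P suc k) g ⟨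
      taylor 0# ((linear θ ^P suc k) *P g) ∎) , ne
    where
    L = taylor 0# (linear θ)

  -- `RootMult` asks for a polynomial cofactor, which the order of a series does not provide; so one
  -- linear factor is divided off per step.
  Ord⇒RootMult : ∀ {θ} f k → Ord (taylor θ f) k → RootMult θ f k
  Ord⇒RootMult {θ} f zero (_ , ne) =
    f , ≈P-taylor0 f _ (Ser.sym (begin
      taylor 0# ((1# ∷ []) *P f)          ≈⟨ taylor-*P 0# (1# ∷ []) f ⟩
      taylor 0# (1# ∷ []) ⊛ taylor 0# f   ≈⟨ Ser.*-congʳ {taylor 0# f} (taylor-1 0#) ⟩
      1ₛ ⊛ taylor 0# f                    ≈⟨ Ser.*-identityˡ (taylor 0# f) ⟩
      taylor 0# f                         ∎)) ,
    λ z → ne (trans (taylor-eval θ f) z)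
  Ord⇒RootMult {θ} f (suc k) (v , ne) = RootMult-suc θ f k root (Ord⇒RootMult (quotient θ f) k
    (ord-ε⁻ {taylor θ (quotient θ f)} (ord-cong (Ser.trans (taylor-root θ θ f root)
      (Ser.*-congʳ {taylor θ (quotient θ f)} (taylor-linear-self θ))) (v , ne))))
    where
    root : eval f θ ≈ 0#
    root = trans (sym (taylor-eval θ f)) (v 0 (s≤s z≤n))

-- Subsets of a finite vertex set

private variable n : ℕ

≡ᵇ-refl : (i : Fin n) → (i ≡ᵇ i) ≡ true
≡ᵇ-refl i = dec-true (i ≟F i) ≡-refl

≢⇒≡ᵇ-false : {i j : Fin n} → i ≢ j → (i ≡ᵇ j) ≡ false
≢⇒≡ᵇ-false {i = i} {j} ne = dec-false (i ≟F j) ne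

≡ᵇ-sound : (i j : Fin n) → (i ≡ᵇ j) ≡ true → i ≡ j
≡ᵇ-sound i j eq with i ≟F j
... | yes p = p

≡ᵇ-sym : (i j : Fin n) → (i ≡ᵇ j) ≡ (j ≡ᵇ i)
≡ᵇ-sym i j with i ≟F j
... | yes ≡-refl = ≡-sym (≡ᵇ-refl i)
... | no ne = ≡-sym (≢⇒≡ᵇ-false (λ eq → ne (≡-sym eq)))

lookup-ext : {S T : Subset n} → (∀ i → inS S i ≡ inS T i) → S ≡ T
lookup-ext {S = []} {[]} eq = ≡-refl
lookup-ext {S = x ∷ S} {y ∷ T} eq = ≡-cong₂ _∷_ (eq zero) (lookup-ext (λ i → eq (suc i)))

∈⇒inS : {S : Subset n} {i : Fin n} → i ∈ S → inS S i ≡ true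
∈⇒inS = []=⇒lookup

inS⇒∈ : {S : Subset n} {i : Fin n} → inS S i ≡ true → i ∈ S
inS⇒∈ {S = S} {i} = lookup⇒[]= i S

∉⇒inS : {S : Subset n} {i : Fin n} → i ∉ S → inS S i ≡ false
∉⇒inS {S = S} {i} i∉S with inS S i in eq
... | false = ≡-refl
... | true = ⊥-elim (i∉S (inS⇒∈ eq))

inS-⊤ : (i : Fin n) → inS ⊤ i ≡ true
inS-⊤ zero = ≡-refl
inS-⊤ (suc i) = inS-⊤ i

inS-⊥ : (i : Fin n) → inS ∅ i ≡ false
inS-⊥ zero = ≡-refl
inS-⊥ (suc i) = inS-⊥ i

inS-∁ : (S : Subset n) (i : Fin n) → inS (∁ S) i ≡ not (inS S i)
inS-∁ S i = lookup-map i not S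

inS-∩ : (S T : Subset n) (i : Fin n) → inS (S ∩ T) i ≡ inS S i ∧ inS T i
inS-∩ S T i = lookup-zipWith _∧_ i S T

inS-∪ : (S T : Subset n) (i : Fin n) → inS (S ∪ T) i ≡ inS S i ∨ inS T i
inS-∪ S T i = lookup-zipWith _∨_ i S T

inS-⁅⁆ : (u i : Fin n) → inS ⁅ u ⁆ i ≡ (i ≡ᵇ u)
inS-⁅⁆ zero zero = ≡-refl
inS-⁅⁆ zero (suc i) = inS-⊥ i
inS-⁅⁆ (suc u) zero = ≡-refl
inS-⁅⁆ (suc u) (suc i) = inS-⁅⁆ u i

inS-- : (S : Subset n) (u i : Fin n) → inS (S - u) i ≡ inS S i ∧ not (i ≡ᵇ u)
inS-- (x ∷ S) zero zero = ≡-sym (∧-zeroʳ x)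
inS-- (x ∷ S) zero (suc i) = ≡-trans (≡-cong (λ T → lookup T i) (p─⊥≡p S)) (≡-sym (∧-identityʳ _))
inS-- (x ∷ S) (suc u) zero = ≡-sym (∧-identityʳ x)
inS-- (x ∷ S) (suc u) (suc i) = inS-- S u i

∣-∣ : {S : Subset n} {u : Fin n} → u ∈ S → ∣ S ∣ ≡ suc ∣ S - u ∣
∣-∣ {S = true ∷ S} here = ≡-cong (λ T → suc ∣ T ∣) (≡-sym (p─⊥≡p S))
∣-∣ {S = true ∷ S} (there u∈S) = ≡-cong suc (∣-∣ u∈S)
∣-∣ {S = false ∷ S} (there u∈S) = ∣-∣ u∈S

size-- : {S : Subset n} {u : Fin n} {k : ℕ} → u ∈ S → ∣ S ∣ ≡ suc k → ∣ S - u ∣ ≡ k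
size-- u∈S size = ℕₚ.suc-injective (≡-trans (≡-sym (∣-∣ u∈S)) size)

∈-⇒∈ : {S : Subset n} {u v : Fin n} → u ∈ S - v → u ∈ S
∈-⇒∈ {S = S} {v = v} = p─q⊆p S ⁅ v ⁆

∈-⇒≢ : {S : Subset n} {u v : Fin n} → u ∈ S - v → u ≢ v
∈-⇒≢ {S = S} {u} p ≡-refl with ≡-trans (≡-sym (∈⇒inS p)) (≡-trans (inS-- S u u)
                              (≡-trans (≡-cong (λ b → inS S u ∧ not b) (≡ᵇ-refl u)) (∧-zeroʳ _)))
... | ()

∈-- : {S : Subset n} {u v : Fin n} → u ∈ S → u ≢ v → u ∈ S - v
∈-- = x∈p∧x≢y⇒x∈p-y

-∩ : (S C : Subset n) (u : Fin n) → (S - u) ∩ C ≡ (S ∩ C) - u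
-∩ S C u = lookup-ext eq
  where
  eq : ∀ i → inS ((S - u) ∩ C) i ≡ inS ((S ∩ C) - u) i
  eq i rewrite inS-∩ (S - u) C i | inS-- (S ∩ C) u i | inS-- S u i | inS-∩ S C i with inS S i | i ≡ᵇ u
  ... | false | _ = ≡-refl
  ... | true | true = ≡-sym (∧-zeroʳ _)
  ... | true | false = ≡-sym (∧-identityʳ _)

-∩∁ : (S C : Subset n) {u : Fin n} → u ∈ C → (S - u) ∩ ∁ C ≡ S ∩ ∁ C
-∩∁ S C {u} u∈C = lookup-ext eq
  where
  eq : ∀ i → inS ((S - u) ∩ ∁ C) i ≡ inS (S ∩ ∁ C) i
  eq i rewrite inS-∩ (S - u) (∁ C) i | inS-∩ S (∁ C) i | inS-- S u i | inS-∁ C i with i ≟F u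
  ... | yes ≡-refl rewrite ∈⇒inS u∈C = ≡-trans (∧-zeroʳ _) (≡-sym (∧-zeroʳ _))
  ... | no i≢u rewrite ∧-identityʳ (inS S i) = ≡-refl

∣∣≡0⇒∉ : {S : Subset n} → ∣ S ∣ ≡ 0 → (i : Fin n) → i ∉ S
∣∣≡0⇒∉ size i i∈S with ≡-trans (≡-sym size) (∣-∣ i∈S)
... | ()

empty⇒∣∣≡0 : {S : Subset n} → ¬ (∃[ u ] u ∈ S) → ∣ S ∣ ≡ 0
empty⇒∣∣≡0 {n} e = ≡-trans (≡-cong ∣_∣ (Empty-unique e)) (∣⊥∣≡0 n)

∣∣≡suc⇒∃ : (S : Subset n) {k : ℕ} → ∣ S ∣ ≡ suc k → ∃[ u ] u ∈ S
∣∣≡suc⇒∃ S size with nonempty? S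
... | yes e = e
... | no e with ≡-trans (≡-sym size) (empty⇒∣∣≡0 e)
...   | ()

∩∁-disjoint : (S C : Subset n) → ∣ S ∩ C ∣ ≡ 0 → S ∩ ∁ C ≡ S
∩∁-disjoint S C size = lookup-ext eq
  where
  eq : ∀ i → inS (S ∩ ∁ C) i ≡ inS S i
  eq i with ∉⇒inS {S = S ∩ C} (∣∣≡0⇒∉ size i)
  ... | out rewrite inS-∩ S (∁ C) i | inS-∁ C i | inS-∩ S C i with inS S i | inS C i
  ...   | false | _ = ≡-refl
  ...   | true | false = ≡-refl

-- Counting matchings: the recursion at a vertex

module MatchingCounts where
  open ≡-Reasoning
  private variable A B : Set

  number : (A → Bool) → List A → ℕ
  number p xs = length (filterᵇ p xs)

  number-++ : (p : A → Bool) (xs ys : List A) → number p (xs ++ ys) ≡ number p xs +ℕ number p ys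
  number-++ p [] ys = ≡-refl
  number-++ p (x ∷ xs) ys with p x
  ... | true = ≡-cong suc (number-++ p xs ys)
  ... | false = number-++ p xs ys

  number-map : (p : B → Bool) (f : A → B) (xs : List A) → number p (map f xs) ≡ number (p ∘ f) xs
  number-map p f [] = ≡-refl
  number-map p f (x ∷ xs) with p (f x)
  ... | true = ≡-cong suc (number-map p f xs)
  ... | false = number-map p f xs

  number-cong : {p q : A → Bool} → (∀ x → p x ≡ q x) → (xs : List A) → number p xs ≡ number q xs
  number-cong eq [] = ≡-refl
  number-cong {p = p} {q} eq (x ∷ xs) with p x | q x | eq x
  ... | true  | .true  | ≡-refl = ≡-cong suc (number-cong eq xs)
  ... | false | .false | ≡-refl = number-cong eq xs

  number-false : (xs : List A) → number (λ _ → false) xs ≡ 0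
  number-false [] = ≡-refl
  number-false (x ∷ xs) = number-false xs

  filterᵇ-comm : (p q : A → Bool) (xs : List A) → filterᵇ p (filterᵇ q xs) ≡ filterᵇ q (filterᵇ p xs)
  filterᵇ-comm p q [] = ≡-refl
  filterᵇ-comm p q (x ∷ xs) with p x in eqp | q x in eqq
  ... | true  | true  rewrite eqp | eqq = ≡-cong (x ∷_) (filterᵇ-comm p q xs)
  ... | true  | false rewrite eqq = filterᵇ-comm p q xs
  ... | false | true  rewrite eqp = filterᵇ-comm p q xs
  ... | false | false = filterᵇ-comm p q xs

  total : (A → ℕ) → List A → ℕ
  total f = foldr (λ x s → f x +ℕ s) 0

  total-cong : {f g : A → ℕ} → (∀ x → f x ≡ g x) → (xs : List A) → total f xs ≡ total g xs
  total-cong eq [] = ≡-refl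
  total-cong eq (x ∷ xs) = ≡-cong₂ _+ℕ_ (eq x) (total-cong eq xs)

  total-+ : (f g : A → ℕ) (xs : List A) → total (λ x → f x +ℕ g x) xs ≡ total f xs +ℕ total g xs
  total-+ f g [] = ≡-refl
  total-+ f g (x ∷ xs) = ≡-trans (≡-cong (f x +ℕ g x +ℕ_) (total-+ f g xs)) (interchange (f x) (g x) _ _)
    where
    interchange : ∀ a b c d → (a +ℕ b) +ℕ (c +ℕ d) ≡ (a +ℕ c) +ℕ (b +ℕ d)
    interchange = solve-∀

  total-filterᵇ : (p : A → Bool) (f : A → ℕ) (xs : List A) →
                  total f (filterᵇ p xs) ≡ total (λ x → if p x then f x else 0) xs
  total-filterᵇ p f [] = ≡-refl
  total-filterᵇ p f (x ∷ xs) with p x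
  ... | true = ≡-cong (f x +ℕ_) (total-filterᵇ p f xs)
  ... | false = total-filterᵇ p f xs

  Edge : ℕ → Set
  Edge n = Fin n × Fin n

  count : List (Edge n) → ℕ → ℕ
  count L r = number (λ M → isMatching M ∧ does (length M ≟ℕ r)) (sublists L)

  infixl 6 _/_ _∖_

  _/_ : List (Edge n) → Edge n → List (Edge n)
  L / e = filterᵇ (disjointE e) L

  incident : Fin n → Edge n → Bool
  incident u (a , b) = u ≡ᵇ a ∨ u ≡ᵇ b

  _∖_ : List (Edge n) → Fin n → List (Edge n)
  L ∖ u = filterᵇ (λ e → not (incident u e)) L

  count-zero : (L : List (Edge n)) → count L 0 ≡ 1
  count-zero [] = ≡-refl
  count-zero (e ∷ L) = begin
    number P (sublists L ++ map (e ∷_) (sublists L))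
      ≡⟨ number-++ P (sublists L) _ ⟩
    count L 0 +ℕ number P (map (e ∷_) (sublists L))
      ≡⟨ ≡-cong₂ _+ℕ_ (count-zero L) (number-map P (e ∷_) (sublists L)) ⟩
    1 +ℕ number (P ∘ (e ∷_)) (sublists L)
      ≡⟨ ≡-cong suc (≡-trans (number-cong (λ M → ∧-zeroʳ _) (sublists L)) (number-false (sublists L))) ⟩
    1 ∎
    where P = λ M → isMatching M ∧ does (length M ≟ℕ 0)

  -- A sublist passes the `foldr` test exactly when all its edges survive in `L / e`; hence the
  -- matchings through `e` are counted by those of `L / e`.
  number-sublists : (e : Edge n) (Q : List (Edge n) → Bool) (L : List (Edge n)) →
    number (λ M → foldr (λ f b → disjointE e f ∧ b) true M ∧ Q M) (sublists L) ≡ number Q (sublists (L / e))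
  number-sublists e Q [] with Q []
  ... | true = ≡-refl
  ... | false = ≡-refl
  number-sublists e Q (x ∷ L) = ≡-trans (number-++ P (sublists L) _)
    (≡-trans (≡-cong₂ _+ℕ_ (number-sublists e Q L) (number-map P (x ∷_) (sublists L))) rest)
    where
    P = λ M → foldr (λ f b → disjointE e f ∧ b) true M ∧ Q M
    rest : number Q (sublists (L / e)) +ℕ number (P ∘ (x ∷_)) (sublists L) ≡ number Q (sublists ((x ∷ L) / e))
    rest with disjointE e x
    ... | true = ≡-trans (≡-cong (number Q (sublists (L / e)) +ℕ_) (≡-trans (number-sublists e (Q ∘ (x ∷_)) L)
                   (≡-sym (number-map Q (x ∷_) (sublists (L / e)))))) (≡-sym (number-++ Q (sublists (L / e)) _))
    ... | false = ≡-trans (≡-cong (number Q (sublists (L / e)) +ℕ_) (number-false (sublists L))) (ℕₚ.+-identityʳ _)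

  count-∷ : (e : Edge n) (L : List (Edge n)) (r : ℕ) →
            count (e ∷ L) (suc r) ≡ count L (suc r) +ℕ count (L / e) r
  count-∷ e L r = begin
    number P (sublists L ++ map (e ∷_) (sublists L))
      ≡⟨ number-++ P (sublists L) _ ⟩
    count L (suc r) +ℕ number P (map (e ∷_) (sublists L))
      ≡⟨ ≡-cong (count L (suc r) +ℕ_) (number-map P (e ∷_) (sublists L)) ⟩
    count L (suc r) +ℕ number (P ∘ (e ∷_)) (sublists L)
      ≡⟨ ≡-cong (count L (suc r) +ℕ_) (number-cong (λ M → ∧-assoc (D M) (isMatching M) (does (length M ≟ℕ r))) (sublists L)) ⟩
    count L (suc r) +ℕ number (λ M → D M ∧ Q M) (sublists L)
      ≡⟨ ≡-cong (count L (suc r) +ℕ_) (number-sublists e Q L) ⟩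
    count L (suc r) +ℕ count (L / e) r ∎
    where
    P = λ M → isMatching M ∧ does (length M ≟ℕ suc r)
    Q = λ M → isMatching M ∧ does (length M ≟ℕ r)
    D = foldr (λ f b → disjointE e f ∧ b) true

  disjointE-sym : (e f : Edge n) → disjointE e f ≡ disjointE f e
  disjointE-sym (a , b) (c , d)
    rewrite ≡ᵇ-sym a c | ≡ᵇ-sym a d | ≡ᵇ-sym b c | ≡ᵇ-sym b d with c ≡ᵇ a | d ≡ᵇ a | c ≡ᵇ b
  ... | true  | _     | _     = ≡-refl
  ... | false | true  | true  = ≡-refl
  ... | false | true  | false = ≡-refl
  ... | false | false | true  = ≡-refl
  ... | false | false | false = ≡-refl

  incident-sound : (u : Fin n) (e : Edge n) → incident u e ≡ true → u ≡ proj₁ e ⊎ u ≡ proj₂ e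
  incident-sound u (a , b) p with u ≡ᵇ a in eq
  ... | true = inj₁ (≡ᵇ-sound u a eq)
  ... | false = inj₂ (≡ᵇ-sound u b p)

  common-vertex : (u : Fin n) (e f : Edge n) → incident u e ≡ true → incident u f ≡ true → disjointE e f ≡ false
  common-vertex u e@(a , b) f@(c , d) p q with incident-sound u e p | incident-sound u f q
  ... | inj₁ ≡-refl | inj₁ ≡-refl rewrite ≡ᵇ-refl u = ≡-refl
  ... | inj₁ ≡-refl | inj₂ ≡-refl rewrite ≡ᵇ-refl u | ∨-zeroʳ (u ≡ᵇ c) = ≡-refl
  ... | inj₂ ≡-refl | inj₁ ≡-refl rewrite ≡ᵇ-refl u | ∨-zeroʳ (a ≡ᵇ d) | ∨-zeroʳ (a ≡ᵇ u) = ≡-refl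
  ... | inj₂ ≡-refl | inj₂ ≡-refl rewrite ≡ᵇ-refl u | ∨-zeroʳ (u ≡ᵇ c) | ∨-zeroʳ (a ≡ᵇ u) | ∨-zeroʳ (a ≡ᵇ c) = ≡-refl

  self-intersects : (e : Edge n) → disjointE e e ≡ false
  self-intersects (a , b) rewrite ≡ᵇ-refl a = ≡-refl

  star : Fin n → List (Edge n) → ℕ → Edge n → ℕ
  star u L r e = if incident u e then count (L / e) r else 0

  -- The first edge `e` is split off. If `e` avoids `u`, the matchings through `e` need the claim
  -- for `L / e`, which is not a sublist by structure; the length bound `k` carries the recursion.
  count-vertex-bounded : (u : Fin n) (k : ℕ) (L : List (Edge n)) → length L ≤ k → (r : ℕ) →
    count L (suc r) ≡ count (L ∖ u) (suc r) +ℕ total (star u L r) L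
  count-vertex-bounded u k [] _ r = ≡-refl
  count-vertex-bounded u (suc k) (e ∷ L) (s≤s len) r with incident u e in u∈e
  ... | true = begin
    count (e ∷ L) (suc r)
      ≡⟨ count-∷ e L r ⟩
    count L (suc r) +ℕ count (L / e) r
      ≡⟨ ≡-cong (_+ℕ count (L / e) r) (count-vertex-bounded u k L len r) ⟩
    (count (L ∖ u) (suc r) +ℕ total (star u L r) L) +ℕ count (L / e) r
      ≡⟨ ℕₚ.+-assoc (count (L ∖ u) (suc r)) _ _ ⟩
    count (L ∖ u) (suc r) +ℕ (total (star u L r) L +ℕ count (L / e) r)
      ≡⟨ ≡-cong (count (L ∖ u) (suc r) +ℕ_) (ℕₚ.+-comm (total (star u L r) L) _) ⟩
    count (L ∖ u) (suc r) +ℕ (count (L / e) r +ℕ total (star u L r) L)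
      ≡⟨ ≡-cong (count (L ∖ u) (suc r) +ℕ_) (≡-cong₂ _+ℕ_ (≡-cong (λ L′ → count L′ r) (≡-sym skip)) (total-cong same L)) ⟩
    count (L ∖ u) (suc r) +ℕ (count ((e ∷ L) / e) r +ℕ total (star u (e ∷ L) r) L) ∎
    where
    skip : (e ∷ L) / e ≡ L / e
    skip rewrite self-intersects e = ≡-refl
    -- Two edges at `u` never lie in a common matching, so adding `e` to the list leaves every term
    -- of the star unchanged.
    same : ∀ f → star u L r f ≡ star u (e ∷ L) r f
    same f with incident u f in u∈f
    ... | false = ≡-refl
    ... | true rewrite common-vertex u f e u∈f u∈e = ≡-refl
  count-vertex-bounded {n} u (suc k) (e ∷ L) (s≤s len) r | false = begin
    count (e ∷ L) (suc r)
      ≡⟨ count-∷ e L r ⟩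
    count L (suc r) +ℕ count (L / e) r
      ≡⟨ ≡-cong₂ _+ℕ_ (count-vertex-bounded u k L len r) (by-r r) ⟩
    (count (L ∖ u) (suc r) +ℕ total (star u L r) L) +ℕ (count (L ∖ u / e) r +ℕ total (extra r) L)
      ≡⟨ interchange (count (L ∖ u) (suc r)) _ _ _ ⟩
    (count (L ∖ u) (suc r) +ℕ count (L ∖ u / e) r) +ℕ (total (star u L r) L +ℕ total (extra r) L)
      ≡⟨ ≡-cong₂ _+ℕ_ (≡-sym (count-∷ e (L ∖ u) r)) (≡-trans (≡-sym (total-+ (star u L r) (extra r) L)) (total-cong (combine r) L)) ⟩
    count (e ∷ (L ∖ u)) (suc r) +ℕ total (star u (e ∷ L) r) L ∎
    where
    interchange : ∀ a b c d → (a +ℕ b) +ℕ (c +ℕ d) ≡ (a +ℕ c) +ℕ (b +ℕ d)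
    interchange = solve-∀
    -- `extra r f` counts the matchings with r + 1 edges that contain `e` and, at the vertex `u`,
    -- the edge `f`; for r = 0 there is no room for both.
    extra : ℕ → Edge n → ℕ
    extra zero f = 0
    extra (suc r) f = if disjointE e f then star u (L / e) r f else 0
    total-0 : (xs : List (Edge n)) → total (λ _ → 0) xs ≡ 0
    total-0 [] = ≡-refl
    total-0 (x ∷ xs) = total-0 xs
    by-r : ∀ r → count (L / e) r ≡ count (L ∖ u / e) r +ℕ total (extra r) L
    by-r zero = ≡-trans (count-zero (L / e)) (≡-sym (≡-cong₂ _+ℕ_ (count-zero (L ∖ u / e)) (total-0 L)))
    by-r (suc r) = ≡-trans (count-vertex-bounded u k (L / e) (ℕₚ.≤-trans (length-filter _ L) len) r)
      (≡-cong₂ _+ℕ_ (≡-cong (λ L′ → count L′ (suc r)) (filterᵇ-comm _ (disjointE e) L))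
                 (total-filterᵇ (disjointE e) (star u (L / e) r) L))
    combine : ∀ r f → star u L r f +ℕ extra r f ≡ star u (e ∷ L) r f
    combine zero f with incident u f
    ... | false = ≡-refl
    ... | true = ≡-trans (ℕₚ.+-identityʳ _) (≡-trans (count-zero (L / f)) (≡-sym (count-zero ((e ∷ L) / f))))
    combine (suc r) f with incident u f | disjointE e f in dis
    ... | false | true = ≡-refl
    ... | false | false = ≡-refl
    ... | true | false rewrite ≡-trans (disjointE-sym f e) dis = ℕₚ.+-identityʳ _
    ... | true | true rewrite ≡-trans (disjointE-sym f e) dis =
      ≡-trans (≡-cong (λ L′ → count (L / f) (suc r) +ℕ count L′ r) (filterᵇ-comm (disjointE f) (disjointE e) L))
        (≡-sym (count-∷ e (L / f) r))

  count-vertex : (u : Fin n) (L : List (Edge n)) (r : ℕ) →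
    count L (suc r) ≡ count (L ∖ u) (suc r) +ℕ total (star u L r) L
  count-vertex u L = count-vertex-bounded u (length L) L ℕₚ.≤-refl

  module ℕSum = SemiringSum ℕₚ.+-*-semiring

  filterᵇ-concatMap : (p : B → Bool) (g : A → List B) (xs : List A) →
    filterᵇ p (concatMap g xs) ≡ concatMap (filterᵇ p ∘ g) xs
  filterᵇ-concatMap p g [] = ≡-refl
  filterᵇ-concatMap p g (x ∷ xs) = ≡-trans (filter-++ _ (g x) _) (≡-cong (filterᵇ p (g x) ++_) (filterᵇ-concatMap p g xs))

  total-++ : (f : A → ℕ) (xs ys : List A) → total f (xs ++ ys) ≡ total f xs +ℕ total f ys
  total-++ f [] ys = ≡-refl
  total-++ f (x ∷ xs) ys = ≡-trans (≡-cong (f x +ℕ_) (total-++ f xs ys)) (≡-sym (ℕₚ.+-assoc (f x) _ _))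

  total-concatMap : (f : B → ℕ) (g : A → List B) (xs : List A) →
    total f (concatMap g xs) ≡ total (λ x → total f (g x)) xs
  total-concatMap f g [] = ≡-refl
  total-concatMap f g (x ∷ xs) = ≡-trans (total-++ f (g x) _) (≡-cong (total f (g x) +ℕ_) (total-concatMap f g xs))

  total-tabulate : (f : A → ℕ) (g : Fin n → A) → total f (tabulate g) ≡ ℕSum.sum (f ∘ g)
  total-tabulate {n = zero} f g = ≡-refl
  total-tabulate {n = suc n} f g = ≡-cong (f (g zero) +ℕ_) (total-tabulate f (g ∘ suc))

  sum-delta : (u : Fin n) (f : Fin n → ℕ) → ℕSum.sum (λ i → if i ≡ᵇ u then f i else 0) ≡ f u
  sum-delta {suc n} zero f = ≡-trans (≡-cong (f zero +ℕ_) (ℕSum.sum-replicate-zero n)) (ℕₚ.+-identityʳ _)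
  sum-delta (suc u) f = sum-delta u (f ∘ suc)

  filterᵇ-if : (p : A → Bool) (x : A) (l s t e s′ t′ : Bool) → (s ∧ t) ∧ p x ≡ s′ ∧ t′ →
    filterᵇ p (if l ∧ s ∧ t ∧ e then x ∷ [] else []) ≡ (if l ∧ s′ ∧ t′ ∧ e then x ∷ [] else [])
  filterᵇ-if p x false s t e s′ t′ eq = ≡-refl
  filterᵇ-if p x true s t e s′ t′ eq
    rewrite ≡-sym (∧-assoc s t e) | ≡-sym (∧-assoc s′ t′ e) | ≡-sym eq with s ∧ t | e | p x in px
  ... | false | _     | _ = ≡-refl
  ... | true  | false | true  = ≡-refl
  ... | true  | false | false = ≡-refl
  ... | true  | true  | true  rewrite px = ≡-refl
  ... | true  | true  | false rewrite px = ≡-refl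

  module _ (E : Adj n) where

    filterᵇ-edges : (p : Edge n → Bool) (S S′ : Subset n) →
      (∀ i j → (inS S i ∧ inS S j) ∧ p (i , j) ≡ inS S′ i ∧ inS S′ j) → filterᵇ p (edges E S) ≡ edges E S′
    filterᵇ-edges p S S′ eq = ≡-trans (filterᵇ-concatMap p _ (allFin n)) (concatMap-cong (λ i →
      ≡-trans (filterᵇ-concatMap p _ (allFin n)) (concatMap-cong (λ j →
        filterᵇ-if p (i , j) (does (i <? j)) (inS S i) (inS S j) (E i j) (inS S′ i) (inS S′ j) (eq i j))
        (allFin n))) (allFin n))

    edges-∖ : (S : Subset n) (u : Fin n) → edges E S ∖ u ≡ edges E (S - u)
    edges-∖ S u = filterᵇ-edges _ S (S - u) eq
      where
      eq : ∀ i j → (inS S i ∧ inS S j) ∧ not (u ≡ᵇ i ∨ u ≡ᵇ j) ≡ inS (S - u) i ∧ inS (S - u) j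
      eq i j rewrite inS-- S u i | inS-- S u j | ≡ᵇ-sym u i | ≡ᵇ-sym u j with inS S i | inS S j | i ≡ᵇ u | j ≡ᵇ u
      ... | false | _ | _ | _ = ≡-refl
      ... | true | false | true  | _ = ≡-refl
      ... | true | false | false | _ = ≡-refl
      ... | true | true | true  | _ = ≡-refl
      ... | true | true | false | true = ≡-refl
      ... | true | true | false | false = ≡-refl

    edges-/ : (S : Subset n) (a b : Fin n) → edges E S / (a , b) ≡ edges E (S - a - b)
    edges-/ S a b = filterᵇ-edges _ S (S - a - b) eq
      where
      eq : ∀ i j → (inS S i ∧ inS S j) ∧ disjointE (a , b) (i , j) ≡ inS (S - a - b) i ∧ inS (S - a - b) j
      eq i j rewrite inS-- (S - a) b i | inS-- (S - a) b j | inS-- S a i | inS-- S a j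
                   | ≡ᵇ-sym a i | ≡ᵇ-sym a j | ≡ᵇ-sym b i | ≡ᵇ-sym b j
        with inS S i | inS S j | i ≡ᵇ a | i ≡ᵇ b | j ≡ᵇ a | j ≡ᵇ b
      ... | false | _ | _ | _ | _ | _ = ≡-refl
      ... | true | false | true  | _     | _ | _ = ≡-refl
      ... | true | false | false | true  | _ | _ = ≡-refl
      ... | true | false | false | false | _ | _ = ≡-refl
      ... | true | true | true  | _     | _ | _ = ≡-refl
      ... | true | true | false | true  | true | _ = ≡-refl
      ... | true | true | false | true  | false | _ = ≡-refl
      ... | true | true | false | false | true  | _ = ≡-refl
      ... | true | true | false | false | false | true = ≡-refl
      ... | true | true | false | false | false | false = ≡-refl

    total-edges : (F : Edge n → ℕ) (S : Subset n) → total F (edges E S) ≡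
      ℕSum.sum (λ i → ℕSum.sum (λ j → if does (i <? j) ∧ inS S i ∧ inS S j ∧ E i j then F (i , j) else 0))
    total-edges F S = begin
      total F (concatMap row (allFin n))
        ≡⟨ total-concatMap F row (allFin n) ⟩
      total (λ i → total F (row i)) (allFin n)
        ≡⟨ total-tabulate (λ i → total F (row i)) id ⟩
      ℕSum.sum (λ i → total F (concatMap (cell i) (allFin n)))
        ≡⟨ ℕSum.sum-cong-≗ (λ i → ≡-trans (total-concatMap F (cell i) (allFin n)) (total-tabulate (λ j → total F (cell i j)) id)) ⟩
      ℕSum.sum (λ i → ℕSum.sum (λ j → total F (cell i j)))
        ≡⟨ ℕSum.sum-cong-≗ (λ i → ℕSum.sum-cong-≗ (λ j → total-if (i , j) (c i j))) ⟩
      ℕSum.sum (λ i → ℕSum.sum (λ j → if c i j then F (i , j) else 0)) ∎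
      where
      c : Fin n → Fin n → Bool
      c i j = does (i <? j) ∧ inS S i ∧ inS S j ∧ E i j
      cell : Fin n → Fin n → List (Edge n)
      cell i j = if c i j then (i , j) ∷ [] else []
      row : Fin n → List (Edge n)
      row i = concatMap (cell i) (allFin n)
      total-if : ∀ x b → total F (if b then x ∷ [] else []) ≡ (if b then F x else 0)
      total-if x true = ℕₚ.+-identityʳ _
      total-if x false = ≡-refl

    module _ (E-sym : ∀ i j → E i j ≡ E j i) where

      -- Each edge at u is listed once, as (u , z) or as (z , u).
      total-star : (S : Subset n) (u : Fin n) → u ∈ S → (F : Edge n → ℕ) → (∀ i j → F (i , j) ≡ F (j , i)) →
        total (λ e → if incident u e then F e else 0) (edges E S) ≡
        ℕSum.sum (λ z → if inS (S - u) z ∧ E u z then F (u , z) else 0)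
      total-star S u u∈S F F-sym = begin
        total (λ e → if incident u e then F e else 0) (edges E S)
          ≡⟨ total-edges _ S ⟩
        ℕSum.sum (λ i → ℕSum.sum (λ j → if c i j then (if incident u (i , j) then F (i , j) else 0) else 0))
          ≡⟨ ℕSum.sum-cong-≗ (λ i → ≡-trans (ℕSum.sum-cong-≗ (split i)) (ℕSum.∑-distrib-+ (left i) (right i))) ⟩
        ℕSum.sum (λ i → ℕSum.sum (left i) +ℕ ℕSum.sum (right i))
          ≡⟨ ℕSum.∑-distrib-+ (λ i → ℕSum.sum (left i)) (λ i → ℕSum.sum (right i)) ⟩
        ℕSum.sum (λ i → ℕSum.sum (left i)) +ℕ ℕSum.sum (λ i → ℕSum.sum (right i))
          ≡⟨ ≡-cong₂ _+ℕ_ (ℕSum.∑-comm left) (ℕSum.sum-cong-≗ (λ i → sum-delta u (f i))) ⟩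
        ℕSum.sum (λ j → ℕSum.sum (λ i → left i j)) +ℕ ℕSum.sum (λ i → f i u)
          ≡⟨ ≡-cong (_+ℕ ℕSum.sum (λ i → f i u)) (ℕSum.sum-cong-≗ (λ j → sum-delta u (λ i → f i j))) ⟩
        ℕSum.sum (f u) +ℕ ℕSum.sum (λ i → f i u)
          ≡⟨ ℕSum.∑-distrib-+ (f u) (λ i → f i u) ⟨
        ℕSum.sum (λ z → f u z +ℕ f z u)
          ≡⟨ ℕSum.sum-cong-≗ merge ⟩
        ℕSum.sum (λ z → if inS (S - u) z ∧ E u z then F (u , z) else 0) ∎
        where
        c : Fin n → Fin n → Bool
        c i j = does (i <? j) ∧ inS S i ∧ inS S j ∧ E i j
        f left right : Fin n → Fin n → ℕ
        f i j = if c i j then F (i , j) else 0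
        left i j = if i ≡ᵇ u then f i j else 0
        right i j = if j ≡ᵇ u then f i j else 0
        c-irrefl : ∀ i → c i i ≡ false
        c-irrefl i rewrite dec-false (i <? i) (λ p → ℕₚ.<-irrefl ≡-refl p) = ≡-refl
        split : ∀ i j → (if c i j then (if incident u (i , j) then F (i , j) else 0) else 0) ≡ left i j +ℕ right i j
        split i j with u ≟F i | u ≟F j
        ... | yes ≡-refl | yes ≡-refl rewrite c-irrefl u | ≡ᵇ-refl u = ≡-refl
        ... | yes ≡-refl | no ne rewrite ≡ᵇ-refl u | ≢⇒≡ᵇ-false (ne ∘ ≡-sym) = ≡-sym (ℕₚ.+-identityʳ _)
        ... | no ne | yes ≡-refl rewrite ≡ᵇ-refl u | ≢⇒≡ᵇ-false (ne ∘ ≡-sym) = ≡-refl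
        ... | no ne | no ne′ rewrite ≢⇒≡ᵇ-false (ne ∘ ≡-sym) | ≢⇒≡ᵇ-false (ne′ ∘ ≡-sym) with c i j
        ...   | true = ≡-refl
        ...   | false = ≡-refl
        merge : ∀ z → f u z +ℕ f z u ≡ (if inS (S - u) z ∧ E u z then F (u , z) else 0)
        merge z rewrite inS-- S u z | ∈⇒inS u∈S with <-cmp u z
        ... | tri< u<z u≢z z≮u rewrite dec-true (u <? z) u<z | dec-false (z <? u) z≮u
                                     | ≢⇒≡ᵇ-false (u≢z ∘ ≡-sym) | ∧-identityʳ (inS S z) = ℕₚ.+-identityʳ _
        ... | tri≈ u≮z ≡-refl _ rewrite dec-false (u <? u) u≮z | ≡ᵇ-refl u | ∧-zeroʳ (inS S u) = ≡-refl
        ... | tri> u≮z u≢z z<u rewrite dec-true (z <? u) z<u | dec-false (u <? z) u≮z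
                                     | ≢⇒≡ᵇ-false (u≢z ∘ ≡-sym) | ∧-identityʳ (inS S z) | E-sym z u | F-sym z u = ≡-refl

      numMatchings-vertex : (S : Subset n) (u : Fin n) → u ∈ S → ∀ r →
        numMatchings E S (suc r) ≡ numMatchings E (S - u) (suc r) +ℕ
          ℕSum.sum (λ z → if inS (S - u) z ∧ E u z then numMatchings E (S - u - z) r else 0)
      numMatchings-vertex S u u∈S r = begin
        count (edges E S) (suc r)
          ≡⟨ count-vertex u (edges E S) r ⟩
        count (edges E S ∖ u) (suc r) +ℕ total (star u (edges E S) r) (edges E S)
          ≡⟨ ≡-cong₂ _+ℕ_ (≡-cong (λ L → count L (suc r)) (edges-∖ S u)) (total-star S u u∈S _ F-sym) ⟩
        numMatchings E (S - u) (suc r) +ℕ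
          ℕSum.sum (λ z → if inS (S - u) z ∧ E u z then count (edges E S / (u , z)) r else 0)
          ≡⟨ ≡-cong (numMatchings E (S - u) (suc r) +ℕ_) (ℕSum.sum-cong-≗ (λ z →
               ≡-cong (λ L → if inS (S - u) z ∧ E u z then count L r else 0) (edges-/ S u z))) ⟩
        numMatchings E (S - u) (suc r) +ℕ
          ℕSum.sum (λ z → if inS (S - u) z ∧ E u z then numMatchings E (S - u - z) r else 0) ∎
        where
        F-sym : ∀ i j → count (edges E S / (i , j)) r ≡ count (edges E S / (j , i)) r
        F-sym i j = ≡-cong (λ L → count L r) (≡-trans (edges-/ S i j)
          (≡-trans (≡-cong (edges E) (p─x─y≡p─y─x S i j)) (≡-sym (edges-/ S j i))))

      -- Balances the truncation in `μ`: deleting a vertex may shorten the alternating sum by one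
      -- term, and the coefficient missing there counts matchings that are too large to exist.
      numMatchings-big : (k : ℕ) (S : Subset n) → ∣ S ∣ ≡ k → ∀ r → k <ℕ r +ℕ r → numMatchings E S r ≡ 0
      numMatchings-big k S eq (suc r) lt with nonempty? S
      ... | no empty = ≡-cong (λ L → count L (suc r)) edges≡[]
        where
        out : ∀ i → inS S i ≡ false
        out i = ∉⇒inS (λ i∈S → empty (i , i∈S))
        concatMap-[] : {A B : Set} (xs : List A) → concatMap {B = B} (λ _ → []) xs ≡ []
        concatMap-[] [] = ≡-refl
        concatMap-[] (x ∷ xs) = concatMap-[] xs
        cell : ∀ i j → (if does (i <? j) ∧ inS S i ∧ inS S j ∧ E i j then (i , j) ∷ [] else []) ≡ []
        cell i j rewrite out i | ∧-zeroʳ (does (i <? j)) = ≡-refl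
        edges≡[] : edges E S ≡ []
        edges≡[] = ≡-trans (concatMap-cong (λ i → ≡-trans (concatMap-cong (cell i) (allFin n)) (concatMap-[] (allFin n)))
                     (allFin n)) (concatMap-[] (allFin n))
      numMatchings-big zero S eq (suc r) lt | yes (u , u∈S) with ≡-trans (≡-sym eq) (∣-∣ u∈S)
      ... | ()
      numMatchings-big (suc k) S eq (suc r) (s≤s lt) | yes (u , u∈S) = ≡-trans (numMatchings-vertex S u u∈S r)
        (≡-cong₂ _+ℕ_ (numMatchings-big k (S - u) size (suc r) (ℕₚ.≤-trans (s≤s (ℕₚ.n≤1+n k)) (s≤s lt)))
          (≡-trans (ℕSum.sum-cong-≗ none) (ℕSum.sum-replicate-zero n)))
        where
        size : ∣ S - u ∣ ≡ k
        size = size-- u∈S eq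
        none : ∀ z → (if inS (S - u) z ∧ E u z then numMatchings E (S - u - z) r else 0) ≡ 0
        none z with inS (S - u) z in z∈S | E u z
        ... | false | _ = ≡-refl
        ... | true | false = ≡-refl
        ... | true | true = go k size lt
          where
          -- S - u - z has two vertices fewer, so the size is split once more to reach a
          -- structurally smaller argument.
          go : ∀ k → ∣ S - u ∣ ≡ k → suc k ≤ r +ℕ suc r → numMatchings E (S - u - z) r ≡ 0
          go zero eq′ _ with ≡-trans (≡-sym eq′) (∣-∣ {S = S - u} (inS⇒∈ {S = S - u} {z} z∈S))
          ... | ()
          go (suc k) eq′ lt′ = numMatchings-big k (S - u - z)
            (size-- {S = S - u} (inS⇒∈ {S = S - u} {z} z∈S) eq′) r
            (ℕₚ.≤-pred (ℕₚ.≤-trans lt′ (ℕₚ.≤-reflexive (ℕₚ.+-suc r r))))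
  

open MatchingCounts using (count; count-zero; numMatchings-vertex; numMatchings-big; module ℕSum)

-- Matching polynomials as monic series satisfying the vertex recursion

module Expansion (ℝ : RealNumbers) (θ : RealNumbers.Carrier ℝ) where
  open RealNumbers ℝ hiding (zero; _-_)
  open RealSeries ℝ
  open SeriesSums ℝ
  open Taylor ℝ
  open Poly ℝ
  open Matching ℝ
  open RingProperties ring using (-‿involutive; -0#≈0#)
  open SetoidReasoning Ser.setoid

  x : Series
  x = X θ

  nat : ℕ → Series
  nat k = const (fromℕ k)

  fromℕ-+ : ∀ a b → fromℕ (a +ℕ b) ≈ fromℕ a + fromℕ b
  fromℕ-+ zero b = sym (+-identityˡ _)
  fromℕ-+ (suc a) b = trans (+-congˡ (fromℕ-+ a b)) (sym (+-assoc _ _ _))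

  nat-+ : ∀ a b → nat (a +ℕ b) ≋ nat a ⊞ nat b
  nat-+ a b = Ser.trans (const-cong (fromℕ-+ a b)) (const-+ _ _)

  -- Σ_r (-1)^r c(r) x^(s-2r) over 0 ≤ r ≤ s/2
  alternating : ℕ → (ℕ → ℕ) → Series
  alternating zero c = nat (c 0) ⊛ (x ^ₛ 0)
  alternating (suc zero) c = nat (c 0) ⊛ (x ^ₛ 1)
  alternating (suc (suc s)) c = nat (c 0) ⊛ (x ^ₛ suc (suc s)) ⊞ (⊟ alternating s (c ∘ suc))

  signed-suc : ∀ r p → fromℤ (signed (suc r) p) ≈ - fromℤ (signed r p)
  signed-suc zero zero = sym -0#≈0#
  signed-suc zero (suc p) = refl
  signed-suc (suc zero) zero = sym -0#≈0#
  signed-suc (suc zero) (suc p) = sym (-‿involutive _)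
  signed-suc (suc (suc r)) p = signed-suc r p

  partialSum : ℕ → (ℕ → Series) → Series
  partialSum zero g = 0ₛ
  partialSum (suc m) g = g 0 ⊞ partialSum m (g ∘ suc)

  taylor-foldr : (a : ℕ → Carrier) (e f : ℕ → ℕ) (m : ℕ) →
    taylor θ (foldr (λ r acc → monomial (a r) (e r) +P acc) [] (applyUpTo f m)) ≋
    partialSum m (λ r → const (a (f r)) ⊛ (x ^ₛ e (f r)))
  taylor-foldr a e f zero = Ser.refl
  taylor-foldr a e f (suc m) = Ser.trans (taylor-+P θ (monomial (a (f 0)) (e (f 0))) _)
    (Ser.+-cong (taylor-monomial θ (a (f 0)) (e (f 0))) (taylor-foldr a e (f ∘ suc) m))

  term : ℕ → (ℕ → ℕ) → ℕ → Series
  term s c r = const (fromℤ (signed r (c r))) ⊛ (x ^ₛ (s ∸ (r +ℕ r)))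

  term-suc : ∀ s c r → term (suc (suc s)) c (suc r) ≋ ⊟ term s (c ∘ suc) r
  term-suc s c r = begin
    const (fromℤ (signed (suc r) (c (suc r)))) ⊛ (x ^ₛ (suc s ∸ (r +ℕ suc r)))
      ≡⟨ ≡-cong (λ m → const (fromℤ (signed (suc r) (c (suc r)))) ⊛ (x ^ₛ (suc s ∸ m))) (ℕₚ.+-suc r r) ⟩
    const (fromℤ (signed (suc r) (c (suc r)))) ⊛ p
      ≈⟨ Ser.*-congʳ {p} (Ser.trans (const-cong (signed-suc r (c (suc r)))) (const-neg _)) ⟩
    (⊟ const (fromℤ (signed r (c (suc r))))) ⊛ p
      ≈⟨ -‿distribˡ-*′ (const (fromℤ (signed r (c (suc r))))) p ⟨
    ⊟ (const (fromℤ (signed r (c (suc r)))) ⊛ p) ∎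
    where
    p = x ^ₛ (s ∸ (r +ℕ r))
    open RingProperties Ser.ring using () renaming (-‿distribˡ-* to -‿distribˡ-*′)

  partialSum-neg : ∀ m {f g : ℕ → Series} → (∀ r → f r ≋ ⊟ g r) → partialSum m f ≋ ⊟ partialSum m g
  partialSum-neg zero eq = pointwise λ _ → sym -0#≈0#
  partialSum-neg (suc m) {f} {g} eq = Ser.trans (Ser.+-cong (eq 0) (partialSum-neg m (λ r → eq (suc r))))
    (⁻¹-∙-comm (g 0) _)
    where
    open AbelianGroupProperties Ser.+-abelianGroup using (⁻¹-∙-comm)

  partialSum-term : ∀ s c → partialSum (suc ⌊ s /2⌋) (term s c) ≋ alternating s c
  partialSum-term zero c = Ser.+-identityʳ _
  partialSum-term (suc zero) c = Ser.+-identityʳ _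
  partialSum-term (suc (suc s)) c = Ser.+-congˡ (Ser.trans (partialSum-neg (suc ⌊ s /2⌋) (term-suc s c))
    (Ser.-‿cong (partialSum-term s (c ∘ suc))))

  taylor-μ : ∀ {n} (E : Adj n) (S : Subset n) → taylor θ (μ E S) ≋ alternating ∣ S ∣ (numMatchings E S)
  taylor-μ E S = Ser.trans (taylor-foldr (λ r → fromℤ (signed r (numMatchings E S r))) (λ r → ∣ S ∣ ∸ (r +ℕ r)) id (suc ⌊ ∣ S ∣ /2⌋)) (partialSum-term ∣ S ∣ (numMatchings E S))

  alternating-cong : ∀ s {c d : ℕ → ℕ} → (∀ r → c r ≡ d r) → alternating s c ≋ alternating s d
  alternating-cong zero eq = Ser.reflexive (≡-cong (λ k → nat k ⊛ (x ^ₛ 0)) (eq 0))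
  alternating-cong (suc zero) eq = Ser.reflexive (≡-cong (λ k → nat k ⊛ (x ^ₛ 1)) (eq 0))
  alternating-cong (suc (suc s)) eq =
    Ser.+-cong (Ser.reflexive (≡-cong (λ k → nat k ⊛ (x ^ₛ suc (suc s))) (eq 0)))
      (Ser.-‿cong (alternating-cong s (λ r → eq (suc r))))

  nat-⊛-+ : ∀ a b f → nat (a +ℕ b) ⊛ f ≋ nat a ⊛ f ⊞ nat b ⊛ f
  nat-⊛-+ a b f = Ser.trans (Ser.*-congʳ {f} (nat-+ a b)) (Ser.distribʳ f (nat a) (nat b))

  alternating-+ : ∀ s (c d : ℕ → ℕ) → alternating s (λ r → c r +ℕ d r) ≋ alternating s c ⊞ alternating s d
  alternating-+ zero c d = nat-⊛-+ (c 0) (d 0) _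
  alternating-+ (suc zero) c d = nat-⊛-+ (c 0) (d 0) _
  alternating-+ (suc (suc s)) c d =
    Ser.trans (Ser.+-cong (nat-⊛-+ (c 0) (d 0) _) (Ser.-‿cong (alternating-+ s (c ∘ suc) (d ∘ suc))))
      (SI.neg-+-interchange _ _ _ _)

  nat-0-⊛ : ∀ f → nat 0 ⊛ f ≋ 0ₛ
  nat-0-⊛ f = Ser.trans (Ser.*-congʳ {f} const-0) (Ser.zeroˡ f)

  alternating-0 : ∀ s → alternating s (λ _ → 0) ≋ 0ₛ
  alternating-0 zero = nat-0-⊛ _
  alternating-0 (suc zero) = nat-0-⊛ _
  alternating-0 (suc (suc s)) = Ser.trans (Ser.+-cong (nat-0-⊛ (x ^ₛ suc (suc s))) (Ser.-‿cong (alternating-0 s)))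
    (Ser.-‿inverseʳ 0ₛ)

  alternating-sum : ∀ s {n} (b : Fin n → ℕ → ℕ) →
    alternating s (λ r → ℕSum.sum (λ z → b z r)) ≋ sum (λ z → alternating s (b z))
  alternating-sum s {zero} b = alternating-0 s
  alternating-sum s {suc n} b = Ser.trans (alternating-+ s (b zero) (λ r → ℕSum.sum (λ z → b (suc z) r)))
    (Ser.+-congˡ {alternating s (b zero)} (alternating-sum s (λ z → b (suc z))))

  -- The right-hand side is `alternating (suc (suc s)) a` unfolded. For even s it has one term more
  -- than the left-hand side, with coefficient a (s/2 + 1), which is zero by hypothesis.
  x-⊛-alternating : ∀ s (a : ℕ → ℕ) → (∀ r → suc s <ℕ r +ℕ r → a r ≡ 0) →
    x ⊛ alternating (suc s) a ≋ nat (a 0) ⊛ (x ^ₛ suc (suc s)) ⊞ (⊟ alternating s (a ∘ suc))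
  x-⊛-alternating zero a big = Ser.trans (SI.neg-difference-zero x (nat (a 0)) (x ^ₛ 1))
    (Ser.+-congˡ (Ser.-‿cong (Ser.sym (Ser.trans
      (Ser.reflexive (≡-cong (λ k → nat k ⊛ (x ^ₛ 0)) (big 1 ℕₚ.≤-refl))) (nat-0-⊛ (x ^ₛ 0))))))
  x-⊛-alternating (suc s) a big = Ser.trans
    (SI.*-difference x (nat (a 0)) (x ^ₛ suc (suc s)) (alternating s (a ∘ suc)))
    (Ser.+-congˡ (Ser.-‿cong (rest s big)))
    where
    rest : ∀ s → (∀ r → suc (suc s) <ℕ r +ℕ r → a r ≡ 0) → x ⊛ alternating s (a ∘ suc) ≋ alternating (suc s) (a ∘ suc)
    rest zero big = SI.*-swap x (nat (a 1)) (x ^ₛ 0)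
    rest (suc s) big = x-⊛-alternating s (a ∘ suc) (λ r lt → big (suc r)
      (s≤s (ℕₚ.≤-trans (s≤s lt) (ℕₚ.≤-reflexive (≡-sym (ℕₚ.+-suc r r))))))

  x-⊛-suc : ∀ f i → (x ⊛ f) (suc i) ≈ θ * f (suc i) + f i
  x-⊛-suc f i = trans (⊛-distribʳ f (const θ) ε (suc i)) (+-cong (const-⊛ θ f (suc i)) (ε-⊛-suc f i))

  Degree≤ : ℕ → Series → Set
  Degree≤ d f = ∀ i → d <ℕ i → f i ≈ 0#

  module Family {n : ℕ} (E : Adj n) (E-sym : ∀ i j → E i j ≡ E j i) where

    M : Subset n → Series
    M S = taylor θ (μ E S)

    M-size : ∀ S {s} → ∣ S ∣ ≡ s → M S ≋ alternating s (numMatchings E S)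
    M-size S ≡-refl = taylor-μ E S

    numMatchings-zero : ∀ S → numMatchings E S 0 ≡ 1
    numMatchings-zero S = count-zero (edges E S)

    nat-1 : nat 1 ≋ 1ₛ
    nat-1 = const-cong (+-identityʳ 1#)

    M-empty : ∀ S → ∣ S ∣ ≡ 0 → M S ≋ 1ₛ
    M-empty S eq = begin
      M S                              ≈⟨ M-size S eq ⟩
      nat (numMatchings E S 0) ⊛ 1ₛ    ≡⟨ ≡-cong (λ k → nat k ⊛ 1ₛ) (numMatchings-zero S) ⟩
      nat 1 ⊛ 1ₛ                       ≈⟨ Ser.*-identityʳ _ ⟩
      nat 1                            ≈⟨ nat-1 ⟩
      1ₛ                               ∎

    M-vertex : ∀ S u → u ∈ S →
      M S ≋ x ⊛ M (S - u) ⊞ (⊟ sum (λ z → when (inS (S - u) z ∧ E u z) (M (S - u - z))))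
    M-vertex S u u∈S = go ∣ S - u ∣ ≡-refl
      where
      c a : ℕ → ℕ
      c = numMatchings E S
      a = numMatchings E (S - u)
      b : Fin n → ℕ → ℕ
      b z r = if inS (S - u) z ∧ E u z then numMatchings E (S - u - z) r else 0
      N : Fin n → Series
      N z = when (inS (S - u) z ∧ E u z) (M (S - u - z))
      go : ∀ k → ∣ S - u ∣ ≡ k → M S ≋ x ⊛ M (S - u) ⊞ (⊟ sum N)
      -- `alternating 1` has no subtracted part, so a single vertex is treated apart; no neighbour
      -- remains either.
      go zero size = begin
        M S                              ≈⟨ M-size S (≡-trans (∣-∣ u∈S) (≡-cong suc size)) ⟩
        nat (c 0) ⊛ (x ⊛ 1ₛ)             ≡⟨ ≡-cong (λ k → nat k ⊛ (x ⊛ 1ₛ)) (numMatchings-zero S) ⟩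
        nat 1 ⊛ (x ⊛ 1ₛ)                 ≈⟨ Ser.*-congʳ {x ⊛ 1ₛ} nat-1 ⟩
        1ₛ ⊛ (x ⊛ 1ₛ)                    ≈⟨ Ser.*-identityˡ _ ⟩
        x ⊛ 1ₛ                           ≈⟨ Ser.*-congˡ {x} (Ser.sym (M-empty (S - u) size)) ⟩
        x ⊛ M (S - u)                    ≈⟨ Ser.+-identityʳ _ ⟨
        x ⊛ M (S - u) ⊞ 0ₛ               ≈⟨ Ser.+-congˡ {x ⊛ M (S - u)} (pointwise λ _ → -0#≈0#) ⟨
        x ⊛ M (S - u) ⊞ (⊟ 0ₛ)           ≈⟨ Ser.+-congˡ {x ⊛ M (S - u)} (Ser.-‿cong (sum-0 N none)) ⟨
        x ⊛ M (S - u) ⊞ (⊟ sum N)        ∎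
        where
        none : ∀ z → N z ≋ 0ₛ
        none z with inS (S - u) z in z∈S
        ... | false = Ser.refl
        ... | true with ≡-trans (≡-sym size) (∣-∣ {S = S - u} (inS⇒∈ {S = S - u} {z} z∈S))
        ...   | ()
      go (suc s) size = begin
        M S
          ≈⟨ M-size S (≡-trans (∣-∣ u∈S) (≡-cong suc size)) ⟩
        nat (c 0) ⊛ p ⊞ (⊟ alternating s (c ∘ suc))
          ≡⟨ ≡-cong (λ k → nat k ⊛ p ⊞ (⊟ alternating s (c ∘ suc)))
               (≡-trans (numMatchings-zero S) (≡-sym (numMatchings-zero (S - u)))) ⟩
        nat (a 0) ⊛ p ⊞ (⊟ alternating s (c ∘ suc))
          ≈⟨ Ser.+-congˡ {nat (a 0) ⊛ p} (Ser.-‿cong (alternating-cong s (numMatchings-vertex E E-sym S u u∈S))) ⟩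
        nat (a 0) ⊛ p ⊞ (⊟ alternating s (λ r → a (suc r) +ℕ ℕSum.sum (λ z → b z r)))
          ≈⟨ Ser.+-congˡ {nat (a 0) ⊛ p} (Ser.-‿cong (Ser.trans (alternating-+ s (a ∘ suc) _)
               (Ser.+-congˡ {alternating s (a ∘ suc)} (alternating-sum s b)))) ⟩
        nat (a 0) ⊛ p ⊞ (⊟ (alternating s (a ∘ suc) ⊞ sum (λ z → alternating s (b z))))
          ≈⟨ SI.subtract-sum (nat (a 0) ⊛ p) (alternating s (a ∘ suc)) (sum (λ z → alternating s (b z))) ⟩
        (nat (a 0) ⊛ p ⊞ (⊟ alternating s (a ∘ suc))) ⊞ (⊟ sum (λ z → alternating s (b z)))
          ≈⟨ Ser.+-cong (Ser.sym (x-⊛-alternating s a (numMatchings-big E E-sym (suc s) (S - u) size)))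
               (Ser.-‿cong (SerSum.sum-cong-≋ part)) ⟩
        x ⊛ alternating (suc s) a ⊞ (⊟ sum N)
          ≈⟨ Ser.+-congʳ {⊟ sum N} (Ser.*-congˡ {x} (M-size (S - u) size)) ⟨
        x ⊛ M (S - u) ⊞ (⊟ sum N) ∎
        where
        p = x ^ₛ suc (suc s)
        part : ∀ z → alternating s (b z) ≋ N z
        part z with inS (S - u) z in z∈S | E u z
        ... | false | _ = alternating-0 s
        ... | true | false = alternating-0 s
        ... | true | true = Ser.sym (M-size (S - u - z)
          (size-- {S = S - u} (inS⇒∈ {S = S - u} {z} z∈S) size))

    degree-sum : ∀ {m d} (f : Fin m → Series) → (∀ z → Degree≤ d (f z)) → Degree≤ d (sum f)
    degree-sum {zero} f deg i lt = refl
    degree-sum {suc m} f deg i lt =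
      trans (+-cong (deg zero i lt) (degree-sum (λ z → f (suc z)) (λ z → deg (suc z)) i lt)) (+-identityˡ 0#)

    -- Since x = θ + ε, the expansion is monic in `ε` as well. The top coefficient 1 keeps the
    -- series from being zero, so that an order exists.
    M-monic : ∀ k S → ∣ S ∣ ≡ k → M S k ≈ 1# × Degree≤ k (M S)
    M-monic k S size with nonempty? S
    M-monic zero S size | yes (u , u∈S) with ≡-trans (≡-sym size) (∣-∣ u∈S)
    ... | ()
    M-monic (suc k) S size | no empty = ⊥-elim (empty (∣∣≡suc⇒∃ S size))
    M-monic zero S size | no _ = at (M-empty S size) 0 , deg
      where
      deg : Degree≤ 0 (M S)
      deg (suc i) _ = at (M-empty S size) (suc i)
    M-monic (suc k) S size | yes (u , u∈S) = lead , deg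
      where
      N : Fin n → Series
      N z = when (inS (S - u) z ∧ E u z) (M (S - u - z))
      size′ : ∣ S - u ∣ ≡ k
      size′ = size-- u∈S size
      ih : M (S - u) k ≈ 1# × Degree≤ k (M (S - u))
      ih = M-monic k (S - u) size′
      degN : ∀ z → Degree≤ k (N z)
      degN z i lt with inS (S - u) z in z∈S | E u z
      ... | false | _ = refl
      ... | true | false = refl
      ... | true | true = go k size′ lt
        where
        go : ∀ k → ∣ S - u ∣ ≡ k → k <ℕ i → M (S - u - z) i ≈ 0#
        go zero eq _ with ≡-trans (≡-sym eq) (∣-∣ {S = S - u} (inS⇒∈ {S = S - u} {z} z∈S))
        ... | ()
        go (suc k) eq lt = proj₂ (M-monic k (S - u - z)
          (size-- {S = S - u} (inS⇒∈ {S = S - u} {z} z∈S) eq)) i (ℕₚ.<-trans (ℕₚ.n<1+n k) lt)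
      coeff : ∀ i → k <ℕ suc i → M S (suc i) ≈ θ * M (S - u) (suc i) + M (S - u) i
      coeff i lt = trans (at (M-vertex S u u∈S) (suc i)) (trans (+-cong (x-⊛-suc (M (S - u)) i)
        (trans (-‿cong (degree-sum N degN (suc i) lt)) -0#≈0#)) (+-identityʳ _))
      lead : M S (suc k) ≈ 1#
      lead = trans (coeff k ℕₚ.≤-refl) (trans (+-cong (trans (*-congˡ (proj₂ ih (suc k) ℕₚ.≤-refl)) (zeroʳ θ)) (proj₁ ih))
               (+-identityˡ 1#))
      deg : Degree≤ (suc k) (M S)
      deg (suc i) (s≤s lt) = trans (coeff i (ℕₚ.m≤n⇒m≤1+n lt))
        (trans (+-cong (trans (*-congˡ (proj₂ ih (suc i) (ℕₚ.m≤n⇒m≤1+n lt))) (zeroʳ θ)) (proj₂ ih i lt)) (+-identityˡ 0#))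

    M-ord : ∀ S → ∃[ k ] Ord (M S) k
    M-ord S = ≉0⇒ord (M S) ∣ S ∣ (λ z → 1≉0 (trans (sym (proj₁ (M-monic ∣ S ∣ S ≡-refl))) z))

-- The path identity and the effect of moving one weight

module Rayleigh (ℝ : RealNumbers) {n : ℕ} (E : Adj n) where
  open RealNumbers ℝ hiding (zero; _-_)
  open RealSeries ℝ
  open SeriesSums ℝ
  open SetoidReasoning Ser.setoid

  same : (M : Subset n → Series) {S T : Subset n} → S ≡ T → M S ≋ M T
  same M eq = Ser.reflexive (≡-cong M eq)

  D : (Subset n → Series) → Subset n → Fin n → Fin n → Series
  D M S u v = M (S - u) ⊛ M (S - v) ⊞ (⊟ (M S ⊛ M (S - u - v)))

  neighbour-- : ∀ S u v z → z ≢ v → (inS (S - v - u) z ∧ E u z) ≡ (inS (S - u) z ∧ E u z)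
  neighbour-- S u v z z≢v rewrite inS-- (S - v) u z | inS-- S v z | inS-- S u z | ≢⇒≡ᵇ-false z≢v
                                | ∧-identityʳ (inS S z) = ≡-refl

  neighbour-self : ∀ S u v → (inS (S - v - u) v ∧ E u v) ≡ false
  neighbour-self S u v rewrite inS-- (S - v) u v | inS-- S v v | ≡ᵇ-refl v | ∧-zeroʳ (inS S v) = ≡-refl

  module _ {y : Fin n → Series} {M : Subset n → Series} (rec : Recursive E y M) where

    -- Expanding `M S` and `M (S - v)` at `u` eliminates the weight and leaves a term for each
    -- neighbour `z`: z = v completes a path and leaves a square, any other `z` continues the path
    -- in S - u. Iterated, this is the Heilmann-Lieb path identity.
    D-vertex : ∀ S u v → u ∈ S → u ≢ v → D M S u v ≋ sum (λ z → when (inS (S - u) z ∧ E u z)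
      (if z ≡ᵇ v then M (S - u - v) ⊛ M (S - u - v) else D M (S - u) z v))
    D-vertex S u v u∈S u≢v = begin
      A ⊛ M (S - v) ⊞ (⊟ (M S ⊛ V))
        ≈⟨ Ser.+-cong (Ser.*-congˡ {A} recV) (Ser.-‿cong (Ser.*-congʳ {V} (rec S u u∈S))) ⟩
      A ⊛ (y u ⊛ V ⊞ (⊟ sum C)) ⊞ (⊟ ((y u ⊛ A ⊞ (⊟ sum B)) ⊛ V))
        ≈⟨ SI.rayleigh-step (y u) A V (sum B) (sum C) ⟩
      sum B ⊛ V ⊞ (⊟ (A ⊛ sum C))
        ≈⟨ Ser.+-cong (SerSum.*-distribʳ-sum V B) (Ser.-‿cong (SerSum.*-distribˡ-sum A C)) ⟩
      sum (λ z → B z ⊛ V) ⊞ (⊟ sum (λ z → A ⊛ C z))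
        ≈⟨ sum-difference (λ z → B z ⊛ V) (λ z → A ⊛ C z) ⟩
      sum (λ z → B z ⊛ V ⊞ (⊟ (A ⊛ C z)))
        ≈⟨ SerSum.sum-cong-≋ part ⟩
      sum (λ z → when (c z) (if z ≡ᵇ v then V ⊛ V else D M (S - u) z v)) ∎
      where
      A = M (S - u)
      V = M (S - u - v)
      c : Fin n → Bool
      c z = inS (S - u) z ∧ E u z
      B C : Fin n → Series
      B z = when (c z) (M (S - u - z))
      C z = when (inS (S - v - u) z ∧ E u z) (M (S - v - u - z))
      recV : M (S - v) ≋ y u ⊛ V ⊞ (⊟ sum C)
      recV = Ser.trans (rec (S - v) u (∈-- u∈S u≢v))
        (Ser.+-congʳ {⊟ sum C} (Ser.*-congˡ {y u} (same M (p─x─y≡p─y─x S v u))))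
      part : ∀ z → B z ⊛ V ⊞ (⊟ (A ⊛ C z)) ≋ when (c z) (if z ≡ᵇ v then V ⊛ V else D M (S - u) z v)
      part z with z ≟F v
      ... | yes ≡-refl rewrite neighbour-self S u z = begin
        when (c z) V ⊛ V ⊞ (⊟ (A ⊛ 0ₛ)) ≈⟨ Ser.+-congˡ {when (c z) V ⊛ V} (Ser.trans (Ser.-‿cong (Ser.zeroʳ A)) (when-⊟ false 0ₛ)) ⟩
        when (c z) V ⊛ V ⊞ 0ₛ           ≈⟨ Ser.+-identityʳ _ ⟩
        when (c z) V ⊛ V                ≈⟨ when-⊛ʳ (c z) V V ⟩
        when (c z) (V ⊛ V)              ∎
      ... | no z≢v rewrite neighbour-- S u v z z≢v = begin
        when (c z) (M (S - u - z)) ⊛ V ⊞ (⊟ (A ⊛ when (c z) (M (S - v - u - z))))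
          ≈⟨ Ser.+-cong (when-⊛ʳ (c z) (M (S - u - z)) V) (Ser.-‿cong (when-⊛ˡ (c z) A (M (S - v - u - z)))) ⟩
        when (c z) (M (S - u - z) ⊛ V) ⊞ (⊟ when (c z) (A ⊛ M (S - v - u - z)))
          ≈⟨ when-difference (c z) (M (S - u - z) ⊛ V) (A ⊛ M (S - v - u - z)) ⟩
        when (c z) (M (S - u - z) ⊛ V ⊞ (⊟ (A ⊛ M (S - v - u - z))))
          ≈⟨ when-cong (c z) (Ser.+-congˡ {M (S - u - z) ⊛ V} (Ser.-‿cong (Ser.*-congˡ {A} (same M
               (≡-trans (≡-cong (_- z) (p─x─y≡p─y─x S v u)) (p─x─y≡p─y─x (S - u) v z)))))) ⟩
        when (c z) (D M (S - u) z v) ∎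

    D-cone-sized : ∀ k S u v → ∣ S ∣ ≡ k → u ∈ S → v ∈ S → u ≢ v → Cone (D M S u v)
    D-cone-sized zero S u v size u∈S with ≡-trans (≡-sym size) (∣-∣ u∈S)
    ... | ()
    D-cone-sized (suc k) S u v size u∈S v∈S u≢v =
      cone-cong (Ser.sym (D-vertex S u v u∈S u≢v)) (cone-sum _ (λ z → cone-when (inS (S - u) z ∧ E u z) (part z)))
      where
      part : ∀ z → (inS (S - u) z ∧ E u z) ≡ true →
        Cone (if z ≡ᵇ v then M (S - u - v) ⊛ M (S - u - v) else D M (S - u) z v)
      part z cz with z ≟F v
      ... | yes ≡-refl = cone-square (M (S - u - z))
      ... | no z≢v = D-cone-sized k (S - u) z v
        (ℕₚ.suc-injective (≡-trans (≡-sym (∣-∣ u∈S)) size)) (inS⇒∈ (proj₁ (∧-split cz))) (∈-- v∈S (u≢v ∘ ≡-sym)) z≢v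

    D-cone : ∀ {S u v} → u ∈ S → v ∈ S → u ≢ v → Cone (D M S u v)
    D-cone {S} {u} {v} = D-cone-sized ∣ S ∣ S u v ≡-refl

    -- The family obtained by adding s to the weight of w
    module _ (w : Fin n) (s : Series) where

      -- The weighted matching polynomial is affine in the weight of `w`, with slope `M (S - w)`.
      -- The closed form therefore suffices, and positivity of `D` carries over through
      -- `shift-recursive`.
      shift : Subset n → Series
      shift S = M S ⊞ when (inS S w) (s ⊛ M (S - w))

      shifted : Fin n → Series
      shifted u = y u ⊞ when (u ≡ᵇ w) s

      shift-in : ∀ S → inS S w ≡ true → shift S ≋ M S ⊞ s ⊛ M (S - w)
      shift-in S eq rewrite eq = Ser.refl

      shift-out : ∀ S → inS S w ≡ false → shift S ≋ M S
      shift-out S eq rewrite eq = Ser.+-identityʳ _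

      out-- : ∀ S u → inS S w ≡ false → inS (S - u) w ≡ false
      out-- S u eq rewrite inS-- S u w | eq = ≡-refl

      out-self : ∀ S → inS (S - w) w ≡ false
      out-self S rewrite inS-- S w w | ≡ᵇ-refl w = ∧-zeroʳ _

      in-- : ∀ S u → inS S w ≡ true → w ≢ u → inS (S - u) w ≡ true
      in-- S u eq ne rewrite inS-- S u w | eq | ≢⇒≡ᵇ-false ne = ≡-refl

      shift-recursive : Recursive E shifted shift
      shift-recursive S u u∈S with u ≟F w | inS S w in w∈S
      ... | yes ≡-refl | false with ≡-trans (≡-sym w∈S) (∈⇒inS u∈S)
      ...   | ()
      shift-recursive S u u∈S | yes ≡-refl | true = begin
        M S ⊞ s ⊛ M (S - u)
          ≈⟨ Ser.+-congʳ {s ⊛ M (S - u)} (rec S u u∈S) ⟩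
        (y u ⊛ M (S - u) ⊞ (⊟ sum N)) ⊞ s ⊛ M (S - u)
          ≈⟨ SI.shift-self (y u) (M (S - u)) s (sum N) ⟩
        (y u ⊞ s) ⊛ M (S - u) ⊞ (⊟ sum N)
          ≈⟨ Ser.+-cong (Ser.*-congˡ {y u ⊞ s} (shift-out (S - u) (out-self S)))
               (Ser.-‿cong (SerSum.sum-cong-≋ (λ z → when-cong (inS (S - u) z ∧ E u z) (shift-out (S - u - z) (out-- (S - u) z (out-self S)))))) ⟨
        (y u ⊞ s) ⊛ shift (S - u) ⊞ (⊟ sum (λ z → when (inS (S - u) z ∧ E u z) (shift (S - u - z)))) ∎
        where
        N : Fin n → Series
        N z = when (inS (S - u) z ∧ E u z) (M (S - u - z))
      shift-recursive S u u∈S | no u≢w | false = begin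
        M S ⊞ 0ₛ
          ≈⟨ Ser.+-identityʳ (M S) ⟩
        M S
          ≈⟨ rec S u u∈S ⟩
        y u ⊛ M (S - u) ⊞ (⊟ sum N)
          ≈⟨ Ser.+-cong (Ser.*-cong (Ser.+-identityʳ (y u)) (shift-out (S - u) (out-- S u w∈S)))
               (Ser.-‿cong (SerSum.sum-cong-≋ (λ z → when-cong (inS (S - u) z ∧ E u z) (shift-out (S - u - z) (out-- (S - u) z (out-- S u w∈S)))))) ⟨
        (y u ⊞ 0ₛ) ⊛ shift (S - u) ⊞ (⊟ sum (λ z → when (inS (S - u) z ∧ E u z) (shift (S - u - z)))) ∎
        where
        N : Fin n → Series
        N z = when (inS (S - u) z ∧ E u z) (M (S - u - z))
      shift-recursive S u u∈S | no u≢w | true = begin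
        M S ⊞ s ⊛ M (S - w)
          ≈⟨ Ser.+-cong (rec S u u∈S) (Ser.*-congˡ {s} (rec (S - w) u (∈-- u∈S u≢w))) ⟩
        (y u ⊛ M (S - u) ⊞ (⊟ sum N)) ⊞ s ⊛ (y u ⊛ M (S - w - u) ⊞ (⊟ sum N′))
          ≈⟨ SI.shift-other (y u) (M (S - u)) (sum N) s (M (S - w - u)) (sum N′) ⟩
        y u ⊛ (M (S - u) ⊞ s ⊛ M (S - w - u)) ⊞ (⊟ (sum N ⊞ s ⊛ sum N′))
          ≈⟨ Ser.+-cong
               (Ser.*-cong (Ser.sym (Ser.+-identityʳ (y u))) (Ser.trans
                 (Ser.+-congˡ {M (S - u)} (Ser.*-congˡ {s} (same M (p─x─y≡p─y─x S w u))))
                 (Ser.sym (shift-in (S - u) (in-- S u w∈S (u≢w ∘ ≡-sym))))))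
               (Ser.-‿cong (Ser.trans (Ser.+-congˡ {sum N} (SerSum.*-distribˡ-sum s N′))
                 (Ser.trans (Ser.sym (SerSum.∑-distrib-+ N (λ z → s ⊛ N′ z))) (SerSum.sum-cong-≋ part)))) ⟩
        (y u ⊞ 0ₛ) ⊛ shift (S - u) ⊞ (⊟ sum (λ z → when (inS (S - u) z ∧ E u z) (shift (S - u - z)))) ∎
        where
        c : Fin n → Bool
        c z = inS (S - u) z ∧ E u z
        N N′ : Fin n → Series
        N z = when (c z) (M (S - u - z))
        N′ z = when (inS (S - w - u) z ∧ E u z) (M (S - w - u - z))
        part : ∀ z → N z ⊞ s ⊛ N′ z ≋ when (c z) (shift (S - u - z))
        part z with z ≟F w
        -- For z = w the vertex `w` is missing both from S - w and from S - u - z, so neither side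
        -- carries a shift.
        ... | yes ≡-refl rewrite neighbour-self S u z = begin
          N z ⊞ s ⊛ 0ₛ                ≈⟨ Ser.trans (Ser.+-congˡ {N z} (Ser.zeroʳ s)) (Ser.+-identityʳ (N z)) ⟩
          N z                         ≈⟨ when-cong (c z) (shift-out (S - u - z) (out-self (S - u))) ⟨
          when (c z) (shift (S - u - z)) ∎
        ... | no z≢w rewrite neighbour-- S u w z z≢w = begin
          N z ⊞ s ⊛ when (c z) (M (S - w - u - z))
            ≈⟨ Ser.+-congˡ {N z} (when-⊛ˡ (c z) s (M (S - w - u - z))) ⟩
          N z ⊞ when (c z) (s ⊛ M (S - w - u - z))
            ≈⟨ when-⊞ (c z) (M (S - u - z)) (s ⊛ M (S - w - u - z)) ⟩
          when (c z) (M (S - u - z) ⊞ s ⊛ M (S - w - u - z))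
            ≈⟨ when-cong (c z) (Ser.trans (Ser.+-congˡ {M (S - u - z)} (Ser.*-congˡ {s} (same M
                 (≡-trans (≡-cong (_- z) (p─x─y≡p─y─x S w u)) (p─x─y≡p─y─x (S - u) w z)))))
                 (Ser.sym (shift-in (S - u - z) (in-- (S - u) z (in-- S u w∈S (u≢w ∘ ≡-sym)) (z≢w ∘ ≡-sym))))) ⟩
          when (c z) (shift (S - u - z)) ∎

-- The Wronskian and interlacing of multiplicities

module Multiplicity (ℝ : RealNumbers) {n : ℕ} (E : Adj n) (family : SeriesSums.DeletionFamily ℝ E) where
  open RealNumbers ℝ hiding (zero; _-_)
  open RealSeries ℝ
  open SeriesSums ℝ
  open DeletionFamily family
  open Poly ℝ using (fromℕ)
  open Rayleigh ℝ E
  open SetoidReasoning Ser.setoid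
  private module CI = Identities commRing

  ϑ-when : ∀ b f → ϑ (when b f) ≋ when b (ϑ f)
  ϑ-when true f = Ser.refl
  ϑ-when false f = ϑ-0ₛ

  ϑ-vertex : ∀ S u → u ∈ S → ϑ (M S) ≋ (ε ⊛ M (S - u) ⊞ x ⊛ ϑ (M (S - u))) ⊞
    (⊟ sum (λ z → when (inS (S - u) z ∧ E u z) (ϑ (M (S - u - z)))))
  ϑ-vertex S u u∈S = begin
    ϑ (M S)
      ≈⟨ ϑ-cong (rec S u u∈S) ⟩
    ϑ (x ⊛ p ⊞ (⊟ sum N))
      ≈⟨ ϑ-⊞ (x ⊛ p) (⊟ sum N) ⟩
    ϑ (x ⊛ p) ⊞ ϑ (⊟ sum N)
      ≈⟨ Ser.+-cong (Ser.trans (ϑ-⊛ x p) (Ser.+-congʳ {x ⊛ ϑ p} (Ser.*-congʳ {p} ϑx)))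
           (Ser.trans (ϑ-⊟ (sum N)) (Ser.-‿cong (Ser.trans (ϑ-sum N)
             (SerSum.sum-cong-≋ (λ z → ϑ-when (inS (S - u) z ∧ E u z) (M (S - u - z))))))) ⟩
    (ε ⊛ p ⊞ x ⊛ ϑ p) ⊞ (⊟ sum (λ z → when (inS (S - u) z ∧ E u z) (ϑ (M (S - u - z))))) ∎
    where
    p = M (S - u)
    N : Fin n → Series
    N z = when (inS (S - u) z ∧ E u z) (M (S - u - z))

  W : Subset n → Fin n → Series
  W S u = M (S - u) ⊛ ϑ (M S) ⊞ (⊟ (M S ⊛ ϑ (M (S - u))))

  W-vertex : ∀ S u → u ∈ S → W S u ≋ ε ⊛ (M (S - u) ⊛ M (S - u)) ⊞
    sum (λ z → when (inS (S - u) z ∧ E u z) (W (S - u) z))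
  W-vertex S u u∈S = begin
    p ⊛ ϑ (M S) ⊞ (⊟ (M S ⊛ ϑ p))
      ≈⟨ Ser.+-cong (Ser.*-congˡ {p} (ϑ-vertex S u u∈S)) (Ser.-‿cong (Ser.*-congʳ {ϑ p} (rec S u u∈S))) ⟩
    p ⊛ ((ε ⊛ p ⊞ x ⊛ ϑ p) ⊞ (⊟ sum N′)) ⊞ (⊟ ((x ⊛ p ⊞ (⊟ sum N)) ⊛ ϑ p))
      ≈⟨ SI.wronskian-step ε x p (ϑ p) (sum N) (sum N′) ⟩
    ε ⊛ (p ⊛ p) ⊞ (sum N ⊛ ϑ p ⊞ (⊟ (p ⊛ sum N′)))
      ≈⟨ Ser.+-congˡ {ε ⊛ (p ⊛ p)} (Ser.trans
           (Ser.+-cong (SerSum.*-distribʳ-sum (ϑ p) N) (Ser.-‿cong (SerSum.*-distribˡ-sum p N′)))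
           (Ser.trans (sum-difference (λ z → N z ⊛ ϑ p) (λ z → p ⊛ N′ z)) (SerSum.sum-cong-≋ part))) ⟩
    ε ⊛ (p ⊛ p) ⊞ sum (λ z → when (c z) (W (S - u) z)) ∎
    where
    p = M (S - u)
    c : Fin n → Bool
    c z = inS (S - u) z ∧ E u z
    N N′ : Fin n → Series
    N z = when (c z) (M (S - u - z))
    N′ z = when (c z) (ϑ (M (S - u - z)))
    part : ∀ z → N z ⊛ ϑ p ⊞ (⊟ (p ⊛ N′ z)) ≋ when (c z) (W (S - u) z)
    part z = Ser.trans (Ser.+-cong (when-⊛ʳ (c z) (M (S - u - z)) (ϑ p))
        (Ser.-‿cong (when-⊛ˡ (c z) p (ϑ (M (S - u - z))))))
      (when-difference (c z) (M (S - u - z) ⊛ ϑ p) (p ⊛ ϑ (M (S - u - z))))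

  W-lex-sized : ∀ k S u → ∣ S ∣ ≡ k → u ∈ S → Lex (W S u)
  W-lex-sized zero S u size u∈S with ≡-trans (≡-sym size) (∣-∣ u∈S)
  ... | ()
  W-lex-sized (suc k) S u size u∈S = lex-cong (Ser.sym (W-vertex S u u∈S))
    (lex-⊞ (lex-ε (proj₁ (cone-square (M (S - u))))) (lex-sum _ (λ z → lex-when (inS (S - u) z ∧ E u z)
      (λ cz → W-lex-sized k (S - u) z (size-- u∈S size) (inS⇒∈ {S = S - u} {z} (proj₁ (∧-split cz)))))))

  W-lex : ∀ {S u} → u ∈ S → Lex (W S u)
  W-lex {S} {u} = W-lex-sized ∣ S ∣ S u ≡-refl

  W-vanish : ∀ S u → Vanish (m (S - u) +ℕ m S) (W S u)
  W-vanish S u = vanish-⊞ {f = M (S - u) ⊛ ϑ (M S)}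
    (vanish-⊛ (m (S - u)) (m S) (proj₁ (ord (S - u))) (vanish-ϑ (proj₁ (ord S))))
    (vanish-⊟ {f = M S ⊛ ϑ (M (S - u))} (≡-subst (λ k → Vanish k (M S ⊛ ϑ (M (S - u)))) (ℕₚ.+-comm (m S) (m (S - u)))
      (vanish-⊛ (m S) (m (S - u)) (proj₁ (ord S)) (vanish-ϑ (proj₁ (ord (S - u)))))))

  -- `W S u` vanishes to the sum of the orders of its two factors; its summands lie in `Lex` and
  -- cannot cancel, so each vanishes that far.
  W-split : ∀ {S u} → u ∈ S → Vanish (m (S - u) +ℕ m S) (ε ⊛ (M (S - u) ⊛ M (S - u))) ×
    (∀ z → Vanish (m (S - u) +ℕ m S) (when (inS (S - u) z ∧ E u z) (W (S - u) z)))
  W-split {S} {u} u∈S = proj₁ both , lex-sum-split _ lexes _ (proj₂ both)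
    where
    lexes : ∀ z → Lex (when (inS (S - u) z ∧ E u z) (W (S - u) z))
    lexes z = lex-when (inS (S - u) z ∧ E u z) (λ cz → W-lex {S - u} {z} (inS⇒∈ (proj₁ (∧-split cz))))
    both = lex-split (lex-ε (proj₁ (cone-square (M (S - u))))) (lex-sum _ lexes) (m (S - u) +ℕ m S)
      (vanish-cong (W-vertex S u u∈S) (W-vanish S u))

  -- The summand `ε` times the square of `M (S - u)` has order exactly 2 m (S - u) + 1, yet it
  -- vanishes to order m (S - u) + m S.
  interlace-upper : ∀ {S u} → u ∈ S → m S ≤ suc (m (S - u))
  interlace-upper {S} {u} u∈S = ℕₚ.+-cancelˡ-≤ (m (S - u)) (m S) (suc (m (S - u)))
    (ℕₚ.≤-trans (vanish≤ord (proj₁ (W-split u∈S)) square-ord) (ℕₚ.≤-reflexive (≡-sym (ℕₚ.+-suc _ _))))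
    where
    p = M (S - u)
    pp : Ord (p ⊛ p) (m (S - u) +ℕ m (S - u))
    pp = ord-⊛ (ord (S - u)) (ord (S - u))
    square-ord : Ord (ε ⊛ (p ⊛ p)) (suc (m (S - u) +ℕ m (S - u)))
    square-ord = vanish-ε (proj₁ pp) , λ eq → proj₂ pp (trans (sym (ε-⊛-suc (p ⊛ p) _)) eq)

  -- By `interlace-upper` inside S - u, every term of the vertex recursion at `u` vanishes to order
  -- m (S - u) - 1.
  interlace-lower : ∀ {S u} → u ∈ S → m (S - u) ≤ suc (m S)
  interlace-lower {S} {u} u∈S with m (S - u) in eq
  ... | zero = z≤n
  ... | suc i = s≤s (vanish≤ord (vanish-cong (Ser.sym (rec S u u∈S))
      (vanish-⊞ {f = x ⊛ M (S - u)} (vanish-⊛ʳ x (vanish-≤ (ℕₚ.≤-trans (ℕₚ.n≤1+n i) (ℕₚ.≤-reflexive (≡-sym eq))) (proj₁ (ord (S - u)))))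
        (vanish-⊟ {f = sum N} (vanish-sum N (λ z → vanish-when (inS (S - u) z ∧ E u z) (λ cz →
          vanish-≤ (ℕₚ.≤-pred (≡-subst (_≤ suc (m (S - u - z))) eq (interlace-upper {S - u} {z} (inS⇒∈ (proj₁ (∧-split cz))))))
            (proj₁ (ord (S - u - z))))))))) (ord S))
    where
    N : Fin n → Series
    N z = when (inS (S - u) z ∧ E u z) (M (S - u - z))

  -- Let l = m (S - w - z). The orders of the two series in `W (S - w) z` differ by one, so it has
  -- order exactly 2 l + 1. Being a summand of `W S w`, it vanishes to order l + 1 + m S; hence m S
  -- ≤ l.
  neighbour-essential⇒positive : ∀ {S w z} → w ∈ S → z ∈ S - w → E w z ≡ true →
    suc (m (S - w - z)) ≡ m (S - w) → suc (m S) ≡ m (S - w)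
  neighbour-essential⇒positive {S} {w} {z} w∈S z∈S Ewz ess = ℕₚ.≤-antisym
      (≡-subst (suc (m S) ≤_) ess (s≤s small)) (interlace-lower w∈S)
    where
    l = m (S - w - z)
    p = M (S - w - z)
    q = M (S - w)
    vp : Vanish l p
    vp = proj₁ (ord (S - w - z))
    oq : Ord q (suc l)
    oq = ≡-subst (Ord q) (≡-sym ess) (ord (S - w))
    coefficient : W (S - w) z (l +ℕ suc l) ≈ p l * q (suc l)
    coefficient = trans (+-cong (coeff-⊛ l (suc l) vp (vanish-ϑ (proj₁ oq)))
        (-‿cong (trans (⊛-comm q (ϑ p) (l +ℕ suc l)) (coeff-⊛ l (suc l) (vanish-ϑ vp) (proj₁ oq)))))
      (CI.euler-value (p l) (q (suc l)) (fromℕ l))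
    cz : (inS (S - w) z ∧ E w z) ≡ true
    cz rewrite ∈⇒inS z∈S | Ewz = ≡-refl
    vW : Vanish (m (S - w) +ℕ m S) (W (S - w) z)
    vW = ≡-subst (λ b → Vanish (m (S - w) +ℕ m S) (when b (W (S - w) z))) cz (proj₂ (W-split w∈S) z)
    oW : Ord (W (S - w) z) (l +ℕ suc l)
    oW = ≡-subst (λ k → Vanish (l +ℕ k) (W (S - w) z)) (≡-sym ess) (W-vanish (S - w) z) ,
         λ eq → *-≉0 (proj₂ (ord (S - w - z))) (proj₂ oq) (trans (sym coefficient) eq)
    small : m S ≤ l
    small = ℕₚ.+-cancelˡ-≤ (suc l) (m S) l (ℕₚ.≤-trans
      (≡-subst (λ k → k +ℕ m S ≤ l +ℕ suc l) (≡-sym ess) (vanish≤ord vW oW)) (ℕₚ.≤-reflexive (ℕₚ.+-suc l l)))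

  -- The derivative as a sum over vertex deletions

  sum-deltaₛ : ∀ {k} (u : Fin k) (f : Series) → sum (λ v → when (v ≡ᵇ u) f) ≋ f
  sum-deltaₛ {suc k} zero f = Ser.trans (Ser.+-congˡ {f} (SerSum.sum-replicate-zero k)) (Ser.+-identityʳ f)
  sum-deltaₛ (suc u) f = Ser.trans (Ser.+-identityˡ _) (sum-deltaₛ u f)

  sum-when : ∀ {k} b (f : Fin k → Series) → when b (sum f) ≋ sum (λ v → when b (f v))
  sum-when true f = Ser.refl
  sum-when {k} false f = Ser.sym (SerSum.sum-replicate-zero k)

  deletions : Subset n → Series
  deletions S = sum (λ v → when (inS S v) (M (S - v)))

  -- This is the vertex recursion differentiated. It arises by summing over `v` the recursions of S
  -- - v at `u`; v = u, where none applies, accounts for the extra `M (S - u)`.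
  deletions-vertex : ∀ S u → u ∈ S → deletions S ≋
    M (S - u) ⊞ (x ⊛ deletions (S - u) ⊞ (⊟ sum (λ z → when (inS (S - u) z ∧ E u z) (deletions (S - u - z)))))
  deletions-vertex S u u∈S = Ser.sym (begin
    p ⊞ (x ⊛ deletions (S - u) ⊞ (⊟ sum (λ z → when (c z) (deletions (S - u - z)))))
      ≈⟨ Ser.+-cong (Ser.sym (sum-deltaₛ u p)) (Ser.+-cong (SerSum.*-distribˡ-sum x d) (Ser.-‿cong
           (Ser.trans (SerSum.sum-cong-≋ (λ z → sum-when (c z) (λ v → when (inS (S - u - z) v) (M (S - u - z - v)))))
             (SerSum.∑-comm (λ z v → f v z))))) ⟩
    sum (λ v → when (v ≡ᵇ u) p) ⊞ (sum (λ v → x ⊛ d v) ⊞ (⊟ sum (λ v → sum (f v))))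
      ≈⟨ Ser.+-congˡ {sum (λ v → when (v ≡ᵇ u) p)} (sum-difference (λ v → x ⊛ d v) (λ v → sum (f v))) ⟩
    sum (λ v → when (v ≡ᵇ u) p) ⊞ sum (λ v → x ⊛ d v ⊞ (⊟ sum (f v)))
      ≈⟨ SerSum.∑-distrib-+ (λ v → when (v ≡ᵇ u) p) (λ v → x ⊛ d v ⊞ (⊟ sum (f v))) ⟨
    sum (λ v → when (v ≡ᵇ u) p ⊞ (x ⊛ d v ⊞ (⊟ sum (f v))))
      ≈⟨ SerSum.sum-cong-≋ part ⟩
    deletions S ∎)
    where
    p = M (S - u)
    c : Fin n → Bool
    c z = inS (S - u) z ∧ E u z
    d : Fin n → Series
    d v = when (inS (S - u) v) (M (S - u - v))
    f : Fin n → Fin n → Series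
    f v z = when (c z) (when (inS (S - u - z) v) (M (S - u - z - v)))
    vanishing : ∀ v → inS (S - u) v ≡ false → x ⊛ d v ⊞ (⊟ sum (f v)) ≋ 0ₛ
    vanishing v out = begin
      x ⊛ d v ⊞ (⊟ sum (f v))
        ≈⟨ Ser.+-cong (Ser.*-congˡ {x} dv) (Ser.-‿cong (sum-0 (f v) fv)) ⟩
      x ⊛ 0ₛ ⊞ (⊟ 0ₛ)
        ≈⟨ Ser.+-cong (Ser.zeroʳ x) (when-⊟ false 0ₛ) ⟩
      0ₛ ⊞ 0ₛ
        ≈⟨ Ser.+-identityˡ 0ₛ ⟩
      0ₛ ∎
      where
      dv : d v ≋ 0ₛ
      dv rewrite out = Ser.refl
      fv : ∀ z → f v z ≋ 0ₛ
      fv z rewrite inS-- (S - u) z v | out = when-0ₛ (c z)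
    part : ∀ v → when (v ≡ᵇ u) p ⊞ (x ⊛ d v ⊞ (⊟ sum (f v))) ≋ when (inS S v) (M (S - v))
    part v with v ≟F u
    ... | yes ≡-refl = begin
      p ⊞ (x ⊛ d v ⊞ (⊟ sum (f v)))  ≈⟨ Ser.+-congˡ {p} (vanishing v out) ⟩
      p ⊞ 0ₛ                         ≈⟨ Ser.+-identityʳ p ⟩
      p                              ≡⟨ ≡-cong (λ b → when b p) (∈⇒inS u∈S) ⟨
      when (inS S v) p               ∎
      where
      out : inS (S - v) v ≡ false
      out rewrite inS-- S v v | ≡ᵇ-refl v = ∧-zeroʳ _
    ... | no v≢u with inS S v in v∈S
    ...   | false = Ser.trans (Ser.+-identityˡ _) (vanishing v out)
      where
      out : inS (S - u) v ≡ false
      out rewrite inS-- S u v | v∈S = ≡-refl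
    ...   | true = begin
      0ₛ ⊞ (x ⊛ d v ⊞ (⊟ sum (f v)))
        ≈⟨ Ser.+-identityˡ _ ⟩
      x ⊛ d v ⊞ (⊟ sum (f v))
        ≈⟨ Ser.+-cong (Ser.*-congˡ {x} dv) (Ser.-‿cong (SerSum.sum-cong-≋ fv)) ⟩
      x ⊛ M (S - v - u) ⊞ (⊟ sum (λ z → when (inS (S - v - u) z ∧ E u z) (M (S - v - u - z))))
        ≈⟨ rec (S - v) u (∈-- u∈S (v≢u ∘ ≡-sym)) ⟨
      M (S - v) ∎
      where
      v∈S-u : inS (S - u) v ≡ true
      v∈S-u rewrite inS-- S u v | v∈S | ≢⇒≡ᵇ-false v≢u = ≡-refl
      dv : d v ≋ M (S - v - u)
      dv rewrite v∈S-u = same M (p─x─y≡p─y─x S u v)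
      fv : ∀ z → f v z ≋ when (inS (S - v - u) z ∧ E u z) (M (S - v - u - z))
      fv z with z ≟F v
      ... | yes ≡-refl rewrite neighbour-self S u z | inS-- (S - u) z z | ≡ᵇ-refl z | ∧-zeroʳ (inS (S - u) z) =
        when-0ₛ (c z)
      ... | no z≢v rewrite neighbour-- S u v z z≢v | inS-- (S - u) z v | v∈S-u | ≢⇒≡ᵇ-false (z≢v ∘ ≡-sym) =
        when-cong (c z) (same M (≡-trans (p─x─y≡p─y─x (S - u) z v) (≡-cong (_- z) (p─x─y≡p─y─x S u v))))

  euler-sized : ∀ k S → ∣ S ∣ ≡ k → ϑ (M S) ≋ ε ⊛ deletions S
  euler-sized k S size with nonempty? S
  euler-sized k S size | no empty = begin
    ϑ (M S)           ≈⟨ ϑ-cong (M-empty S (empty⇒∣∣≡0 empty)) ⟩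
    ϑ 1ₛ              ≈⟨ ϑ-const 1# ⟩
    0ₛ                ≈⟨ Ser.zeroʳ ε ⟨
    ε ⊛ 0ₛ            ≈⟨ Ser.*-congˡ {ε} (sum-0 _ none) ⟨
    ε ⊛ deletions S   ∎
    where
    none : ∀ v → when (inS S v) (M (S - v)) ≋ 0ₛ
    none v rewrite ∉⇒inS {S = S} {v} (λ v∈S → empty (v , v∈S)) = Ser.refl
  euler-sized zero S size | yes (u , u∈S) with ≡-trans (≡-sym size) (∣-∣ u∈S)
  ... | ()
  euler-sized (suc k) S size | yes (u , u∈S) = begin
    ϑ (M S)
      ≈⟨ ϑ-vertex S u u∈S ⟩
    (ε ⊛ p ⊞ x ⊛ ϑ p) ⊞ (⊟ sum (λ z → when (c z) (ϑ (M (S - u - z)))))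
      ≈⟨ Ser.+-cong (Ser.+-congˡ {ε ⊛ p} (Ser.*-congˡ {x} (euler-sized k (S - u) size′)))
           (Ser.-‿cong (Ser.trans (SerSum.sum-cong-≋ part)
             (Ser.sym (SerSum.*-distribˡ-sum ε (λ z → when (c z) (deletions (S - u - z))))))) ⟩
    (ε ⊛ p ⊞ x ⊛ (ε ⊛ deletions (S - u))) ⊞ (⊟ (ε ⊛ sum (λ z → when (c z) (deletions (S - u - z)))))
      ≈⟨ SI.derivative-step ε x p (deletions (S - u)) (sum (λ z → when (c z) (deletions (S - u - z)))) ⟩
    ε ⊛ (p ⊞ (x ⊛ deletions (S - u) ⊞ (⊟ sum (λ z → when (c z) (deletions (S - u - z))))))
      ≈⟨ Ser.*-congˡ {ε} (deletions-vertex S u u∈S) ⟨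
    ε ⊛ deletions S ∎
    where
    p = M (S - u)
    size′ : ∣ S - u ∣ ≡ k
    size′ = size-- u∈S size
    c : Fin n → Bool
    c z = inS (S - u) z ∧ E u z
    part : ∀ z → when (c z) (ϑ (M (S - u - z))) ≋ ε ⊛ when (c z) (deletions (S - u - z))
    part z with inS (S - u) z in z∈S | E u z
    ... | false | _ = Ser.sym (Ser.zeroʳ ε)
    ... | true | false = Ser.sym (Ser.zeroʳ ε)
    ... | true | true = go k size′
      where
      z∈ : z ∈ S - u
      z∈ = inS⇒∈ {S = S - u} {z} z∈S
      go : ∀ k → ∣ S - u ∣ ≡ k → ϑ (M (S - u - z)) ≋ ε ⊛ deletions (S - u - z)
      go zero eq = ⊥-elim (∣∣≡0⇒∉ eq z z∈)
      go (suc k) eq = euler-sized k (S - u - z) (size-- z∈ eq)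

  euler : ∀ S → ϑ (M S) ≋ ε ⊛ deletions S
  euler S = euler-sized ∣ S ∣ S ≡-refl

  -- The derivative of a series of order k + 1 has order exactly k, as k + 1 is nonzero in the
  -- field; so its summands `M (S - v)` cannot all vanish to order k + 1.
  some-deletion-smaller : ∀ S {k} → m S ≡ suc k → ¬ (∀ v → v ∈ S → suc k ≤ m (S - v))
  some-deletion-smaller S {k} mS large = *-≉0 (fromℕ-suc≉0 k) (proj₂ (≡-subst (Ord (M S)) mS (ord S))) coefficient
    where
    f : Fin n → Series
    f v = when (inS S v) (M (S - v))
    deleted : ∀ v → Vanish (suc k) (f v)
    deleted v = vanish-when (inS S v) {f = M (S - v)}
      (λ v∈S → vanish-≤ (large v (inS⇒∈ {S = S} {v} v∈S)) (proj₁ (ord (S - v))))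
    vanishing : Vanish (suc (suc k)) (ε ⊛ deletions S)
    vanishing = vanish-ε {f = deletions S} (vanish-sum f deleted)
    coefficient : fromℕ (suc k) * M S (suc k) ≈ 0#
    coefficient = trans (at (euler S) (suc k)) (vanishing (suc k) ℕₚ.≤-refl)

  exists-essential : ∀ S {k} → m S ≡ suc k → ∃[ z ] (z ∈ S × suc (m (S - z)) ≡ m S)
  exists-essential S {k} mS = decide (any? (λ z → (z ∈? S) ×-dec (suc (m (S - z)) ≟ℕ m S)))
    where
    decide : Dec (∃[ z ] (z ∈ S × suc (m (S - z)) ≡ m S)) → ∃[ z ] (z ∈ S × suc (m (S - z)) ≡ m S)
    decide (yes found) = found
    decide (no none) = ⊥-elim (some-deletion-smaller S mS (λ v v∈S → large v v∈S (ℕₚ.m≤n⇒m<n∨m≡n (interlace-upper v∈S))))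
      where
      large : ∀ v → v ∈ S → m S <ℕ suc (m (S - v)) ⊎ m S ≡ suc (m (S - v)) → suc k ≤ m (S - v)
      large v v∈S (inj₁ lt) = ≡-subst (_≤ m (S - v)) mS (ℕₚ.≤-pred lt)
      large v v∈S (inj₂ eq) = ⊥-elim (none (v , v∈S , ≡-sym eq))

  -- Excluded configurations and the stability of special vertices

  ord-⊞ˡ : ∀ {f g k} → Ord f k → Vanish (suc k) g → Ord (f ⊞ g) k
  ord-⊞ˡ {f} {g} {k} (v , ne) w = vanish-⊞ {f = f} v (vanish-≤ (ℕₚ.n≤1+n k) w) ,
    λ eq → ne (trans (sym (trans (+-congˡ (w k ℕₚ.≤-refl)) (+-identityʳ _))) eq)

  ord-⊞ʳ : ∀ {f g k} → Vanish (suc k) f → Ord g k → Ord (f ⊞ g) k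
  ord-⊞ʳ {f} {g} {k} w (v , ne) = vanish-⊞ {f = f} (vanish-≤ (ℕₚ.n≤1+n k) w) v ,
    λ eq → ne (trans (sym (trans (+-congʳ (w k ℕₚ.≤-refl)) (+-identityˡ _))) eq)

  ord-⊟ : ∀ {f k} → Ord f k → Ord (⊟ f) k
  ord-⊟ {f} {k} (v , ne) = vanish-⊟ {f = f} v ,
    λ eq → ne (trans (sym (-‿involutive (f k))) (trans (-‿cong eq) -0#≈0#))
    where open RingProperties ring using (-‿involutive; -0#≈0#)

  odd-order-impossible : ∀ {f} j → Cone f → ¬ Ord f (suc (j +ℕ j))
  odd-order-impossible j (_ , even) (v , ne) = ne (even j v)

  module _ {S : Subset n} {a b w : Fin n}
    (a∈S : a ∈ S) (b∈S : b ∈ S) (w∈S : w ∈ S) (a≢b : a ≢ b) (a≢w : a ≢ w) (b≢w : b ≢ w) where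

    -- When the weight of w is x + tε, the coefficient of D a b at p + q is a
    -- non-constant affine function of t, hence negative for some t.
    obstruction : ∀ k l p q → p +ℕ q ≡ suc k +ℕ l →
      Vanish (suc k) (M S) → Ord (M (S - w)) k →
      Vanish p (M (S - a)) → Vanish p (M (S - a - w)) →
      Vanish q (M (S - b)) → Vanish q (M (S - b - w)) →
      Ord (M (S - a - b)) l → Vanish l (M (S - a - b - w)) → ⊥
    obstruction k l p q index vS (vw , cw≉0) va vaw vb vbw (vab , d≉0) vabw =
      proj₁ (D-cone (shift-recursive rec w s) a∈S b∈S a≢b) (p +ℕ q) vD (<-respˡ (sym value) -1<0)
      where
      c cw d α β i t : Carrier
      c = M S (suc k)
      cw = M (S - w) k
      d = M (S - a - b) l
      α = M (S - a) p
      β = M (S - b) q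
      i = proj₁ (inverse (cw * d) (*-≉0 cw≉0 d≉0))
      -- The solution of α β - (c + t cw) d = -1.
      t = (α * β + 1# + - (c * d)) * i
      s : Series
      -- The factor `ε` lifts `M (S - w)` from order k to k + 1, so the shift reaches the
      -- coefficient `c`; in the other three series it enters only beyond the index that is read.
      s = const t ⊛ ε
      M′ : Subset n → Series
      M′ = shift rec w s
      s-⊛ : ∀ f j → (s ⊛ f) j ≈ t * (ε ⊛ f) j
      s-⊛ f j = trans (⊛-assoc (const t) ε f j) (const-⊛ t (ε ⊛ f) j)
      M′-coeff : ∀ T → w ∈ T → ∀ j → M′ T j ≈ M T j + t * (ε ⊛ M (T - w)) j
      M′-coeff T w∈T j = trans (at (shift-in rec w s T (∈⇒inS w∈T)) j) (+-congˡ (s-⊛ (M (T - w)) j))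
      M′-vanish : ∀ T → w ∈ T → ∀ j → Vanish j (M T) → Vanish j (ε ⊛ M (T - w)) → Vanish j (M′ T)
      M′-vanish T w∈T j v v′ i lt = trans (M′-coeff T w∈T i)
        (trans (+-cong (v i lt) (trans (*-congˡ (v′ i lt)) (zeroʳ t))) (+-identityˡ 0#))
      M′-same : ∀ T → w ∈ T → ∀ j → Vanish j (M (T - w)) → M′ T j ≈ M T j
      M′-same T w∈T j v = trans (M′-coeff T w∈T j) (trans
        (+-congˡ (trans (*-congˡ (vanish-ε {f = M (T - w)} v j ℕₚ.≤-refl)) (zeroʳ t))) (+-identityʳ _))
      raise : ∀ {j f} → Vanish j f → Vanish j (ε ⊛ f)
      raise {j} {f} v = vanish-≤ (ℕₚ.n≤1+n j) (vanish-ε {f = f} v)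
      w∈a : w ∈ S - a
      w∈a = ∈-- w∈S (a≢w ∘ ≡-sym)
      w∈b : w ∈ S - b
      w∈b = ∈-- w∈S (b≢w ∘ ≡-sym)
      w∈ab : w ∈ S - a - b
      w∈ab = ∈-- w∈a (b≢w ∘ ≡-sym)
      va′ : Vanish p (M′ (S - a))
      va′ = M′-vanish (S - a) w∈a p va (raise {f = M (S - a - w)} vaw)
      vb′ : Vanish q (M′ (S - b))
      vb′ = M′-vanish (S - b) w∈b q vb (raise {f = M (S - b - w)} vbw)
      vS′ : Vanish (suc k) (M′ S)
      vS′ = M′-vanish S w∈S (suc k) vS (vanish-ε {f = M (S - w)} vw)
      vab′ : Vanish l (M′ (S - a - b))
      vab′ = M′-vanish (S - a - b) w∈ab l vab (raise {f = M (S - a - b - w)} vabw)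
      vD : Vanish (p +ℕ q) (D M′ S a b)
      vD = vanish-⊞ {f = M′ (S - a) ⊛ M′ (S - b)} (vanish-⊛ p q va′ vb′)
        (vanish-⊟ {f = M′ S ⊛ M′ (S - a - b)} (≡-subst (λ j → Vanish j (M′ S ⊛ M′ (S - a - b))) (≡-sym index)
          (vanish-⊛ (suc k) l vS′ vab′)))
      first : (M′ (S - a) ⊛ M′ (S - b)) (p +ℕ q) ≈ α * β
      first = trans (coeff-⊛ p q va′ vb′) (*-cong (M′-same (S - a) w∈a p vaw) (M′-same (S - b) w∈b q vbw))
      second : (M′ S ⊛ M′ (S - a - b)) (p +ℕ q) ≈ (c + t * cw) * d
      second = ≡-subst (λ j → (M′ S ⊛ M′ (S - a - b)) j ≈ (c + t * cw) * d) (≡-sym index)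
        (trans (coeff-⊛ (suc k) l vS′ vab′) (*-cong
          (trans (M′-coeff S w∈S (suc k)) (+-congˡ (*-congˡ (ε-⊛-suc (M (S - w)) k))))
          (M′-same (S - a - b) w∈ab l vabw)))
      value : D M′ S a b (p +ℕ q) ≈ - 1#
      value = trans (+-cong first (-‿cong second))
        (CI.obstruction-value α β c cw d i (proj₂ (inverse (cw * d) (*-≉0 cw≉0 d≉0))))

  -- What must be excluded is m (S - u) = m S. With l = m (S - w), either m (S - u - w) = l, so `w`
  -- is essential in S - u and raises m (S - u) above m S, or it is larger and `D M S u w` has the
  -- odd order (l + 1) + l.
  neighbour-of-essential : ∀ {S u w} → u ∈ S → w ∈ S → u ≢ w → E u w ≡ true →
    suc (m (S - w)) ≡ m S → suc (m (S - u)) ≢ m S → m (S - u) ≡ suc (m S)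
  neighbour-of-essential {S} {u} {w} u∈S w∈S u≢w Euw ess not-ess =
    cases (ℕₚ.m≤n⇒m<n∨m≡n (interlace-lower u∈S)) (ℕₚ.m≤n⇒m<n∨m≡n (interlace-upper u∈S))
    where
    l = m (S - w)
    neutral⇒⊥ : m (S - u) ≡ m S → ⊥
    neutral⇒⊥ neutral = split (ℕₚ.m≤n⇒m<n∨m≡n
        (ℕₚ.≤-pred (≡-subst (_≤ suc (m (S - u - w))) mu (interlace-upper w∈S-u))))
      where
      w∈S-u : w ∈ S - u
      w∈S-u = ∈-- w∈S (u≢w ∘ ≡-sym)
      mu : m (S - u) ≡ suc l
      mu = ≡-trans neutral (≡-sym ess)
      split : l <ℕ m (S - u - w) ⊎ l ≡ m (S - u - w) → ⊥
      split (inj₂ eq) = ℕₚ.1+n≢n (≡-trans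
        (neighbour-essential⇒positive u∈S w∈S-u Euw (≡-trans (≡-cong suc (≡-sym eq)) (≡-sym mu))) neutral)
      split (inj₁ lt) = odd-order-impossible l (D-cone rec u∈S w∈S u≢w)
        (ord-⊞ˡ {M (S - u) ⊛ M (S - w)} (ord-⊛ (≡-subst (Ord (M (S - u))) mu (ord (S - u))) (ord (S - w)))
          (vanish-⊟ {f = M S ⊛ M (S - u - w)} (vanish-≤ (s≤s (ℕₚ.≤-reflexive (≡-sym (ℕₚ.+-suc l l))))
            (vanish-⊛ (suc l) (suc l) (proj₁ (≡-subst (Ord (M S)) (≡-sym ess) (ord S)))
              (vanish-≤ lt (proj₁ (ord (S - u - w))))))))
    cases : m (S - u) <ℕ suc (m S) ⊎ m (S - u) ≡ suc (m S) → m S <ℕ suc (m (S - u)) ⊎ m S ≡ suc (m (S - u)) →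
      m (S - u) ≡ suc (m S)
    cases (inj₂ eq) _ = eq
    cases (inj₁ lt) (inj₂ eq) = ⊥-elim (not-ess (≡-sym eq))
    cases (inj₁ lt) (inj₁ lt′) = ⊥-elim (neutral⇒⊥ (ℕₚ.≤-antisym (ℕₚ.≤-pred lt) (ℕₚ.≤-pred lt′)))

  -- Interlacing in S - w bounds the value from above, interlacing in S - a from below. Thus `w`
  -- stays essential once `a` is gone.
  essential-after-positive : ∀ {S a w} → a ∈ S → w ∈ S → a ≢ w →
    m (S - a) ≡ suc (m S) → suc (m (S - w)) ≡ m S → m (S - a - w) ≡ m S
  essential-after-positive {S} {a} {w} a∈S w∈S a≢w pos ess = ℕₚ.≤-antisym
    (≡-subst (λ j → m (S - a - w) ≤ j) ess
      (≡-subst (λ T → m T ≤ suc (m (S - w))) (p─x─y≡p─y─x S w a) (interlace-lower (∈-- a∈S a≢w))))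
    (ℕₚ.≤-pred (≡-subst (_≤ suc (m (S - a - w))) pos (interlace-upper (∈-- w∈S (a≢w ∘ ≡-sym)))))

  -- For k = m S interlacing leaves k, k + 1 and k + 2 for m (S - a - b). Parity excludes k + 1;
  -- excluding k takes the essential neighbour `w` of `a`.
  stability : ∀ {S a b w} → a ∈ S → b ∈ S → w ∈ S → a ≢ b → E a w ≡ true →
    m (S - a) ≡ suc (m S) → m (S - b) ≡ suc (m S) → suc (m (S - w)) ≡ m S →
    m (S - a - b) ≡ suc (m (S - a))
  stability {S} {a} {b} {w} a∈S b∈S w∈S a≢b Eaw pos-a pos-b ess =
    cases (ℕₚ.m≤n⇒m<n∨m≡n (interlace-lower b∈S-a))
    where
    k = m S
    ≢w : ∀ {v} → m (S - v) ≡ suc k → v ≢ w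
    ≢w pos ≡-refl = ℕₚ.<-irrefl ≡-refl (ℕₚ.<-trans (ℕₚ.≤-reflexive ess) (ℕₚ.≤-reflexive (≡-sym pos)))
    a≢w = ≢w pos-a
    b≢w = ≢w pos-b
    b∈S-a : b ∈ S - a
    b∈S-a = ∈-- b∈S (a≢b ∘ ≡-sym)
    a∈S-b : a ∈ S - b
    a∈S-b = ∈-- a∈S a≢b
    lower : k ≤ m (S - a - b)
    lower = ℕₚ.≤-pred (≡-subst (_≤ suc (m (S - a - b))) pos-a (interlace-upper b∈S-a))
    -- The product for S - a and S - b vanishes to order 2 k + 2, so `D` would have the order k + (k
    -- + 1) of the other product.
    neutral : m (S - a - b) ≡ suc k → ⊥
    neutral eq = odd-order-impossible k (D-cone rec a∈S b∈S a≢b)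
      (ord-⊞ʳ {M (S - a) ⊛ M (S - b)}
        (vanish-≤ (ℕₚ.≤-reflexive (≡-cong suc (≡-sym (ℕₚ.+-suc k k)))) (vanish-⊛ (suc k) (suc k)
          (proj₁ (≡-subst (Ord (M (S - a))) pos-a (ord (S - a)))) (proj₁ (≡-subst (Ord (M (S - b))) pos-b (ord (S - b))))))
        (ord-⊟ {M S ⊛ M (S - a - b)} (≡-subst (Ord (M S ⊛ M (S - a - b))) (ℕₚ.+-suc k k)
          (ord-⊛ (ord S) (≡-subst (Ord (M (S - a - b))) eq (ord (S - a - b)))))))
    essential : m (S - a - b) ≡ k → ⊥
    essential eq = split (ℕₚ.m≤n⇒m<n∨m≡n (≡-subst (_≤ suc (m (S - a - b - w))) eq (interlace-upper w∈S-a-b)))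
      where
      w∈S-a-b : w ∈ S - a - b
      w∈S-a-b = ∈-- (∈-- w∈S (a≢w ∘ ≡-sym)) (b≢w ∘ ≡-sym)
      swap : S - b - a ≡ S - a - b
      swap = p─x─y≡p─y─x S b a
      split : k <ℕ suc (m (S - a - b - w)) ⊎ k ≡ suc (m (S - a - b - w)) → ⊥
      -- If `w` is essential in S - b - a, its neighbour `a` forces m (S - b) = k - 1, against
      -- `pos-b`.
      split (inj₂ eq′) = ℕₚ.<-irrefl (≡-trans (≡-sym eq) (≡-trans (≡-cong m (≡-sym swap)) (≡-sym
          (neighbour-essential⇒positive a∈S-b (≡-subst (w ∈_) (≡-sym swap) w∈S-a-b) Eaw
            (≡-subst (λ T → suc (m (T - w)) ≡ m T) (≡-sym swap) (≡-trans (≡-sym eq′) (≡-sym eq)))))))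
        (≡-subst (λ j → k <ℕ suc j) (≡-sym pos-b) (ℕₚ.m≤n⇒m≤1+n ℕₚ.≤-refl))
      -- `M (S - a)` and `M (S - b)` have order k + 1 but are read at k: the comparison takes place
      -- at 2 k, the sum of the orders for S and S - a - b.
      split (inj₁ lt) = obstruction a∈S b∈S w∈S a≢b a≢w b≢w (m (S - w)) k k k (≡-cong (_+ℕ k) (≡-sym ess))
        (proj₁ (≡-subst (Ord (M S)) (≡-sym ess) (ord S))) (ord (S - w))
        (weaken pos-a) (proj₁ (≡-subst (Ord (M (S - a - w))) (essential-after-positive a∈S w∈S a≢w pos-a ess) (ord (S - a - w))))
        (weaken pos-b) (proj₁ (≡-subst (Ord (M (S - b - w))) (essential-after-positive b∈S w∈S b≢w pos-b ess) (ord (S - b - w))))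
        (≡-subst (Ord (M (S - a - b))) eq (ord (S - a - b)))
        (vanish-≤ (ℕₚ.≤-pred lt) (proj₁ (ord (S - a - b - w))))
        where
        weaken : ∀ {v} → m (S - v) ≡ suc k → Vanish k (M (S - v))
        weaken {v} pos = vanish-≤ (ℕₚ.≤-trans (ℕₚ.n≤1+n k) (ℕₚ.≤-reflexive (≡-sym pos))) (proj₁ (ord (S - v)))
    cases : m (S - a - b) <ℕ suc (m (S - a)) ⊎ m (S - a - b) ≡ suc (m (S - a)) → m (S - a - b) ≡ suc (m (S - a))
    cases (inj₂ eq) = eq
    cases (inj₁ lt) = ⊥-elim (cases′ (ℕₚ.m≤n⇒m<n∨m≡n lower))
      where
      upper : m (S - a - b) ≤ suc k
      upper = ≡-subst (m (S - a - b) ≤_) pos-a (ℕₚ.≤-pred lt)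
      cases′ : k <ℕ m (S - a - b) ⊎ k ≡ m (S - a - b) → ⊥
      cases′ (inj₁ lt′) = neutral (ℕₚ.≤-antisym upper lt′)
      cases′ (inj₂ eq) = essential (≡-sym eq)

  -- Gallai's lemma

  module _ (E-sym : ∀ i j → E i j ≡ E j i) where
    open Matching ℝ using (Walk; here; step)

    walk-start : ∀ {S u v} → Walk E S u v → u ∈ S
    walk-start (here u∈S) = u∈S
    walk-start (step u∈S _ _) = u∈S

    -- A walk ending in u from an essential vertex of H - u must leave the
    -- essential vertices of H - u before it reaches u.
    gallai-walk : ∀ {H} → (∀ v → v ∈ H → suc (m (H - v)) ≡ m H) → ∀ {u l} → u ∈ H → m (H - u) ≡ suc l →
      ∀ {v} → Walk E H v u → v ∈ H - u → suc (m (H - u - v)) ≡ m (H - u) → ⊥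
    gallai-walk crit u∈H mu (here _) v∈H-u _ = ∈-⇒≢ v∈H-u ≡-refl
    gallai-walk {H} crit {u} {l} u∈H mu {v} (step {y = y} v∈H Evy walk) v∈H-u ess = next (y ≟F u)
      where
      y∈H : y ∈ H
      y∈H = walk-start walk
      v≢u : v ≢ u
      v≢u = ∈-⇒≢ v∈H-u
      mH : m H ≡ suc (suc l)
      mH = ≡-trans (≡-sym (crit u u∈H)) (≡-cong suc mu)
      single : ∀ {z} → z ∈ H → m (H - z) ≡ suc l
      single z∈H = ℕₚ.suc-injective (≡-trans (crit _ z∈H) mH)
      never-positive : ∀ {z} → z ∈ H → suc (m H) ≡ m (H - z) → ⊥
      never-positive z∈H pos = ℕₚ.<-irrefl (≡-sym (≡-trans (≡-cong suc (≡-sym mH)) (≡-trans pos (single z∈H))))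
        (ℕₚ.m≤n⇒m≤1+n ℕₚ.≤-refl)
      leave : y ≢ u → suc (m (H - u - y)) ≢ m (H - u) → ⊥
      leave y≢u not-ess = pairs (v ≟F y)
        where
        y∈H-u : y ∈ H - u
        y∈H-u = ∈-- y∈H y≢u
        pairs : Dec (v ≡ y) → ⊥
        pairs (yes ≡-refl) = not-ess ess
        -- The weight of `y` is moved. The orders are l + 2 for H, l + 1 for H - v, H - u and H - y,
        -- and l for H - v - u, so both products in `D` meet at 2 l + 2.
        pairs (no v≢y) = obstruction v∈H u∈H y∈H v≢u v≢y (y≢u ∘ ≡-sym) (suc l) l (suc l) (suc l)
          (≡-cong suc (ℕₚ.+-suc l l))
          (proj₁ (≡-subst (Ord (M H)) mH (ord H))) (≡-subst (Ord (M (H - y))) (single y∈H) (ord (H - y)))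
          (proj₁ (≡-subst (Ord (M (H - v))) (single v∈H) (ord (H - v)))) (vanish-≤ large-vy (proj₁ (ord (H - v - y))))
          (proj₁ (≡-subst (Ord (M (H - u))) mu (ord (H - u)))) (vanish-≤ (ℕₚ.≤-trans (ℕₚ.n≤1+n _) (ℕₚ.≤-reflexive (≡-sym muy))) (proj₁ (ord (H - u - y))))
          (≡-subst (Ord (M (H - v - u))) mvu (ord (H - v - u))) (vanish-≤ large-vuy (proj₁ (ord (H - v - u - y))))
          where
          muy : m (H - u - y) ≡ suc (suc l)
          muy = ≡-trans (neighbour-of-essential y∈H-u v∈H-u (v≢y ∘ ≡-sym) (≡-trans (E-sym y v) Evy) ess not-ess) (≡-cong suc mu)
          mvu : m (H - v - u) ≡ l
          mvu = ≡-trans (≡-cong m (p─x─y≡p─y─x H v u)) (ℕₚ.suc-injective (≡-trans ess mu))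
          y∈H-v : y ∈ H - v
          y∈H-v = ∈-- y∈H (v≢y ∘ ≡-sym)
          large-vy : suc l ≤ m (H - v - y)
          large-vy = bigger (ℕₚ.m≤n⇒m<n∨m≡n (interlace-upper y∈H-v))
            where
            bigger : m (H - v) <ℕ suc (m (H - v - y)) ⊎ m (H - v) ≡ suc (m (H - v - y)) → suc l ≤ m (H - v - y)
            bigger (inj₁ lt) = ≡-subst (_≤ m (H - v - y)) (single v∈H) (ℕₚ.≤-pred lt)
            -- `y` essential in H - v would raise the multiplicity on deleting its neighbour `v`
            -- from H, but every vertex of H is essential.
            bigger (inj₂ eq) = ⊥-elim (never-positive v∈H (neighbour-essential⇒positive v∈H y∈H-v Evy (≡-sym eq)))
          large-vuy : l ≤ m (H - v - u - y)
          large-vuy = ≡-subst (λ T → l ≤ m T)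
            (≡-trans (p─x─y≡p─y─x (H - u) y v) (≡-cong (_- y) (p─x─y≡p─y─x H u v)))
            (ℕₚ.≤-trans (ℕₚ.n≤1+n l) (ℕₚ.≤-pred (≡-subst (_≤ suc (m (H - u - y - v))) muy
              (interlace-upper (∈-- v∈H-u v≢y)))))
      next : Dec (y ≡ u) → ⊥
      next (yes ≡-refl) = never-positive u∈H
        (neighbour-essential⇒positive u∈H v∈H-u (≡-trans (E-sym y v) Evy) ess)
      next (no y≢u) = decide (suc (m (H - u - y)) ≟ℕ m (H - u))
        where
        decide : Dec (suc (m (H - u - y)) ≡ m (H - u)) → ⊥
        decide (yes ess-y) = gallai-walk crit u∈H mu walk (∈-- y∈H y≢u) ess-y
        decide (no not-ess) = leave y≢u not-ess

    -- If m (H - u) were positive, H - u would have an essential vertex; connectivity supplies a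
    -- walk from there to `u`, which `gallai-walk` forbids.
    gallai : ∀ {H} → (∀ u v → u ∈ H → v ∈ H → Walk E H u v) → (∀ u → u ∈ H → suc (m (H - u)) ≡ m H) →
      ∀ {u} → u ∈ H → m H ≡ 1
    gallai {H} connected crit {u} u∈H = cases (m (H - u)) ≡-refl
      where
      cases : ∀ k → m (H - u) ≡ k → m H ≡ 1
      cases zero eq = ≡-trans (≡-sym (crit u u∈H)) (≡-cong suc eq)
      cases (suc l) eq = ⊥-elim (found (exists-essential (H - u) eq))
        where
        found : ∃[ z ] (z ∈ H - u × suc (m (H - u - z)) ≡ m (H - u)) → ⊥
        found (z , z∈H-u , ess) = gallai-walk crit u∈H eq (connected z u (∈-⇒∈ z∈H-u) u∈H) z∈H-u ess

  -- Multiplicativity over separated vertex sets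

  module _ (C : Subset n) where

    Separated : Subset n → Set
    Separated S = ∀ i j → i ∈ S → j ∈ S → i ∈ C → j ∉ C → E i j ≡ false

    separated-- : ∀ {S} u → Separated S → Separated (S - u)
    separated-- u sep i j i∈S j∈S = sep i j (∈-⇒∈ i∈S) (∈-⇒∈ j∈S)

    -- Only vertices of `C` are expanded; `Separated` keeps their neighbours inside `C`, so
    -- `M (S ∩ ∁ C)` remains a common factor of the whole recursion.
    product-sized : ∀ k S → ∣ S ∩ C ∣ ≡ k → Separated S → M S ≋ M (S ∩ C) ⊛ M (S ∩ ∁ C)
    product-sized zero S size sep = Ser.sym (begin
      M (S ∩ C) ⊛ M (S ∩ ∁ C) ≈⟨ Ser.*-cong (M-empty (S ∩ C) size) (same M (∩∁-disjoint S C size)) ⟩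
      1ₛ ⊛ M S                ≈⟨ Ser.*-identityˡ (M S) ⟩
      M S                     ∎)
    product-sized (suc k) S size sep = remove (∣∣≡suc⇒∃ (S ∩ C) size)
      where
      Q = M (S ∩ ∁ C)
      remove : ∃[ u ] u ∈ S ∩ C → M S ≋ M (S ∩ C) ⊛ Q
      remove (u , u∈SC) = begin
        M S
          ≈⟨ rec S u u∈S ⟩
        x ⊛ M (S - u) ⊞ (⊟ sum (λ z → when (inS (S - u) z ∧ E u z) (M (S - u - z))))
          ≈⟨ Ser.+-cong (Ser.*-congˡ {x} (Ser.trans (product-sized k (S - u) (≡-trans (≡-cong ∣_∣ (-∩ S C u)) size′) (separated-- u sep))
               (Ser.*-cong (same M (-∩ S C u)) (same M (-∩∁ S C u∈C)))))
               (Ser.-‿cong (Ser.trans (SerSum.sum-cong-≋ part) (Ser.sym (SerSum.*-distribʳ-sum Q N)))) ⟩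
        x ⊛ (M (S ∩ C - u) ⊛ Q) ⊞ (⊟ (sum N ⊛ Q))
          ≈⟨ SI.product-step x (M (S ∩ C - u)) Q (sum N) ⟩
        (x ⊛ M (S ∩ C - u) ⊞ (⊟ sum N)) ⊛ Q
          ≈⟨ Ser.*-congʳ {Q} (rec (S ∩ C) u u∈SC) ⟨
        M (S ∩ C) ⊛ Q ∎
        where
        u∈S : u ∈ S
        u∈S = proj₁ (x∈p∩q⁻ S C u∈SC)
        u∈C : u ∈ C
        u∈C = proj₂ (x∈p∩q⁻ S C u∈SC)
        size′ : ∣ S ∩ C - u ∣ ≡ k
        size′ = size-- u∈SC size
        N : Fin n → Series
        N z = when (inS (S ∩ C - u) z ∧ E u z) (M (S ∩ C - u - z))
        sets : ∀ z → (S - u - z) ∩ C ≡ S ∩ C - u - z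
        sets z = ≡-trans (-∩ (S - u) C z) (≡-cong (_- z) (-∩ S C u))
        factor : ∀ z → z ∈ S ∩ C - u → M (S - u - z) ≋ M (S ∩ C - u - z) ⊛ Q
        factor z z∈ = shrink k size′
          where
          z∈C : z ∈ C
          z∈C = proj₂ (x∈p∩q⁻ S C (∈-⇒∈ z∈))
          shrink : ∀ k → ∣ S ∩ C - u ∣ ≡ k → M (S - u - z) ≋ M (S ∩ C - u - z) ⊛ Q
          shrink zero eq = ⊥-elim (∣∣≡0⇒∉ eq z z∈)
          shrink (suc j) eq = Ser.trans (product-sized j (S - u - z) (≡-trans (≡-cong ∣_∣ (sets z)) (size-- z∈ eq))
              (separated-- z (separated-- u sep)))
            (Ser.*-cong (same M (sets z)) (same M (≡-trans (-∩∁ (S - u) C z∈C) (-∩∁ S C u∈C))))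
        part : ∀ z → when (inS (S - u) z ∧ E u z) (M (S - u - z)) ≋ N z ⊛ Q
        part z = by-membership (z ∈? C)
          where
          member : inS (S ∩ C - u) z ≡ inS (S - u) z ∧ inS C z
          member = ≡-trans (≡-cong (λ T → inS T z) (≡-sym (-∩ S C u))) (inS-∩ (S - u) C z)
          by-membership : Dec (z ∈ C) → when (inS (S - u) z ∧ E u z) (M (S - u - z)) ≋ N z ⊛ Q
          by-membership (yes z∈C) = by-value (inS (S ∩ C - u) z ∧ E u z) ≡-refl
            where
            agree : (inS (S - u) z ∧ E u z) ≡ (inS (S ∩ C - u) z ∧ E u z)
            agree = ≡-cong (_∧ E u z) (≡-sym (≡-trans member
              (≡-trans (≡-cong (inS (S - u) z ∧_) (∈⇒inS z∈C)) (∧-identityʳ _))))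
            by-value : ∀ b → (inS (S ∩ C - u) z ∧ E u z) ≡ b → when (inS (S - u) z ∧ E u z) (M (S - u - z)) ≋ N z ⊛ Q
            by-value true eq rewrite agree | eq = factor z (inS⇒∈ {S = S ∩ C - u} {z} (proj₁ (∧-split eq)))
            by-value false eq rewrite agree | eq = Ser.sym (Ser.zeroˡ Q)
          by-membership (no z∉C) = Ser.trans (Ser.reflexive (≡-cong (λ b → when b (M (S - u - z))) left))
            (Ser.sym (Ser.trans (Ser.*-congʳ {Q} (Ser.reflexive (≡-cong (λ b → when b (M (S ∩ C - u - z))) right))) (Ser.zeroˡ Q)))
            where
            right : (inS (S ∩ C - u) z ∧ E u z) ≡ false
            right = ≡-cong (_∧ E u z) (≡-trans member (≡-trans (≡-cong (inS (S - u) z ∧_) (∉⇒inS z∉C)) (∧-zeroʳ _)))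
            left : (inS (S - u) z ∧ E u z) ≡ false
            left = by-S (z ∈? (S - u))
              where
              by-S : Dec (z ∈ S - u) → (inS (S - u) z ∧ E u z) ≡ false
              by-S (yes z∈) = ≡-trans (≡-cong (inS (S - u) z ∧_) (sep u z u∈S (∈-⇒∈ z∈) u∈C z∉C)) (∧-zeroʳ _)
              by-S (no z∉) = ≡-cong (_∧ E u z) (∉⇒inS z∉)

    m-product : ∀ {S} → Separated S → m S ≡ m (S ∩ C) +ℕ m (S ∩ ∁ C)
    m-product {S} sep = ord-unique (ord S) (ord-cong (Ser.sym (product-sized ∣ S ∩ C ∣ S ≡-refl sep))
      (ord-⊛ (ord (S ∩ C)) (ord (S ∩ ∁ C))))

  -- Removing special vertices and restoring joined ones

  module _ (A : Subset n) where

    -- Being special in a form that survives the removal of other special vertices: deletion raises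
    -- the multiplicity, in place of "not essential", and an essential neighbour is kept on record.
    AllSpecial : Subset n → Set
    AllSpecial S = ∀ b → b ∈ S → b ∈ A →
      m (S - b) ≡ suc (m S) × ∃[ w ] (w ∈ S × E b w ≡ true × suc (m (S - w)) ≡ m S)

    remove-special : ∀ {S a} → a ∈ S → a ∈ A → AllSpecial S → AllSpecial (S - a)
    remove-special {S} {a} a∈S a∈A special b b∈S-a b∈A = result (special a a∈S a∈A) (special b b∈S b∈A)
      where
      b∈S : b ∈ S
      b∈S = ∈-⇒∈ b∈S-a
      a≢b : a ≢ b
      a≢b = ∈-⇒≢ b∈S-a ∘ ≡-sym
      Spec : Fin n → Subset n → Set
      Spec v T = m (T - v) ≡ suc (m T) × ∃[ w ] (w ∈ T × E v w ≡ true × suc (m (T - w)) ≡ m T)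
      result : Spec a S → Spec b S → Spec b (S - a)
      result (pos-a , w , w∈S , Eaw , ess) (pos-b , w′ , w′∈S , Ebw′ , ess′) =
        stability a∈S b∈S w∈S a≢b Eaw pos-a pos-b ess ,
        w′ , ∈-- w′∈S (a≢w′ ∘ ≡-sym) , Ebw′ ,
        ≡-trans (≡-cong suc (essential-after-positive a∈S w′∈S a≢w′ pos-a ess′)) (≡-sym pos-a)
        where
        a≢w′ : a ≢ w′
        a≢w′ ≡-refl = ℕₚ.<-irrefl ≡-refl (ℕₚ.<-trans (ℕₚ.≤-reflexive ess′) (ℕₚ.≤-reflexive (≡-sym pos-a)))

    remove-all-special : ∀ k S → ∣ S ∩ A ∣ ≡ k → AllSpecial S → m (S ∩ ∁ A) ≡ k +ℕ m S
    remove-all-special zero S size special = ≡-cong m (∩∁-disjoint S A size)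
    remove-all-special (suc k) S size special = remove (∣∣≡suc⇒∃ (S ∩ A) size)
      where
      remove : ∃[ a ] a ∈ S ∩ A → m (S ∩ ∁ A) ≡ suc k +ℕ m S
      remove (a , a∈SA) = ≡-trans (≡-cong m (≡-sym (-∩∁ S A a∈A)))
        (≡-trans (remove-all-special k (S - a) (≡-trans (≡-cong ∣_∣ (-∩ S A a)) (size-- a∈SA size))
          (remove-special a∈S a∈A special))
          (≡-trans (≡-cong (k +ℕ_) (proj₁ (special a a∈S a∈A))) (ℕₚ.+-suc k (m S))))
        where
        a∈S = proj₁ (x∈p∩q⁻ S A a∈SA)
        a∈A = proj₂ (x∈p∩q⁻ S A a∈SA)

    module _ (joined : ∀ a z → a ∈ A → a ≢ z → E a z ≡ true) where

      -- The bound `k ≤ m (S ∩ ∁ A)` keeps the multiplicity positive until the last vertex of `A`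
      -- returns; so an essential vertex is always available, and joining makes it a neighbour.
      add-joined : ∀ k S → ∣ S ∩ A ∣ ≡ k → k ≤ m (S ∩ ∁ A) → m S +ℕ k ≡ m (S ∩ ∁ A)
      add-joined zero S size _ = ≡-trans (ℕₚ.+-identityʳ (m S)) (≡-cong m (≡-sym (∩∁-disjoint S A size)))
      add-joined (suc k) S size large = remove (∣∣≡suc⇒∃ (S ∩ A) size)
        where
        remove : ∃[ a ] a ∈ S ∩ A → m S +ℕ suc k ≡ m (S ∩ ∁ A)
        remove (a , a∈SA) = ≡-trans (ℕₚ.+-suc (m S) k) (≡-trans (≡-cong (_+ℕ k) (drop (m (S - a)) ≡-refl)) ih)
          where
          a∈S = proj₁ (x∈p∩q⁻ S A a∈SA)
          a∈A = proj₂ (x∈p∩q⁻ S A a∈SA)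
          sets : (S - a) ∩ ∁ A ≡ S ∩ ∁ A
          sets = -∩∁ S A a∈A
          ih : m (S - a) +ℕ k ≡ m (S ∩ ∁ A)
          ih = ≡-trans (add-joined k (S - a) (≡-trans (≡-cong ∣_∣ (-∩ S A a)) (size-- a∈SA size))
                 (≡-subst (λ T → k ≤ m T) (≡-sym sets) (ℕₚ.≤-trans (ℕₚ.n≤1+n k) large))) (≡-cong m sets)
          drop : ∀ j → m (S - a) ≡ j → suc (m S) ≡ m (S - a)
          -- m (S - a) = 0 would make m (S ∩ ∁ A) equal to k, one less than assumed.
          drop zero eq = ⊥-elim (ℕₚ.<-irrefl ≡-refl
            (≡-subst (suc k ≤_) (≡-trans (≡-sym ih) (≡-cong (_+ℕ k) eq)) large))
          drop (suc j) eq = found (exists-essential (S - a) eq)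
            where
            found : ∃[ z ] (z ∈ S - a × suc (m (S - a - z)) ≡ m (S - a)) → suc (m S) ≡ m (S - a)
            found (z , z∈ , ess) = neighbour-essential⇒positive a∈S z∈ (joined a z a∈A (∈-⇒≢ z∈ ∘ ≡-sym)) ess

-- Adjacency in S_θ(G)

SAdj-sym : {n : ℕ} (ℝ : RealNumbers) (E : Adj n) → (∀ i j → E i j ≡ E j i) → (A : Subset n) →
  ∀ i j → Matching.SAdj ℝ E A i j ≡ Matching.SAdj ℝ E A j i
SAdj-sym ℝ E E-sym A i j rewrite ≡ᵇ-sym i j | E-sym i j | ∨-comm (inS A i) (inS A j) = ≡-refl

SAdj-joined : {n : ℕ} (ℝ : RealNumbers) (E : Adj n) (A : Subset n) →
  ∀ a z → a ∈ A → a ≢ z → Matching.SAdj ℝ E A a z ≡ true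
SAdj-joined ℝ E A a z a∈A a≢z rewrite ≢⇒≡ᵇ-false a≢z | ∈⇒inS a∈A = ∨-zeroʳ (E a z)

-- Equality of the edge lists themselves is what transfers matching counts; on the diagonal both
-- sides fail the test `i <? j`.
SAdj-edges : {n : ℕ} (ℝ : RealNumbers) (E : Adj n) (A R : Subset n) → (∀ i → i ∈ R → i ∉ A) →
  edges (Matching.SAdj ℝ E A) R ≡ edges E R
SAdj-edges {n} ℝ E A R avoid = concatMap-cong (λ i → concatMap-cong (λ j →
  ≡-cong (λ b → if b then (i , j) ∷ [] else []) (cond i j)) (allFin n)) (allFin n)
  where
  cond : ∀ i j → (does (i <? j) ∧ inS R i ∧ inS R j ∧ Matching.SAdj ℝ E A i j) ≡ (does (i <? j) ∧ inS R i ∧ inS R j ∧ E i j)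
  cond i j with i ≟F j
  ... | yes ≡-refl rewrite dec-false (i <? i) (ℕₚ.<-irrefl ≡-refl) = ≡-refl
  ... | no _ with inS R i in i∈R | inS R j in j∈R
  ...   | false | _ = ≡-refl
  ...   | true | false = ≡-refl
  ...   | true | true rewrite ∉⇒inS {S = A} (avoid i (inS⇒∈ i∈R)) | ∉⇒inS {S = A} (avoid j (inS⇒∈ j∈R))
                            | ∨-identityʳ (E i j) = ≡-refl

-- Multiplicities in a concrete graph and in its components

module Roots (ℝ : RealNumbers) (θ : RealNumbers.Carrier ℝ) where
  open RealSeries ℝ
  open SeriesSums ℝ using (DeletionFamily)
  open Taylor ℝ
  open Expansion ℝ θ
  open Matching ℝ

  ϑx : ϑ x ≋ ε
  ϑx = Ser.trans (ϑ-⊞ (const θ) ε) (Ser.trans (Ser.+-cong (ϑ-const θ) ϑ-ε) (Ser.+-identityˡ ε))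

  module Graph {n : ℕ} (E : Adj n) (E-sym : ∀ i j → E i j ≡ E j i) where
    open Family E E-sym public

    m : Subset n → ℕ
    m S = proj₁ (M-ord S)

    ord : ∀ S → Ord (M S) (m S)
    ord S = proj₂ (M-ord S)

    family : DeletionFamily E
    family = record { x = x ; ϑx = ϑx ; M = M ; rec = M-vertex ; M-empty = M-empty ; m = m ; ord = ord }

    open Multiplicity ℝ E family public

    mult⇒m : ∀ S {k} → Mult θ E S k → m S ≡ k
    mult⇒m S mult = ord-unique (ord S) (RootMult⇒Ord {f = μ E S} mult)

    m⇒mult : ∀ S {k} → m S ≡ k → Mult θ E S k
    m⇒mult S {k} eq = Ord⇒RootMult (μ E S) k (≡-subst (Ord (M S)) eq (ord S))

    essential⇒m : ∀ {S u} → Essential θ E S u → suc (m (S - u)) ≡ m S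
    essential⇒m {S} {u} (_ , k , multS , multS-u) = ≡-trans (≡-cong suc (mult⇒m (S - u) {k} multS-u)) (≡-sym (mult⇒m S {suc k} multS))

    m⇒essential : ∀ {S u} → u ∈ S → suc (m (S - u)) ≡ m S → Essential θ E S u
    m⇒essential {S} {u} u∈S eq = u∈S , m (S - u) , m⇒mult S (≡-sym eq) , m⇒mult (S - u) ≡-refl

    special⇒positive : ∀ {S b} → Special θ E S b →
      m (S - b) ≡ suc (m S) × ∃[ w ] (w ∈ S × E b w ≡ true × suc (m (S - w)) ≡ m S)
    special⇒positive {S} {b} (b∈S , not-ess , w , ess , Ebw) =
      neighbour-of-essential b∈S (proj₁ ess) (λ { ≡-refl → not-ess ess }) Ebw (essential⇒m ess) (not-ess ∘ m⇒essential b∈S) ,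
      w , proj₁ ess , Ebw , essential⇒m ess

    component-separated : ∀ {T C} → Component E T C → Separated C T
    component-separated {T} {C} (_ , _ , closed) i j _ j∈T i∈C j∉C = absent (E i j) ≡-refl
      where
      absent : ∀ b → E i j ≡ b → E i j ≡ false
      absent false eq = eq
      absent true eq = ⊥-elim (j∉C (closed i j i∈C j∈T eq))

    component-∩ : ∀ {T C} → Component E T C → T ∩ C ≡ C
    component-∩ {T} {C} (C⊆T , _) = lookup-ext eq
      where
      eq : ∀ i → inS (T ∩ C) i ≡ inS C i
      eq i rewrite inS-∩ T C i with inS C i in i∈C
      ... | false = ∧-zeroʳ (inS T i)
      ... | true = ≡-trans (∧-identityʳ (inS T i)) (∈⇒inS (C⊆T (inS⇒∈ i∈C)))

    m-component : ∀ {T C} → Component E T C → m T ≡ m C +ℕ m (T ∩ ∁ C)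
    m-component {T} {C} comp = ≡-trans (m-product C (component-separated comp))
      (≡-cong (λ K → m K +ℕ m (T ∩ ∁ C)) (component-∩ comp))

    critical⇒m≡1 : ∀ {H u} → Critical θ E H → u ∈ H → m H ≡ 1
    critical⇒m≡1 ((_ , _ , walks) , ess) = gallai E-sym walks (λ u u∈H → essential⇒m (ess u u∈H))

    delete-two : ∀ {T u v} → u ∈ T → v ∈ T → u ≢ v → m T ≤ suc (suc (m (T - u - v)))
    delete-two u∈T v∈T u≢v = ℕₚ.≤-trans (interlace-upper u∈T) (s≤s (interlace-upper (∈-- v∈T (u≢v ∘ ≡-sym))))

    -- Deleting `v` costs nothing: as m Q = 0, all of m T comes from outside Q, and that part is
    -- still a factor after the deletion. Deleting `u` then costs at most one.
    delete-from-Q : ∀ {T Q u v} → Component E T Q → m Q ≡ 0 → u ∈ T → v ∈ Q → u ≢ v → m T ≤ suc (m (T - v - u))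
    delete-from-Q {T} {Q} {u} {v} comp mQ u∈T v∈Q u≢v = ℕₚ.≤-trans first (interlace-upper (∈-- u∈T u≢v))
      where
      first : m T ≤ m (T - v)
      first = ℕₚ.≤-trans
        (ℕₚ.≤-reflexive (≡-trans (m-component comp) (≡-trans (≡-cong (_+ℕ m (T ∩ ∁ Q)) mQ) (≡-cong m (≡-sym (-∩∁ T Q v∈Q))))))
        (ℕₚ.≤-trans (ℕₚ.m≤n+m _ (m ((T - v) ∩ Q)))
          (ℕₚ.≤-reflexive (≡-sym (m-product Q (separated-- Q v (component-separated comp))))))

    -- By Gallai's lemma H contributes exactly 1 to m T, so even the loss of that whole contribution
    -- costs one; the part outside H is untouched.
    delete-from-H : ∀ {T H u v} → Component E T H → Critical θ E H → u ∈ H → v ∈ H → m T ≤ suc (m (T - u - v))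
    delete-from-H {T} {H} {u} {v} comp crit u∈H v∈H = ℕₚ.≤-trans
      (ℕₚ.≤-reflexive (≡-trans (m-component comp) (≡-trans (≡-cong (_+ℕ m (T ∩ ∁ H)) (critical⇒m≡1 crit u∈H))
        (≡-cong (suc ∘ m) (≡-sym (≡-trans (-∩∁ (T - u) H v∈H) (-∩∁ T H u∈H)))))))
      (s≤s (ℕₚ.≤-trans (ℕₚ.m≤n+m _ (m ((T - u - v) ∩ H)))
        (ℕₚ.≤-reflexive (≡-sym (m-product H (separated-- H v (separated-- H u (component-separated comp))))))))

  -- The two graphs carry separately obtained orders; they are compared through the expansion of
  -- `μ`, which depends only on the size of R and the edge list.
  same-edges⇒same-m : {n : ℕ} {E E′ : Adj n} (s : ∀ i j → E i j ≡ E j i) (s′ : ∀ i j → E′ i j ≡ E′ j i) (R : Subset n) →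
    edges E R ≡ edges E′ R → Graph.m E s R ≡ Graph.m E′ s′ R
  same-edges⇒same-m {E = E} {E′} s s′ R eq = ord-unique (Graph.ord E s R) (ord-cong
    (Ser.trans (taylor-μ E′ R) (Ser.trans (alternating-cong ∣ R ∣ (λ r → ≡-cong (λ L → count L r) (≡-sym eq)))
      (Ser.sym (taylor-μ E R)))) (Graph.ord E′ s′ R))

-- Vertex sets of the theorem and the final count

module _ {n : ℕ} where

  ∁-pair : (A : Subset n) (u v : Fin n) → ∁ (A ∪ ⁅ u ⁆ ∪ ⁅ v ⁆) ≡ ∁ A - u - v
  ∁-pair A u v = lookup-ext eq
    where
    eq : ∀ i → inS (∁ (A ∪ ⁅ u ⁆ ∪ ⁅ v ⁆)) i ≡ inS (∁ A - u - v) i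
    eq i rewrite inS-∁ (A ∪ ⁅ u ⁆ ∪ ⁅ v ⁆) i | inS-∪ A (⁅ u ⁆ ∪ ⁅ v ⁆) i | inS-∪ ⁅ u ⁆ ⁅ v ⁆ i
               | inS-⁅⁆ u i | inS-⁅⁆ v i | inS-- (∁ A - u) v i | inS-- (∁ A) u i | inS-∁ A i
      with inS A i | i ≡ᵇ u
    ... | true | _ = ≡-refl
    ... | false | true = ≡-refl
    ... | false | false = ≡-refl

  pair-∩ : (A : Subset n) (u v : Fin n) → u ∉ A → v ∉ A → ∁ (⁅ u ⁆ ∪ ⁅ v ⁆) ∩ A ≡ A
  pair-∩ A u v u∉A v∉A = lookup-ext eq
    where
    eq : ∀ i → inS (∁ (⁅ u ⁆ ∪ ⁅ v ⁆) ∩ A) i ≡ inS A i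
    eq i rewrite inS-∩ (∁ (⁅ u ⁆ ∪ ⁅ v ⁆)) A i | inS-∁ (⁅ u ⁆ ∪ ⁅ v ⁆) i | inS-∪ ⁅ u ⁆ ⁅ v ⁆ i
               | inS-⁅⁆ u i | inS-⁅⁆ v i with i ≟F u | i ≟F v
    ... | yes ≡-refl | _ = ≡-sym (∉⇒inS u∉A)
    ... | no _ | yes ≡-refl = ≡-sym (∉⇒inS v∉A)
    ... | no _ | no _ = ≡-refl

  pair-∩∁ : (A : Subset n) (u v : Fin n) → ∁ (⁅ u ⁆ ∪ ⁅ v ⁆) ∩ ∁ A ≡ ∁ (A ∪ ⁅ u ⁆ ∪ ⁅ v ⁆)
  pair-∩∁ A u v = lookup-ext eq
    where
    eq : ∀ i → inS (∁ (⁅ u ⁆ ∪ ⁅ v ⁆) ∩ ∁ A) i ≡ inS (∁ (A ∪ ⁅ u ⁆ ∪ ⁅ v ⁆)) i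
    eq i rewrite inS-∩ (∁ (⁅ u ⁆ ∪ ⁅ v ⁆)) (∁ A) i | inS-∁ (⁅ u ⁆ ∪ ⁅ v ⁆) i | inS-∁ A i
               | inS-∁ (A ∪ ⁅ u ⁆ ∪ ⁅ v ⁆) i | inS-∪ A (⁅ u ⁆ ∪ ⁅ v ⁆) i with inS A i | inS (⁅ u ⁆ ∪ ⁅ v ⁆) i
    ... | true | true = ≡-refl
    ... | true | false = ≡-refl
    ... | false | true = ≡-refl
    ... | false | false = ≡-refl

  ⊤∩ : (A : Subset n) → ⊤ ∩ A ≡ A
  ⊤∩ A = lookup-ext (λ i → ≡-trans (inS-∩ ⊤ A i) (≡-cong (_∧ inS A i) (inS-⊤ i)))

theorem4p7 :
    (ℝ : RealNumbers) (θ : RealNumbers.Carrier ℝ) {n : ℕ} (G : SimpleGraph n) →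
    let open Matching ℝ
        E = SimpleGraph.adj G
    in
    (A : Subset n) →
    -- A is A_θ(G), the set of θ-special vertices of G
    (∀ w → (w ∈ A → Special θ E ⊤ w) × (Special θ E ⊤ w → w ∈ A)) →
    -- every component of G ∖ A_θ(G) is θ-critical (an H_i) or has mult 0 (a Q_j)
    (∀ C → Component E (∁ A) C → Critical θ E C ⊎ Mult θ E C 0) →
    (u v : Fin n) → ¬ (u ≡ v) →
    ( -- (a)
      (u ∉ A × ∃[ Q ] (Component E (∁ A) Q × Mult θ E Q 0 × v ∈ Q))
      -- (b)
    ⊎ ∃[ H ] (Component E (∁ A) H × Critical θ E H × u ∈ H × v ∈ H)
      -- (c)
    ⊎ (∃[ k ] (Mult θ E ⊤ k × 2 ≤ k) ×
       ∃[ H₁ ] ∃[ H₂ ] (Component E (∁ A) H₁ × Critical θ E H₁ ×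
                        Component E (∁ A) H₂ × Critical θ E H₂ ×
                        ¬ (H₁ ≡ H₂) × u ∈ H₁ × v ∈ H₂)) ) →
    -- mult(θ, S_θ(G) ∖ (A ∪ {u,v})) = mult(θ, S_θ(G) ∖ uv) + |A|
    ∃[ k ] ( Mult θ (SAdj E A) (∁ (⁅ u ⁆ ∪ ⁅ v ⁆)) k ×
             Mult θ (SAdj E A) (∁ (A ∪ ⁅ u ⁆ ∪ ⁅ v ⁆)) (k +ℕ ∣ A ∣) )
theorem4p7 ℝ θ {n} G A isA _ u v u≢v hyp =
  S.m F , S.m⇒mult F ≡-refl , S.m⇒mult R (≡-sym (≡-trans added (≡-cong S.m (pair-∩∁ A u v))))
  where
  open Matching ℝ
  open Roots ℝ θ
  E = SimpleGraph.adj G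
  E-sym = SimpleGraph.sym G
  module G = Graph E E-sym
  module S = Graph (SAdj E A) (SAdj-sym ℝ E E-sym A)
  F R : Subset n
  F = ∁ (⁅ u ⁆ ∪ ⁅ v ⁆)
  R = ∁ (A ∪ ⁅ u ⁆ ∪ ⁅ v ⁆)
  special : G.AllSpecial A ⊤
  special b _ b∈A = G.special⇒positive (proj₁ (isA b) b∈A)
  m-∁A : G.m (∁ A) ≡ ∣ A ∣ +ℕ G.m ⊤
  m-∁A = ≡-trans (≡-cong G.m (≡-sym (⊤∩ (∁ A))))
    (G.remove-all-special A ∣ A ∣ ⊤ (≡-cong ∣_∣ (⊤∩ A)) special)
  outside : (u ∉ A × v ∉ A)
  outside = from hyp
    where
    from : _ → u ∉ A × v ∉ A
    from (inj₁ (u∉A , _ , (Q⊆ , _) , _ , v∈Q)) = u∉A , x∈∁p⇒x∉p (Q⊆ v∈Q)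
    from (inj₂ (inj₁ (_ , (H⊆ , _) , _ , u∈H , v∈H))) = x∈∁p⇒x∉p (H⊆ u∈H) , x∈∁p⇒x∉p (H⊆ v∈H)
    from (inj₂ (inj₂ (_ , _ , _ , _ , (H₁⊆ , _) , _ , (H₂⊆ , _) , _ , _ , u∈H₁ , v∈H₂))) =
      x∈∁p⇒x∉p (H₁⊆ u∈H₁) , x∈∁p⇒x∉p (H₂⊆ v∈H₂)
  u∈∁A : u ∈ ∁ A
  u∈∁A = x∉p⇒x∈∁p (proj₁ outside)
  v∈∁A : v ∈ ∁ A
  v∈∁A = x∉p⇒x∈∁p (proj₂ outside)
  -- If A is empty there is nothing to show. Otherwise a special vertex has an essential neighbour,
  -- so m of G is at least 1 and makes up for the one that is lost.
  one-lost : G.m (∁ A) ≤ suc (G.m (∁ A - u - v)) → ∣ A ∣ ≤ G.m (∁ A - u - v)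
  one-lost le = by-size ∣ A ∣ ≡-refl
    where
    by-size : ∀ k → ∣ A ∣ ≡ k → ∣ A ∣ ≤ G.m (∁ A - u - v)
    by-size zero eq = ≡-subst (_≤ G.m (∁ A - u - v)) (≡-sym eq) z≤n
    by-size (suc k) eq = some (∣∣≡suc⇒∃ A eq)
      where
      some : ∃[ a ] a ∈ A → ∣ A ∣ ≤ G.m (∁ A - u - v)
      some (a , a∈A) = ℕₚ.≤-pred (ℕₚ.≤-trans (ℕₚ.≤-reflexive (≡-sym (ℕₚ.+-comm ∣ A ∣ 1)))
        (ℕₚ.≤-trans (ℕₚ.+-monoʳ-≤ ∣ A ∣ (pos (special a ∈⊤ a∈A))) (ℕₚ.≤-trans (ℕₚ.≤-reflexive (≡-sym m-∁A)) le)))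
        where
        pos : G.m (⊤ - a) ≡ suc (G.m ⊤) × ∃[ w ] (w ∈ ⊤ × E a w ≡ true × suc (G.m (⊤ - w)) ≡ G.m ⊤) → 1 ≤ G.m ⊤
        pos (_ , _ , _ , _ , eq) = ≡-subst (1 ≤_) eq (s≤s z≤n)
  bound : ∣ A ∣ ≤ G.m (∁ A - u - v)
  bound = by-case hyp
    where
    by-case : _ → ∣ A ∣ ≤ G.m (∁ A - u - v)
    by-case (inj₁ (_ , Q , comp , mQ , v∈Q)) = one-lost (≡-subst (λ T → G.m (∁ A) ≤ suc (G.m T))
      (p─x─y≡p─y─x (∁ A) v u) (G.delete-from-Q comp (G.mult⇒m Q mQ) u∈∁A v∈Q u≢v))
    by-case (inj₂ (inj₁ (H , comp , crit , u∈H , v∈H))) = one-lost (G.delete-from-H comp crit u∈H v∈H)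
    -- Two deletions cost at most two, which mult(θ, G) ≥ 2 covers.
    by-case (inj₂ (inj₂ (k , (mult , 2≤k) , _))) = ℕₚ.≤-pred (ℕₚ.≤-pred (ℕₚ.≤-trans
      (ℕₚ.≤-reflexive (≡-sym (ℕₚ.+-comm ∣ A ∣ 2))) (ℕₚ.≤-trans
        (ℕₚ.+-monoʳ-≤ ∣ A ∣ (≡-subst (2 ≤_) (≡-sym (G.mult⇒m ⊤ mult)) 2≤k))
        (ℕₚ.≤-trans (ℕₚ.≤-reflexive (≡-sym m-∁A)) (G.delete-two u∈∁A v∈∁A u≢v)))))
  R-avoids : ∀ i → i ∈ R → i ∉ A
  R-avoids i i∈R = x∈∁p⇒x∉p (∈-⇒∈ (∈-⇒∈ (≡-subst (i ∈_) (∁-pair A u v) i∈R)))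
  -- The bound is obtained in G but needed in S_θ(G); once A is removed the two graphs coincide.
  m-R : S.m R ≡ G.m (∁ A - u - v)
  m-R = ≡-trans (same-edges⇒same-m (SAdj-sym ℝ E E-sym A) E-sym R (SAdj-edges ℝ E A R R-avoids)) (≡-cong G.m (∁-pair A u v))
  added : S.m F +ℕ ∣ A ∣ ≡ S.m (F ∩ ∁ A)
  added = S.add-joined A (SAdj-joined ℝ E A) ∣ A ∣ F (≡-cong ∣_∣ (pair-∩ A u v (proj₁ outside) (proj₂ outside)))
    (ℕₚ.≤-trans bound (ℕₚ.≤-reflexive (≡-trans (≡-sym m-R) (≡-cong S.m (≡-sym (pair-∩∁ A u v))))))
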